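{- Let $k$ be a positive integer and let $n\geq 36k^4$. If $G$ is a connected graph with $n$ vertices and at most $n\left(1+\frac{1}{204k^3+126k^2}\right)$ edges, then $$r(G,F_k)=2n-1.$$
   Context: All graphs are finite and simple. For graphs $G$ and $H$, the Ramsey number $r(G,H)$ is the smallest positive integer $N$ such that every red-blue coloring of the edges of the complete graph $K_N$ contains a red subgraph isomorphic to $G$ or a blue subgraph isomorphic to $H$. The fan $F_k$ is the graph consisting of $k$ triangles sharing one common vertex, i.e. $F_k=K_1+kK_2$ (a single vertex joined to all vertices of a matching with $k$ edges). -}

module Defs where

open import Data.Nat using (ℕ; zero; suc; _+_; _*_; _≤_; _<_; _≡ᵇ_; _<ᵇ_)
open import Data.Nat.Properties using (≡ᵇ⇒≡; m≢1+m+n)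
open import Data.Bool using (Bool; true; false; _∧_; _∨_; not; T)
open import Data.Bool.Properties using (∨-comm; ∧-inverseʳ)
open import Data.Fin using (Fin; toℕ)
open import Data.List using (List; length; filter; allFin; concatMap; map)
open import Data.Product using (Σ; ∃; _×_; _,_)
open import Function.Definitions using (Injective)
open import Relation.Binary.PropositionalEquality using (_≡_; refl; trans)
open import Relation.Nullary using (¬_)
open import Relation.Nullary.Decidable using (T?)

record Graph (n : ℕ) : Set where
  field
    adj    : Fin n → Fin n → Bool
    adj-sym : ∀ u v → adj u v ≡ adj v u
    irrefl : ∀ v → adj v v ≡ false
open Graph public

edgeCount : ∀ {n} → Graph n → ℕ
edgeCount {n} G =
  length (filter (λ p → T? (Data.Product.proj₁ p))
    (concatMap (λ i → map (λ j → (((toℕ i) <ᵇ (toℕ j)) ∧ adj G i j) , j) (allFin n)) (allFin n)))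

data Reachable {n} (G : Graph n) : Fin n → Fin n → Set where
  here : ∀ {v} → Reachable G v v
  step : ∀ {u v w} → adj G u v ≡ true → Reachable G v w → Reachable G u w

Connected : ∀ {n} → Graph n → Set
Connected {n} G = ∀ (u v : Fin n) → Reachable G u v

-- A red-blue colouring of the edges of K_N (true = red, false = blue);
-- only the values on pairs of distinct vertices matter.
record Colouring (N : ℕ) : Set where
  field
    colour : Fin N → Fin N → Bool
    csym   : ∀ x y → colour x y ≡ colour y x
open Colouring public

ContainsMono : ∀ {N m} → Colouring N → Bool → Graph m → Set
ContainsMono {N} {m} c b H =
  Σ (Fin m → Fin N) λ f → Injective _≡_ _≡_ f ×
    (∀ u v → adj H u v ≡ true → colour c (f u) (f v) ≡ b)

Arrows : ∀ {n m} → ℕ → Graph n → Graph m → Set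
Arrows N G H = ∀ (c : Colouring N) → ContainsMono c true G Data.Sum.⊎ ContainsMono c false H
  where import Data.Sum

RamseyNumberIs : ∀ {n m} → Graph n → Graph m → ℕ → Set
RamseyNumberIs G H R = Arrows R G H × (∀ M → 1 ≤ M → M < R → ¬ Arrows M G H)

-- The fan F_k = K_1 + k K_2 on vertex set Fin (1 + 2k):
-- vertex 0 is the centre, and vertex i (1 ≤ i ≤ k) is matched with i + k.
fanRel : ℕ → ℕ → ℕ → Bool
fanRel k a b = ((a ≡ᵇ 0) ∧ not (b ≡ᵇ 0)) ∨ (not (a ≡ᵇ 0) ∧ (b ≡ᵇ a + k))

private
  noSelf : ∀ k a → (a ≡ᵇ a + suc k) ≡ false
  noSelf k a with a ≡ᵇ a + suc k in eq
  ... | false = refl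
  ... | true  = Data.Empty.⊥-elim (m≢1+m+n a (trans (≡ᵇ⇒≡ a (a + suc k) (subst' eq)) (Data.Nat.Properties.+-suc a k)))
    where
      import Data.Empty
      import Data.Nat.Properties
      subst' : ∀ {x} → x ≡ true → T x
      subst' refl = _

  fanIrr : ∀ k a → (fanRel (suc k) a a ∨ fanRel (suc k) a a) ≡ false
  fanIrr k a with a ≡ᵇ 0
  ... | true  = refl
  ... | false rewrite noSelf k a = refl

fan : (k : ℕ) → Graph (suc (k + k))
fan zero = record { adj = λ _ _ → false ; adj-sym = λ _ _ → refl ; irrefl = λ _ → refl }
fan (suc k) = record
  { adj    = λ u v → fanRel (suc k) (toℕ u) (toℕ v) ∨ fanRel (suc k) (toℕ v) (toℕ u)
  ; adj-sym = λ u v → ∨-comm (fanRel (suc k) (toℕ u) (toℕ v)) _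
  ; irrefl = λ v → fanIrr k (toℕ v)
  }

{-# OPTIONS --safe #-}
module Submission where

open import Defs
open import Data.Nat using (ℕ; _+_; _*_; _^_; _≤_; _∸_)

-- Idea.  Without a blue F_k, the blue neighbourhood of a vertex has no blue matching of size k, so it
-- is a red clique up to 2(k - 1) vertices.  Fix such a colouring of K_{2n-1}, and let H be connected
-- with m ≤ n vertices and at most m + ℓ edges, where ℓ is the excess of G.  By induction on m, H is red:
--  * If n vertices consist of a red clique and fewer than 2k vertices with few blue neighbours in
--    it, H fits: its vertices outside the clique are chosen independent and of small degree.
--  * If H has 2k - 1 leaves and all blue degrees are below n, one leaf is removed and reinserted.
--    Otherwise there is a red clique A of order at least n - 2k + 2.  Either the parents of the leaves
--    can be put on vertices of A with blue degree below n, and the leaves are added greedily, or nearly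
--    all of A is joined in blue to a second such clique, and one of the two absorbs enough vertices.
--  * If H has a suspended path with 4k² inner vertices, it is shortened by one vertex.  If no vertex
--    y outside the copy of the shortened graph can be inserted, the successors of the red
--    neighbours of y on the path form a blue clique joined to y, so y has fewer than 2k of them.  Hence
--    the vertices outside span no blue matching of size k, and they form an almost clique as above.
--  * Otherwise H consists of few vertices of degree ≠ 2 joined by short paths, so m is at most about
--    n / 2, and H is embedded greedily, its vertices of large degree being put in a red clique.

-- Both reductions, deleting a leaf and suppressing a vertex of degree 2, remove one vertex and at
-- least one edge, so connectedness and the excess bound `ℓ` survive. The order `n` and the host
-- with `N = 2n - 1` vertices stay fixed while `m` decreases: a copy of a reduced graph then misses
-- at least `n` vertices of the host, which is the room for an almost clique of order `n`. To keep
-- the types fixed as well, every graph lives on `Fin n` and carries the list `L` of its actual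
-- vertices. Throughout, `j = k - 1`. The bound on the edges is used as `330 k² ℓ ≤ n`, from
-- `204 + 126 = 330` and `k³ ≥ k²`. With at most `2j` leaves, at most `8j + 6ℓ` edges leave the
-- vertices of degree ≠ 2 (counted at each end), and each is followed for at most `4k²` vertices;
-- the two lower bounds on `n` make the resulting `m` small enough for a greedy embedding. The last
-- two cases of the overview argue from the absence of a red copy; this is constructively sound
-- because the existence of a copy is decided by exhaustive search.

-- Numerical inequalities

module Arithmetic where

  open import Data.List using ([]; _∷_)
  open import Data.Nat using (zero; suc; _<_; z≤n; s≤s)
  open import Data.Nat.Properties
  open import Data.Nat.Tactic.RingSolver using (solve-∀; solve)
  open import Data.Product using (_×_; _,_)
  open import Relation.Binary.PropositionalEquality

  -- x ≤ y is a positive combination of the hypotheses and c is the slack; both sides are moved so that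
  -- the equation is a semiring identity.
  lin : ∀ {a b x y} c → x ≤ y → a + y + c ≡ b + x → a ≤ b
  lin {a} {b} {x} {y} c h e = ≤-trans (m≤m+n a c)
    (+-cancelʳ-≤ y (a + c) b (≤-trans (≤-reflexive (trans (swap a c y) e)) (+-monoʳ-≤ b h)))
    where
    swap : ∀ a c y → a + c + y ≡ a + y + c
    swap = solve-∀

  infixl 6 _⊕_
  infixl 7 _⊛_
  _⊕_ : ∀ {x y x′ y′} → x ≤ y → x′ ≤ y′ → x + x′ ≤ y + y′
  _⊕_ = +-mono-≤

  _⊛_ : ∀ k {x y} → x ≤ y → k * x ≤ k * y
  k ⊛ h = *-monoʳ-≤ k h

  infixl 7 _⊛ʳ_
  _⊛ʳ_ : ∀ {x y} → x ≤ y → ∀ k → x * k ≤ y * k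
  h ⊛ʳ k = *-monoˡ-≤ k h

  slot : ∀ l r d → r ≤ d → suc (l + r) ≤ d + suc l
  slot l r d h = lin 0 h (solve (l ∷ r ∷ d ∷ []))

  -- At most `2(L + ℓ)/5` vertices have degree at least 5, so about three fifths of `L` are left as
  -- candidates for an independent set of size `r`, which needs five candidates per vertex.
  low-degree-count : ∀ low hi L ℓ r j n A → L ≤ low + hi → 5 * hi ≤ 2 * (L + ℓ) → r + A ≤ L → n ≤ A + 2 * j →
    r ≤ 2 * j → 330 * ℓ ≤ n → 36 * suc j ≤ n → 5 * r ≤ low
  low-degree-count low hi L ℓ r j n A e1 e2 e3 e4 e5 e6 e7 = *-cancelˡ-≤ 5
    (lin (328 * ℓ + 72 + 22 * j) (5 ⊛ e1 ⊕ e2 ⊕ 3 ⊛ e3 ⊕ 3 ⊛ e4 ⊕ 22 ⊛ e5 ⊕ e6 ⊕ 2 ⊛ e7)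
      (solve (low ∷ hi ∷ L ∷ ℓ ∷ r ∷ j ∷ n ∷ A ∷ [])))

  -- The term `5r` counts independent vertices and their neighbours; `3kr` counts the clique
  -- vertices that are blue to one of the `r` vertices outside.
  room-in-clique : ∀ r j n A → r ≤ 2 * j → n ≤ A + 2 * j → 36 * (suc j * suc j) ≤ n → r * 5 + r * (3 * suc j) ≤ A
  room-in-clique r j n A e1 e2 e3 =
    lin (36 + 54 * j + 30 * j * j) (e1 ⊛ʳ (5 + 3 * suc j) ⊕ e2 ⊕ e3) (solve (r ∷ j ∷ n ∷ A ∷ []))

  blue-degree-vs-clique : ∀ D a j → D ≤ a + 2 * j → 6 * suc j ≤ D → 2 * D ≤ 3 * a
  blue-degree-vs-clique D a j h g = lin 6 (3 ⊛ h ⊕ g) (solve (D ∷ a ∷ j ∷ []))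

  high-degree-few : ∀ s a E → s * suc E ≤ a * E → s ≤ a
  high-degree-few s a E h = ≮⇒≥ λ a<s →
    n≮0 {0} (lin {x = suc a * suc E} (a + E) (≤-trans (a<s ⊛ʳ suc E) h) (solve (a ∷ s ∷ E ∷ [])))

  -- The chain is `2dD ≤ 3ad ≤ 3E ≤ 6(m + ℓ)`, hence `q + dD < m + 3(m + ℓ)`.
  greedy-room : ∀ q d D a E m ℓ N → 2 * D ≤ 3 * a → a * d ≤ E → E ≤ 2 * (m + ℓ) → q < m → 4 * m + 3 * ℓ ≤ N → q + d * D < N
  greedy-room q d D a E m ℓ N h1 h2 h3 h4 h5 = *-cancelˡ-≤ 2
    (lin 0 (d ⊛ h1 ⊕ 3 ⊛ h2 ⊕ 3 ⊛ h3 ⊕ 2 ⊛ h4 ⊕ 2 ⊛ h5) (solve (q ∷ d ∷ D ∷ a ∷ E ∷ m ∷ ℓ ∷ N ∷ [])))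

  one-leaf-room : ∀ q n N → suc N ≡ 2 * n → q < n → q + 1 * (n ∸ 1) < N
  one-leaf-room q zero N e ()
  one-leaf-room q (suc n) N e h = room n h e
    where
    room : ∀ n → q < suc n → suc N ≡ 2 * suc n → suc (q + 1 * n) ≤ N
    room n h e = lin 0 (h ⊕ ≤-reflexive (sym e)) (solve (q ∷ n ∷ N ∷ []))

  core-fits : ∀ core lv m n A j → core + lv ≤ m → m ≤ n → lv ≡ suc (2 * j) → n ≤ A + 2 * j → core ≤ A
  core-fits core lv m n A j e1 e2 refl e4 = lin 1 (e1 ⊕ e2 ⊕ e4) (solve (core ∷ m ∷ n ∷ A ∷ j ∷ []))

  bad-vertices-exist : ∀ A good bad n j → A ≤ good + bad → good ≤ 2 * j → n ≤ A + 2 * j → 36 * (suc j * suc j) ≤ n → 0 < bad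
  bad-vertices-exist A good bad n j e1 e2 e3 e4 =
    lin (35 + 68 * j + 36 * j * j) (e1 ⊕ e2 ⊕ e3 ⊕ e4) (solve (A ∷ good ∷ bad ∷ n ∷ j ∷ []))

  red-outside-few : ∀ r b A n j N → suc N ≡ 2 * n → r + (b + A) ≤ N → n ≤ b → n ≤ A + 2 * j → r ≤ 2 * j
  red-outside-few r b A n j N e1 e2 e3 e4 =
    lin 1 (≤-reflexive e1 ⊕ e2 ⊕ e3 ⊕ e4) (solve (r ∷ b ∷ A ∷ n ∷ j ∷ N ∷ []))

  blue-bad-many : ∀ b s good j → b ≤ s + good → good ≤ 2 * j → 3 * suc j < b → suc j ≤ s
  blue-bad-many b s good j e1 e2 e3 = lin 3 (e1 ⊕ e2 ⊕ e3) (solve (b ∷ s ∷ good ∷ j ∷ []))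

  fan-room : ∀ j p → 3 * suc j < p → 2 * j + suc j ≤ p
  fan-room j p h = lin 3 h (solve (j ∷ p ∷ []))

  one-side-large : ∀ s t n N → suc N ≡ 2 * n → N ≤ s + t → s < n → n ≤ t
  one-side-large s t n N e h g = lin 0 (≤-reflexive (sym e) ⊕ h ⊕ g) (solve (s ∷ t ∷ n ∷ N ∷ []))

  three-vertices : ∀ m A n j → A < m → n ≤ A + 2 * j → 36 * (suc j * suc j) ≤ n → 2 < m
  three-vertices m A n j e1 e2 e3 = lin (34 + 70 * j + 36 * j * j) (e1 ⊕ e2 ⊕ e3) (solve (m ∷ A ∷ n ∷ j ∷ []))

  drop-two-darts : ∀ d d′ m m′ ℓ → 2 + d′ ≤ d → m ≤ suc m′ → d ≤ 2 * (m + ℓ) → d′ ≤ 2 * (m′ + ℓ)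
  drop-two-darts d d′ m m′ ℓ e1 e2 e3 = lin 0 (e1 ⊕ 2 ⊛ e2 ⊕ e3) (solve (d ∷ d′ ∷ m ∷ m′ ∷ ℓ ∷ []))

  -- The origin of the path length `4k²`: `2k` vertices with at most `2k - 1` red neighbours each
  -- cannot reach every vertex of the path in red.
  pairs-in-path : ∀ j → suc (2 * suc j * suc (2 * j)) ≤ 4 * (suc j * suc j)
  pairs-in-path j = lin {x = 0} {y = 0} (1 + 2 * j) z≤n (solve (j ∷ []))

  path-blue-room : ∀ j r b → 4 * (suc j * suc j) ≤ b + r → r ≤ suc (2 * j) → suc (2 * j) + suc j ≤ b
  path-blue-room j r b e1 e2 = lin (1 + 3 * j + 4 * j * j) (e1 ⊕ e2) (solve (j ∷ r ∷ b ∷ []))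

  outside-large : ∀ i y m n N → suc N ≡ 2 * n → N ≤ i + y → i < m → m ≤ n → n ≤ y
  outside-large i y m n N e1 e2 e3 e4 = lin 0 (≤-reflexive (sym e1) ⊕ e2 ⊕ e3 ⊕ e4) (solve (i ∷ y ∷ m ∷ n ∷ N ∷ []))

  suppressed-darts : ∀ d d′ e → d′ ≤ 2 + e → 4 + e ≤ d → 2 + d′ ≤ d
  suppressed-darts d d′ e h g = lin 0 (h ⊕ g) (solve (d ∷ d′ ∷ e ∷ []))

  -- `E` vertices of degree ≠ 2 have degree sum `D`, and `p` of them are leaves. Eliminating `D`
  -- from `3E - 2p ≤ D ≤ 2E + 2ℓ` bounds `E`, and then `D`.
  essential-bounds : ∀ E D p ℓ j → D ≤ 2 * E + 2 * ℓ → 3 * E ≤ D + 2 * p → p ≤ 2 * j → E ≤ 4 * j + 2 * ℓ × D ≤ 8 * j + 6 * ℓ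
  essential-bounds E D p ℓ j e1 e2 e3 = lin 0 (e1 ⊕ e2 ⊕ 2 ⊛ e3) (solve (E ∷ D ∷ p ∷ ℓ ∷ j ∷ [])) ,
    lin 0 (3 ⊛ e1 ⊕ 2 ⊛ e2 ⊕ 4 ⊛ e3) (solve (E ∷ D ∷ p ∷ ℓ ∷ j ∷ []))

  excess-at-essential : ∀ S D E m ℓ → S + 2 * E ≡ D + 2 * m → S ≤ 2 * (m + ℓ) → D ≤ 2 * E + 2 * ℓ
  excess-at-essential S D E m ℓ e h = lin 0 (≤-reflexive (sym e) ⊕ h) (solve (S ∷ D ∷ E ∷ m ∷ ℓ ∷ []))

  essential-size : ∀ m E D q j ℓ → m ≤ E + D * q → E ≤ 4 * j + 2 * ℓ → D ≤ 8 * j + 6 * ℓ →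
    m ≤ 4 * j + 2 * ℓ + (8 * j + 6 * ℓ) * q
  essential-size m E D q j ℓ h e d = ≤-trans h (e ⊕ d ⊛ʳ q)

  core-greedy : ∀ m n N j ℓ → suc N ≡ 2 * n → 36 * (suc j * suc j * (suc j * suc j)) ≤ n → 330 * (suc j * suc j * ℓ) ≤ n →
    m ≤ 4 * j + 2 * ℓ + (8 * j + 6 * ℓ) * (4 * (suc j * suc j)) → 4 * m + 3 * ℓ ≤ N
  -- After doubling, `2N` is about `4n`; three of these copies of `n` absorb the powers of `k` and
  -- one absorbs the multiples of `ℓ`.
  core-greedy m n N j ℓ e hn hℓ h = *-cancelˡ-≤ 2 (lin
    (106 + 144 * j + 136 * j * j + 176 * j * j * j + 108 * j * j * j * j + (116 + 276 * j + 138 * j * j) * ℓ)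
    (2 ⊛ ≤-reflexive (sym e) ⊕ 3 ⊛ hn ⊕ hℓ ⊕ 8 ⊛ h) (solve (m ∷ n ∷ N ∷ j ∷ ℓ ∷ [])))

  core-degree-greedy : ∀ m n N j ℓ → suc N ≡ 2 * n → 36 * (suc j * suc j * (suc j * suc j)) ≤ n →
    330 * (suc j * suc j * ℓ) ≤ n → m ≤ 4 * j + 2 * ℓ + (8 * j + 6 * ℓ) * (4 * (suc j * suc j)) →
    (8 * j + 6 * ℓ + 2) * (6 * suc j) + m ≤ N
  core-degree-greedy m n N j ℓ e hn hℓ h = lin
    (23 + 48 * j + 104 * j * j + 112 * j * j * j + 36 * j * j * j * j + (268 + 576 * j + 306 * j * j) * ℓ)
    (≤-reflexive (sym e) ⊕ hn ⊕ hℓ ⊕ h) (solve (m ∷ n ∷ N ∷ j ∷ ℓ ∷ []))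

  cycle-greedy : ∀ m n N j ℓ → suc N ≡ 2 * n → 36 * (suc j * suc j * (suc j * suc j)) ≤ n → 330 * (suc j * suc j * ℓ) ≤ n →
    m ≤ 1 + 2 * (4 * (suc j * suc j)) → 4 * m + 3 * ℓ ≤ N
  cycle-greedy m n N j ℓ e hn hℓ h = *-cancelˡ-≤ 2 (lin
    (34 + 304 * j + 584 * j * j + 432 * j * j * j + 108 * j * j * j * j + (324 + 660 * j + 330 * j * j) * ℓ)
    (2 ⊛ ≤-reflexive (sym e) ⊕ 3 ⊛ hn ⊕ hℓ ⊕ 8 ⊛ h) (solve (m ∷ n ∷ N ∷ j ∷ ℓ ∷ [])))

  cycle-degree-greedy : ∀ m n N j → suc N ≡ 2 * n → 36 * (suc j * suc j * (suc j * suc j)) ≤ n →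
    m ≤ 1 + 2 * (4 * (suc j * suc j)) → 2 * (6 * suc j) + m ≤ N
  cycle-degree-greedy m n N j e hn h = lin
    (14 + 116 * j + 208 * j * j + 144 * j * j * j + 36 * j * j * j * j)
    (≤-reflexive (sym e) ⊕ hn ⊕ z≤n {n} ⊕ h) (solve (m ∷ n ∷ N ∷ j ∷ []))

  path-length-≥2 : ∀ j → 2 ≤ 4 * (suc j * suc j)
  path-length-≥2 j = lin {x = 0} {y = 0} (2 + 8 * j + 4 * j * j) z≤n (solve (j ∷ []))

  fourth-power⇒square : ∀ j n → 36 * (suc j * suc j * (suc j * suc j)) ≤ n → 36 * (suc j * suc j) ≤ n
  fourth-power⇒square j n h = lin (72 * j + 180 * j * j + 144 * j * j * j + 36 * j * j * j * j) h (solve (j ∷ n ∷ []))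

  excess-bound : ∀ j ℓ n → 330 * (suc j * suc j * ℓ) ≤ n → 330 * ℓ ≤ n
  excess-bound j ℓ n h = lin ((660 * j + 330 * j * j) * ℓ) h (solve (j ∷ ℓ ∷ n ∷ []))

  excess-scaled : ∀ e n C → e * C ≤ n * (C + 1) → (e ∸ n) * C ≤ n
  excess-scaled e n C h = subst (_≤ n) (sym (*-distribʳ-∸ C e n))
    (m≤n+o⇒m∸n≤o (e * C) (n * C) (≤-trans h (≤-reflexive (expand n C))))
    where
    expand : ∀ n C → n * (C + 1) ≡ n * C + n
    expand = solve-∀

  coefficient-bound : ∀ ℓ n j → ℓ * (204 * (suc j * (suc j * (suc j * 1))) + 126 * (suc j * (suc j * 1))) ≤ n →
    330 * (suc j * suc j * ℓ) ≤ n
  coefficient-bound ℓ n j h = lin (204 * (j * suc j * suc j) * ℓ) h (solve (ℓ ∷ n ∷ j ∷ []))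

  fourth-power : ∀ n j → 36 * (suc j * (suc j * (suc j * (suc j * 1)))) ≤ n → 36 * (suc j * suc j * (suc j * suc j)) ≤ n
  fourth-power n j h = lin 0 h (solve (n ∷ j ∷ []))

  below-two-cliques : ∀ h M → suc M ≤ suc (h + 1 * suc (suc h)) → M ≤ suc h + suc h
  below-two-cliques h M lt = lin 0 lt (solve (h ∷ M ∷ []))

open Arithmetic
open import Data.Bool using (Bool; true; false; _∧_; _∨_; T) renaming (_≟_ to _≟ᵇ_)
open import Data.Bool.Properties using (¬-not; T-∧)
open import Data.Empty using (⊥; ⊥-elim)
open import Data.Fin as Fin using (Fin; zero; suc; toℕ; splitAt; inject≤; _↑ˡ_; _↑ʳ_) renaming (_≟_ to _≟ᶠ_)
import Data.Fin.Properties as Finₚ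
open import Data.List using (List; []; _∷_; _++_; length; map; filter; allFin; concatMap; take; drop; lookup; upTo)
open import Data.List.Properties using (length-++; length-take; length-map; length-tabulate; length-upTo; filter-++; filter-accept; filter-reject; take++drop≡id; map-++)
open import Data.List.Membership.Propositional using (_∈_; _∉_; find; lose)
open import Data.List.Membership.Propositional.Properties using (∈-∃++; ∈-++⁺ˡ; ∈-++⁺ʳ; ∈-++⁻; ∈-filter⁺; ∈-filter⁻; ∈-map⁺; ∈-map⁻; ∈-allFin; ∈-upTo⁺; ∈-lookup; ∈-length; ∈-concatMap⁺; ∈-concatMap⁻)
import Data.List.Membership.DecPropositional as DecMembership
open import Data.List.Relation.Binary.Permutation.Propositional using (_↭_; ↭-refl; ↭-sym; ↭-trans; ↭-prep; ↭-swap; ↭⇒↭ₛ)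
open import Data.List.Relation.Binary.Permutation.Propositional.Properties using (shift; ++⁺ʳ; ∈-resp-↭; ↭-length)
import Data.List.Relation.Binary.Permutation.Setoid.Properties as PermSetoid
open import Data.List.Relation.Unary.All as All using (All; []; _∷_)
import Data.List.Relation.Unary.All.Properties as Allₚ
open import Data.List.Relation.Unary.AllPairs as AllPairs using (AllPairs; []; _∷_)
open import Data.List.Relation.Unary.Any using (Any; here; there; any?)
open import Data.List.Relation.Unary.Unique.Propositional using (Unique)
import Data.List.Relation.Unary.Unique.Propositional.Properties as Uniqueₚ
open import Data.Nat as ℕ using (zero; suc; _<_; z≤n; s≤s; >-nonZero; _<ᵇ_; _≤?_; _<?_)
open import Data.Nat.ListAction using (sum)
open import Data.Nat.Properties hiding (_≟_)
open import Data.Nat.Tactic.RingSolver using (solve-∀)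
open import Data.Product using (∃; ∃-syntax; Σ-syntax; _×_; _,_; proj₁; proj₂; swap)
open import Data.Sum using (_⊎_; inj₁; inj₂; [_,_]′)
open import Data.Unit using (⊤; tt)
open import Data.Vec as Vec using (Vec)
import Data.Vec.Properties as Vecₚ
open import Function using (_∘_; id)
open import Function.Bundles using (Equivalence)
open import Relation.Binary using (tri<; tri≈; tri>)
open import Relation.Binary.PropositionalEquality hiding ([_])
open import Relation.Nullary using (¬_; Dec; yes; no; contradiction; ¬?)
open import Relation.Nullary.Decidable using (_×-dec_; _⊎-dec_; _→-dec_; decidable-stable; map′; T?; does; dec-true; dec-false)
open import Relation.Unary using (Decidable)

-- Lists

length-insert : ∀ {A : Set} (as : List A) {x bs} → length (as ++ x ∷ bs) ≡ suc (length (as ++ bs))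
length-insert []       = refl
length-insert (_ ∷ as) = cong suc (length-insert as)

∈-uninsert : ∀ {A : Set} (as : List A) {x z bs} → z ∈ as ++ x ∷ bs → z ≢ x → z ∈ as ++ bs
∈-uninsert as z∈ z≢x with ∈-++⁻ as z∈
... | inj₁ z∈as         = ∈-++⁺ˡ z∈as
... | inj₂ (here z≡x)   = contradiction z≡x z≢x
... | inj₂ (there z∈bs) = ∈-++⁺ʳ as z∈bs

∈-insert : ∀ {A : Set} (as : List A) {x z bs} → z ∈ as ++ bs → z ∈ as ++ x ∷ bs
∈-insert as z∈ with ∈-++⁻ as z∈
... | inj₁ z∈as = ∈-++⁺ˡ z∈as
... | inj₂ z∈bs = ∈-++⁺ʳ as (there z∈bs)

-- The pigeonhole principle behind nearly every count below: sets are duplicate-free lists, and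
-- cardinalities are compared through inclusion.
length-⊆ : ∀ {A : Set} {xs ys : List A} → Unique xs → (∀ {x} → x ∈ xs → x ∈ ys) → length xs ≤ length ys
length-⊆ []       _   = z≤n
length-⊆ (x∉ ∷ u) sub with ∈-∃++ (sub (here refl))
... | as , bs , refl = subst (_ ≤_) (sym (length-insert as))
  (s≤s (length-⊆ u (λ z∈ → ∈-uninsert as (sub (there z∈)) (λ z≡x → All.lookup x∉ z∈ (sym z≡x)))))

infix 4 _∈?_
_∈?_ : ∀ {n} (x : Fin n) (xs : List (Fin n)) → Dec (x ∈ xs)
_∈?_ = DecMembership._∈?_ _≟ᶠ_

-- The form in which counting produces vertices: `ys` collects everything that is forbidden,
-- possibly with repetitions.
pick : ∀ {n} {xs ys : List (Fin n)} → Unique xs → length ys < length xs → ∃[ x ] x ∈ xs × x ∉ ys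
pick {xs = xs} {ys} u lt with any? (λ x → ¬? (x ∈? ys)) xs
... | yes a = find a
... | no ¬a = contradiction
  (length-⊆ u (λ {x} x∈ → decidable-stable (x ∈? ys) (λ x∉ → ¬a (lose x∈ x∉)))) (<⇒≱ lt)

length-filter-¬ : ∀ {A : Set} {P : A → Set} (P? : Decidable P) xs →
  length xs ≡ length (filter P? xs) + length (filter (¬? ∘ P?) xs)
length-filter-¬ P? [] = refl
length-filter-¬ P? (x ∷ xs) with P? x
... | yes _ = cong suc (length-filter-¬ P? xs)
... | no  _ = trans (cong suc (length-filter-¬ P? xs)) (sym (+-suc _ _))

length-concatMap-≤ : ∀ {A B : Set} (f : A → List B) xs d → (∀ {x} → x ∈ xs → length (f x) ≤ d) →
  length (concatMap f xs) ≤ length xs * d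
length-concatMap-≤ f []       d h = z≤n
length-concatMap-≤ f (x ∷ xs) d h = subst (_≤ d + length xs * d) (sym (length-++ (f x)))
  (h (here refl) ⊕ length-concatMap-≤ f xs d (h ∘ there))

∈-concatMap : ∀ {A B : Set} (f : A → List B) {xs x y} → x ∈ xs → y ∈ f x → y ∈ concatMap f xs
∈-concatMap f x∈ y∈ = ∈-concatMap⁺ f (lose x∈ y∈)

∈-take⁻ : ∀ {A : Set} k {xs : List A} {x} → x ∈ take k xs → x ∈ xs
∈-take⁻ (suc k) {_ ∷ _} (here e)   = here e
∈-take⁻ (suc k) {_ ∷ _} (there x∈) = there (∈-take⁻ k x∈)

length-take-≤ : ∀ {A : Set} {k} {xs : List A} → k ≤ length xs → length (take k xs) ≡ k
length-take-≤ {k = k} {xs} h = trans (length-take k xs) (m≤n⇒m⊓n≡m h)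

length-allFin : ∀ n → length (allFin n) ≡ n
length-allFin n = length-tabulate id

Unique-resp-↭ : ∀ {A : Set} {xs ys : List A} → xs ↭ ys → Unique xs → Unique ys
Unique-resp-↭ {A} p = PermSetoid.Unique-resp-↭ (setoid A) (↭⇒↭ₛ p)

Unique-++ˡ : ∀ {A : Set} (xs : List A) {ys} → Unique (xs ++ ys) → Unique xs
Unique-++ˡ []       _        = []
Unique-++ˡ (x ∷ xs) (x∉ ∷ u) = Allₚ.++⁻ˡ xs x∉ ∷ Unique-++ˡ xs u

Unique-++ʳ : ∀ {A : Set} (xs : List A) {ys} → Unique (xs ++ ys) → Unique ys
Unique-++ʳ []       u       = u
Unique-++ʳ (x ∷ xs) (_ ∷ u) = Unique-++ʳ xs u

module _ {A : Set} where

  -- `Unique (flat M)` is the encoding of "`M` is a matching": all endpoints are distinct.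
  flat : List (A × A) → List A
  flat []            = []
  flat ((a , b) ∷ M) = a ∷ b ∷ flat M

  length-flat : ∀ M → length (flat M) ≡ 2 * length M
  length-flat []      = refl
  length-flat (_ ∷ M) = trans (cong (2 +_) (length-flat M)) (double (length M))
    where
    double : ∀ m → suc (suc (2 * m)) ≡ 2 * suc m
    double = solve-∀

  proj₁∈flat : ∀ M i → proj₁ (lookup M i) ∈ flat M
  proj₁∈flat (_ ∷ M) zero    = here refl
  proj₁∈flat (_ ∷ M) (suc i) = there (there (proj₁∈flat M i))

  proj₂∈flat : ∀ M i → proj₂ (lookup M i) ∈ flat M
  proj₂∈flat (_ ∷ M) zero    = there (here refl)
  proj₂∈flat (_ ∷ M) (suc i) = there (there (proj₂∈flat M i))

  flat-injective₁ : ∀ M → Unique (flat M) → ∀ i i′ → proj₁ (lookup M i) ≡ proj₁ (lookup M i′) → i ≡ i′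
  flat-injective₁ (_ ∷ M) _ zero zero _ = refl
  flat-injective₁ (_ ∷ M) (a∉ ∷ _ ∷ u) zero (suc i) e = contradiction e (All.lookup a∉ (there (proj₁∈flat M i)))
  flat-injective₁ (_ ∷ M) (a∉ ∷ _ ∷ u) (suc i) zero e = contradiction (sym e) (All.lookup a∉ (there (proj₁∈flat M i)))
  flat-injective₁ (_ ∷ M) (_ ∷ _ ∷ u) (suc i) (suc i′) e = cong suc (flat-injective₁ M u i i′ e)

  flat-injective₂ : ∀ M → Unique (flat M) → ∀ i i′ → proj₂ (lookup M i) ≡ proj₂ (lookup M i′) → i ≡ i′
  flat-injective₂ (_ ∷ M) _ zero zero _ = refl
  flat-injective₂ (_ ∷ M) (_ ∷ b∉ ∷ u) zero (suc i) e = contradiction e (All.lookup b∉ (proj₂∈flat M i))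
  flat-injective₂ (_ ∷ M) (_ ∷ b∉ ∷ u) (suc i) zero e = contradiction (sym e) (All.lookup b∉ (proj₂∈flat M i))
  flat-injective₂ (_ ∷ M) (_ ∷ _ ∷ u) (suc i) (suc i′) e = cong suc (flat-injective₂ M u i i′ e)

  flat-disjoint : ∀ M → Unique (flat M) → ∀ i i′ → proj₁ (lookup M i) ≢ proj₂ (lookup M i′)
  flat-disjoint (_ ∷ M) (a∉ ∷ _) zero zero e = All.lookup a∉ (here refl) e
  flat-disjoint (_ ∷ M) (a∉ ∷ _) zero (suc i) e = All.lookup a∉ (there (proj₂∈flat M i)) e
  flat-disjoint (_ ∷ M) (_ ∷ b∉ ∷ _) (suc i) zero e = All.lookup b∉ (proj₁∈flat M i) (sym e)
  flat-disjoint (_ ∷ M) (_ ∷ _ ∷ u) (suc i) (suc i′) e = flat-disjoint M u i i′ e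

-- Blue fans

module Blue {N : ℕ} (c : Colouring N) where

  -- The values of a colouring on the diagonal are junk, so x ≢ y is part of the relation.
  Bl : Fin N → Fin N → Set
  Bl x y = x ≢ y × colour c x y ≡ false

  Bl? : ∀ x → Decidable (Bl x)
  Bl? x y = ¬? (x ≟ᶠ y) ×-dec (colour c x y ≟ᵇ false)

  Bl-sym : ∀ {x y} → Bl x y → Bl y x
  Bl-sym {x} {y} (x≢y , b) = x≢y ∘ sym , trans (csym c y x) b

  ¬Bl⇒red : ∀ {x y} → x ≢ y → ¬ Bl x y → colour c x y ≡ true
  ¬Bl⇒red x≢y ¬b = ¬-not (λ b → ¬b (x≢y , b))

  RedEdge : Fin N → Fin N → Set
  RedEdge x y = colour c x y ≡ true

  blueIn : Fin N → List (Fin N) → List (Fin N)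
  blueIn x = filter (Bl? x)

  redIn : Fin N → List (Fin N) → List (Fin N)
  redIn x = filter (¬? ∘ Bl? x)

  blueNbrs : Fin N → List (Fin N)
  blueNbrs x = blueIn x (allFin N)

  blueNbrs-unique : ∀ x → Unique (blueNbrs x)
  blueNbrs-unique x = Uniqueₚ.filter⁺ (Bl? x) (Uniqueₚ.allFin⁺ N)

  ∈-blueNbrs : ∀ {x y} → Bl x y → y ∈ blueNbrs x
  ∈-blueNbrs {x} {y} b = ∈-filter⁺ (Bl? x) (∈-allFin y) b

  ∈-blueNbrs⁻ : ∀ {x y} → y ∈ blueNbrs x → Bl x y
  ∈-blueNbrs⁻ {x} y∈ = proj₂ (∈-filter⁻ (Bl? x) {xs = allFin N} y∈)

  Red : List (Fin N) → Set
  Red A = ∀ {x y} → x ∈ A → y ∈ A → ¬ Bl x y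

  -- The working form of a fan: a centre and a matching in its blue neighbourhood. Allowing more
  -- than `k` edges spares trimming the matching.
  BlueFan : ℕ → Set
  BlueFan k = ∃[ w ] Σ[ M ∈ List (Fin N × Fin N) ]
    k ≤ length M × All (λ e → Bl (proj₁ e) (proj₂ e)) M × (∀ {x} → x ∈ flat M → Bl w x) × Unique (flat M)

  blueFan⇒contains : ∀ j → BlueFan (suc j) → ContainsMono c false (fan (suc j))
  blueFan⇒contains j (w , M , k≤ , blM , blw , u) = f , f-inj , f-blue
    where
    k = suc j
    ix : Fin k → Fin (length M)
    ix i = inject≤ i k≤
    ix-inj : ∀ {i i′} → ix i ≡ ix i′ → i ≡ i′
    ix-inj {i} {i′} = Finₚ.inject≤-injective k≤ k≤ i i′
    a b : Fin k → Fin N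
    a i = proj₁ (lookup M (ix i))
    b i = proj₂ (lookup M (ix i))
    f : Fin (suc (k + k)) → Fin N
    f zero    = w
    f (suc i) = [ a , b ]′ (splitAt k i)
    wf : ∀ i → Bl w (f (suc i))
    wf i with splitAt k i
    ... | inj₁ x = blw (proj₁∈flat M (ix x))
    ... | inj₂ x = blw (proj₂∈flat M (ix x))
    f-inj : ∀ {x y} → f x ≡ f y → x ≡ y
    f-inj {zero} {zero} _ = refl
    f-inj {zero} {suc y} e = contradiction e (proj₁ (wf y))
    f-inj {suc x} {zero} e = contradiction (sym e) (proj₁ (wf x))
    f-inj {suc x} {suc y} e with splitAt k x in ex | splitAt k y in ey
    ... | inj₁ p | inj₁ q = cong suc (trans (sym (Finₚ.splitAt⁻¹-↑ˡ ex)) (trans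
            (cong (_↑ˡ k) (ix-inj (flat-injective₁ M u (ix p) (ix q) e))) (Finₚ.splitAt⁻¹-↑ˡ ey)))
    ... | inj₁ p | inj₂ q = contradiction e (flat-disjoint M u (ix p) (ix q))
    ... | inj₂ p | inj₁ q = contradiction (sym e) (flat-disjoint M u (ix q) (ix p))
    ... | inj₂ p | inj₂ q = cong suc (trans (sym (Finₚ.splitAt⁻¹-↑ʳ ex)) (trans
            (cong (k ↑ʳ_) (ix-inj (flat-injective₂ M u (ix p) (ix q) e))) (Finₚ.splitAt⁻¹-↑ʳ ey)))
    blM! : ∀ i → colour c (a i) (b i) ≡ false
    blM! i = proj₂ (All.lookup blM (∈-lookup (ix i)))
    rel-blue : ∀ x y → fanRel k (toℕ x) (toℕ y) ≡ true → colour c (f x) (f y) ≡ false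
    rel-blue zero (suc y) _ = proj₂ (wf y)
    rel-blue (suc x) (suc y) e with splitAt k x in ex | splitAt k y in ey
    -- Two first ends are never matched: their positions differ by less than `k`, while `fanRel`
    -- asks for a difference of exactly `k`.
    ... | inj₁ p | inj₁ q = contradiction
            (trans (sym (Finₚ.toℕ-↑ˡ q k)) (trans (cong toℕ (Finₚ.splitAt⁻¹-↑ˡ ey))
              (suc-injective (≡ᵇ⇒≡ (suc (toℕ y)) (suc (toℕ x) + k) (subst T (sym e) _)))))
            (<⇒≢ (<-≤-trans (Finₚ.toℕ<n q) (m≤n+m k (toℕ x))))
    ... | inj₁ p | inj₂ q = subst (λ z → colour c (a p) (b z) ≡ false) p≡q (blM! p)
      where
      p≡q : p ≡ q
      p≡q = Finₚ.toℕ-injective (+-cancelʳ-≡ k (toℕ p) (toℕ q) (trans (cong (_+ k)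
        (trans (sym (Finₚ.toℕ-↑ˡ p k)) (cong toℕ (Finₚ.splitAt⁻¹-↑ˡ ex))))
        (trans (sym (suc-injective (≡ᵇ⇒≡ (suc (toℕ y)) (suc (toℕ x) + k) (subst T (sym e) _))))
        (trans (cong toℕ (sym (Finₚ.splitAt⁻¹-↑ʳ ey))) (trans (Finₚ.toℕ-↑ʳ k q) (+-comm k (toℕ q)))))))
    ... | inj₂ p | _ = contradiction (suc-injective (≡ᵇ⇒≡ (suc (toℕ y)) (suc (toℕ x) + k) (subst T (sym e) _)))
            (<⇒≢ (<-≤-trans (Finₚ.toℕ<n y) (+-monoˡ-≤ k (subst (k ≤_)
              (trans (sym (Finₚ.toℕ-↑ʳ k p)) (cong toℕ (Finₚ.splitAt⁻¹-↑ʳ ex))) (m≤m+n k (toℕ p))))))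
    f-blue : ∀ x y → adj (fan k) x y ≡ true → colour c (f x) (f y) ≡ false
    f-blue x y e with fanRel k (toℕ x) (toℕ y) in e₁
    ... | true  = rel-blue x y e₁
    ... | false = trans (csym c (f x) (f y)) (rel-blue y x e)

  -- Greedy construction: a new vertex either has no blue neighbour in the red set `A` and joins it,
  -- or is matched with one, which then leaves `A`. The matching is only maximal, not maximum, but
  -- that is enough for `A` to be red.
  maxMatching : ∀ Y → Σ[ A ∈ List (Fin N) ] Σ[ M ∈ List (Fin N × Fin N) ]
    (A ++ flat M ↭ Y) × All (λ e → Bl (proj₁ e) (proj₂ e)) M × Red A
  maxMatching [] = [] , [] , ↭-refl , [] , λ ()
  maxMatching (y ∷ Y) with maxMatching Y
  ... | A , M , perm , blM , red with any? (Bl? y) A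
  ... | no ¬b = y ∷ A , M , ↭-prep y perm , blM , red′
    where
    red′ : Red (y ∷ A)
    red′ (here refl) (here refl) (ne , _) = ne refl
    red′ (here refl) (there z∈) b = ¬b (lose z∈ b)
    red′ (there z∈) (here refl) b = ¬b (lose z∈ (Bl-sym b))
    red′ (there z∈) (there z′∈) b = red z∈ z′∈ b
  ... | yes p with find p
  ... | a , a∈ , yb with ∈-∃++ a∈
  ... | as , bs , refl = as ++ bs , (y , a) ∷ M ,
    ↭-trans (shift y (as ++ bs) (a ∷ flat M)) (↭-prep y
      (↭-trans (shift a (as ++ bs) (flat M)) (↭-trans (++⁺ʳ (flat M) (↭-sym (shift a as bs))) perm))) ,
    yb ∷ blM , λ p q → red (∈-insert as p) (∈-insert as q)

  module NoFan (j : ℕ) (nofan : ¬ BlueFan (suc j)) where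

    -- A matching of more than `j` blue edges inside the blue neighbourhood of `w` would be a fan
    -- with centre `w`, so at most `2j` vertices are matched.
    redClique : ∀ w Y → Unique Y → (∀ {y} → y ∈ Y → Bl w y) → Σ[ A ∈ List (Fin N) ]
      Unique A × (∀ {y} → y ∈ A → y ∈ Y) × Red A × length Y ≤ length A + 2 * j
    redClique w Y u bl with maxMatching Y
    ... | A , M , perm , blM , red = A , uA , (∈-resp-↭ perm ∘ ∈-++⁺ˡ) , red , len
      where
      uAM : Unique (A ++ flat M)
      uAM = Unique-resp-↭ (↭-sym perm) u
      uA : Unique A
      uA = Unique-++ˡ A uAM
      uM : Unique (flat M)
      uM = Unique-++ʳ A uAM
      M≤j : length M ≤ j
      M≤j with length M ≤? j
      ... | yes h = h
      ... | no ¬h = ⊥-elim (nofan (w , M , ≰⇒> ¬h , blM , (λ x∈ → bl (∈-resp-↭ perm (∈-++⁺ʳ A x∈))) , uM))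
      len : length Y ≤ length A + 2 * j
      len = subst (_≤ length A + 2 * j) (trans (sym (length-++ A)) (↭-length perm))
        (+-monoʳ-≤ (length A) (subst (_≤ 2 * j) (sym (length-flat M)) (2 ⊛ M≤j)))

  -- Greedy: when `s` is matched, at most `d` vertices of `P` are excluded by red edges and fewer
  -- than `length S` by earlier choices.
  matchInto : ∀ (P : List (Fin N)) d → Unique P → ∀ S → Unique S → (∀ {s} → s ∈ S → s ∉ P) →
    (∀ {s} → s ∈ S → length (redIn s P) ≤ d) → d + length S ≤ length P →
    Σ[ M ∈ List (Fin N × Fin N) ] length M ≡ length S × All (λ e → Bl (proj₁ e) (proj₂ e)) M ×
      (∀ {x} → x ∈ map proj₂ M → x ∈ P) × (∀ {x} → x ∈ flat M → x ∈ S ⊎ x ∈ map proj₂ M) × Unique (flat M)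
  matchInto P d uP [] _ _ _ _ = [] , refl , [] , (λ ()) , (λ ()) , []
  matchInto P d uP (s ∷ S) (s∉S ∷ uS) disj few room
    with matchInto P d uP S uS (disj ∘ there) (few ∘ there) (≤-trans (+-monoʳ-≤ d (n≤1+n _)) room)
  ... | M , len , blM , M⊆P , M⊆ , uM
    with pick {ys = map proj₂ M ++ redIn s P} uP (≤-trans (subst (λ z → suc z ≤ d + length (s ∷ S))
      (sym (trans (length-++ (map proj₂ M)) (cong (_+ length (redIn s P)) (trans (length-map proj₂ M) len))))
      (slot (length S) (length (redIn s P)) d (few (here refl)))) room)
  ... | p , p∈ , p∉ = (s , p) ∷ M , cong suc len , sp ∷ blM , M⊆P′ , M⊆′ , (s≢p ∷ s∉M) ∷ p∉M ∷ uM
    where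
    sp : Bl s p
    sp = decidable-stable (Bl? s p) (λ ¬b → p∉ (∈-++⁺ʳ (map proj₂ M) (∈-filter⁺ (¬? ∘ Bl? s) p∈ ¬b)))
    s≢p = proj₁ sp
    M⊆P′ : ∀ {x} → x ∈ p ∷ map proj₂ M → x ∈ P
    M⊆P′ (here refl) = p∈
    M⊆P′ (there x∈)  = M⊆P x∈
    M⊆′ : ∀ {x} → x ∈ s ∷ p ∷ flat M → x ∈ s ∷ S ⊎ x ∈ p ∷ map proj₂ M
    M⊆′ (here e) = inj₁ (here e)
    M⊆′ (there (here e)) = inj₂ (here e)
    M⊆′ (there (there x∈)) with M⊆ x∈
    ... | inj₁ x∈S = inj₁ (there x∈S)
    ... | inj₂ x∈M = inj₂ (there x∈M)
    s∉M : All (s ≢_) (flat M)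
    s∉M = All.tabulate λ x∈ → λ { refl → [ (λ x∈S → All.lookup s∉S x∈S refl) , (λ x∈M → disj (here refl) (M⊆P x∈M)) ]′ (M⊆ x∈) }
    p∉M : All (p ≢_) (flat M)
    p∉M = All.tabulate λ x∈ → λ { refl → [ (λ x∈S → disj (there x∈S) p∈) , (λ x∈M → p∉ (∈-++⁺ˡ x∈M)) ]′ (M⊆ x∈) }

  -- The source of most fans below: two disjoint sets in the blue neighbourhood of `w` that are
  -- almost completely joined in blue.
  fanFromBipartite : ∀ k w S P d → Unique S → Unique P → (∀ {s} → s ∈ S → s ∉ P) →
    (∀ {s} → s ∈ S → Bl w s) → (∀ {p} → p ∈ P → Bl w p) → k ≤ length S →
    (∀ {s} → s ∈ S → length (redIn s P) ≤ d) → d + k ≤ length P → BlueFan k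
  fanFromBipartite k w S P d uS uP disj wS wP k≤ few room
    with matchInto P d uP (take k S) (Uniqueₚ.take⁺ k uS) (disj ∘ ∈-take⁻ k) (few ∘ ∈-take⁻ k)
      (subst (λ z → d + z ≤ length P) (sym (length-take-≤ k≤)) room)
  ... | M , len , blM , M⊆P , M⊆ , uM = w , M , ≤-reflexive (sym (trans len (length-take-≤ k≤))) , blM ,
    (λ x∈ → [ wS ∘ ∈-take⁻ k , wP ∘ M⊆P ]′ (M⊆ x∈)) , uM

-- Partial red embeddings

searchVec : ∀ {N} m (P : Vec (Fin N) m → Set) → Decidable P → Dec (∃ P)
searchVec zero    P P? = map′ (λ p → Vec.[] , p) (λ { (Vec.[] , p) → p }) (P? Vec.[])
searchVec (suc m) P P? = map′ (λ { (x , v , p) → x Vec.∷ v , p }) (λ { (x Vec.∷ v , p) → x , v , p })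
  (Finₚ.any? (λ x → searchVec m (P ∘ (x Vec.∷_)) (P? ∘ (x Vec.∷_))))

-- Functions are enumerated as vectors. A function agrees with its table only pointwise, so `P` has
-- to respect pointwise equality.
searchFun : ∀ {m N} (P : (Fin m → Fin N) → Set) → Decidable P → (∀ f g → f ≗ g → P f → P g) → Dec (∃ P)
searchFun {m} P P? resp = map′ (λ { (v , p) → Vec.lookup v , p })
  (λ { (f , p) → Vec.tabulate f , resp f _ (λ i → sym (Vecₚ.lookup∘tabulate f i)) p })
  (searchVec m (P ∘ Vec.lookup) (P? ∘ Vec.lookup))

contains? : ∀ {N m} (c : Colouring N) b (H : Graph m) → Dec (ContainsMono c b H)
contains? {N} {m} c b H = map′ (λ { (f , i , r) → f , (λ {x} {y} → i x y) , r }) (λ { (f , i , r) → f , (λ x y → i {x} {y}) , r })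
  (searchFun
    (λ f → (∀ x y → f x ≡ f y → x ≡ y) × (∀ u v → adj H u v ≡ true → colour c (f u) (f v) ≡ b))
    (λ f → Finₚ.all? (λ x → Finₚ.all? λ y → (f x ≟ᶠ f y) →-dec (x ≟ᶠ y)) ×-dec
           Finₚ.all? (λ u → Finₚ.all? λ v → (adj H u v ≟ᵇ true) →-dec (colour c (f u) (f v) ≟ᵇ b)))
    (λ f g f≗g (i , r) → (λ x y e → i x y (trans (f≗g x) (trans e (sym (f≗g y))))) ,
      λ u v e → subst₂ (λ a b′ → colour c a b′ ≡ b) (f≗g u) (f≗g v) (r u v e)))

module Degree {n : ℕ} (H : Graph n) where

  _~_ : Fin n → Fin n → Set
  u ~ v = adj H u v ≡ true

  _~?_ : ∀ u v → Dec (u ~ v)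
  u ~? v = adj H u v ≟ᵇ true

  ~-sym : ∀ {u v} → u ~ v → v ~ u
  ~-sym {u} {v} e = trans (adj-sym H v u) e

  ~-irrefl : ∀ {u v} → u ~ v → u ≢ v
  ~-irrefl {u} e refl = contradiction (trans (sym e) (irrefl H u)) λ ()

  nbrs : Fin n → List (Fin n)
  nbrs v = filter (v ~?_) (allFin n)

  deg : Fin n → ℕ
  deg v = length (nbrs v)

  ∈-nbrs : ∀ {v w} → v ~ w → w ∈ nbrs v
  ∈-nbrs {v} {w} e = ∈-filter⁺ (v ~?_) (∈-allFin w) e

  ∈-nbrs⁻ : ∀ {v w} → w ∈ nbrs v → v ~ w
  ∈-nbrs⁻ {v} w∈ = proj₂ (∈-filter⁻ (v ~?_) {xs = allFin n} w∈)

  nbrs-unique : ∀ v → Unique (nbrs v)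
  nbrs-unique v = Uniqueₚ.filter⁺ (v ~?_) (Uniqueₚ.allFin⁺ n)

  degSum : List (Fin n) → ℕ
  degSum = sum ∘ map deg

module Embedding {n N : ℕ} (H : Graph n) (c : Colouring N) where

  open Blue c
  open Degree H

  -- The map is total on `Fin n`, with arbitrary values off `P`; a partial embedding then grows by
  -- changing a single value.
  record Embeds (P : List (Fin n)) (f : Fin n → Fin N) : Set where
    field
      inj : ∀ {u v} → u ∈ P → v ∈ P → f u ≡ f v → u ≡ v
      red : ∀ {u v} → u ∈ P → v ∈ P → u ~ v → colour c (f u) (f v) ≡ true
  open Embeds public

  Emb : List (Fin n) → Set
  Emb L = ∃ (Embeds L)

  emb? : ∀ L → Dec (Emb L)
  emb? L = map′
    (λ { (f , i , r) → f , record { inj = λ {u} {v} → i u v ; red = λ {u} {v} → r u v } })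
    (λ { (f , p) → f , (λ u v → inj p {u} {v}) , (λ u v → red p {u} {v}) })
    (searchFun
      (λ f → (∀ u v → u ∈ L → v ∈ L → f u ≡ f v → u ≡ v) ×
             (∀ u v → u ∈ L → v ∈ L → u ~ v → colour c (f u) (f v) ≡ true))
      (λ f → Finₚ.all? (λ u → Finₚ.all? λ v → (u ∈? L) →-dec ((v ∈? L) →-dec ((f u ≟ᶠ f v) →-dec (u ≟ᶠ v)))) ×-dec
             Finₚ.all? (λ u → Finₚ.all? λ v → (u ∈? L) →-dec ((v ∈? L) →-dec ((u ~? v) →-dec (colour c (f u) (f v) ≟ᵇ true)))))
      (λ f g f≗g (i , r) → (λ u v u∈ v∈ e → i u v u∈ v∈ (trans (f≗g u) (trans e (sym (f≗g v))))) ,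
        λ u v u∈ v∈ e → subst₂ (λ a b → colour c a b ≡ true) (f≗g u) (f≗g v) (r u v u∈ v∈ e)))

  Embeds-⊆ : ∀ {P Q f} → (∀ {u} → u ∈ P → u ∈ Q) → Embeds Q f → Embeds P f
  Embeds-⊆ sub p = record { inj = λ u∈ v∈ → inj p (sub u∈) (sub v∈) ; red = λ u∈ v∈ → red p (sub u∈) (sub v∈) }

  Embeds-[] : ∀ {f} → Embeds [] f
  Embeds-[] = record { inj = λ () ; red = λ () }

  update : (Fin n → Fin N) → Fin n → Fin N → Fin n → Fin N
  update f v y w with w ≟ᶠ v
  ... | yes _ = y
  ... | no  _ = f w

  update-same : ∀ f v y → update f v y v ≡ y
  update-same f v y with v ≟ᶠ v
  ... | yes _ = refl
  ... | no ¬e = contradiction refl ¬e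

  update-other : ∀ f v y {w} → w ≢ v → update f v y w ≡ f w
  update-other f v y {w} w≢v with w ≟ᶠ v
  ... | yes e = contradiction e w≢v
  ... | no  _ = refl

  ∉⇒≢ : ∀ {P : List (Fin n)} {u v} → v ∉ P → u ∈ P → u ≢ v
  ∉⇒≢ v∉ u∈ refl = v∉ u∈

  extend : ∀ {P f v y} → Embeds P f → v ∉ P → y ∉ map f P → (∀ {u} → u ∈ P → v ~ u → ¬ Bl (f u) y) →
    Embeds (v ∷ P) (update f v y)
  extend {P} {f} {v} {y} p v∉ y∉ ok = record { inj = i ; red = r }
    where
    g = update f v y
    gv : g v ≡ y
    gv = update-same f v y
    gP : ∀ {u} → u ∈ P → g u ≡ f u
    gP u∈ = update-other f v y (∉⇒≢ v∉ u∈)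
    fresh : ∀ {u} → u ∈ P → f u ≢ y
    fresh u∈ e = y∉ (subst (_∈ map f P) e (∈-map⁺ f u∈))
    i : ∀ {a b} → a ∈ v ∷ P → b ∈ v ∷ P → g a ≡ g b → a ≡ b
    i (here refl) (here refl) _ = refl
    i (here refl) (there b∈) e = contradiction (trans (sym (gP b∈)) (trans (sym e) gv)) (fresh b∈)
    i (there a∈) (here refl) e = contradiction (trans (sym (gP a∈)) (trans e gv)) (fresh a∈)
    i (there a∈) (there b∈) e = inj p a∈ b∈ (trans (sym (gP a∈)) (trans e (gP b∈)))
    new : ∀ {u} → u ∈ P → v ~ u → colour c (g u) (g v) ≡ true
    new u∈ e = subst₂ (λ a b → colour c a b ≡ true) (sym (gP u∈)) (sym gv) (¬Bl⇒red (fresh u∈) (ok u∈ e))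
    r : ∀ {a b} → a ∈ v ∷ P → b ∈ v ∷ P → a ~ b → colour c (g a) (g b) ≡ true
    r (here refl) (here refl) e = contradiction refl (~-irrefl e)
    r (here refl) (there b∈) e = trans (csym c _ _) (new b∈ e)
    r (there a∈) (here refl) e = new a∈ (~-sym e)
    r (there a∈) (there b∈) e = subst₂ (λ a b → colour c a b ≡ true) (sym (gP a∈)) (sym (gP b∈)) (red p a∈ b∈ e)

  Spot : List (Fin n) → (Fin n → Fin N) → Fin n → Fin N → Set
  Spot Q g v y = y ∉ map g Q × (∀ {u} → u ∈ Q → v ~ u → ¬ Bl (g u) y)

  -- The common skeleton of all greedy embeddings: starting from `f` on `P`, the vertices of `vs`
  -- are placed one at a time, each at a host vertex satisfying `T`. A user only proves `Available`,
  -- that a place exists for `v`; its length bound is strict because `v` is not yet placed. `class`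
  -- remembers where the earlier vertices lie.
  module Place (T : Fin n → Fin N → Set) (vs P : List (Fin n)) (f : Fin n → Fin N) where

    record State (Q : List (Fin n)) (g : Fin n → Fin N) : Set where
      field
        pe     : Embeds Q g
        unique : Unique Q
        agree  : ∀ {u} → u ∈ P → g u ≡ f u
        class  : ∀ {u} → u ∈ Q → u ∈ P ⊎ (u ∈ vs × T u (g u))
    open State public

    Available : Set
    Available = ∀ Q g v → v ∈ vs → v ∉ Q → v ∉ P → State Q g → length Q < length vs + length P →
      ∃[ y ] T v y × Spot Q g v y

    private
      go : Available → ∀ todo Q g → State Q g → (∀ {u} → u ∈ P → u ∈ Q) → Unique todo →
        (∀ {v} → v ∈ todo → v ∈ vs × v ∉ Q) → length todo + length Q ≤ length vs + length P →
        ∃[ R ] ∃[ h ] State R h × (∀ {u} → u ∈ Q → u ∈ R) × (∀ {u} → u ∈ todo → u ∈ R)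
      go av [] Q g s _ _ _ _ = Q , g , s , id , λ ()
      go av (v ∷ todo) Q g s P⊆Q (v∉todo ∷ utodo) new len
        with new (here refl)
      ... | v∈vs , v∉Q with av Q g v v∈vs v∉Q (v∉Q ∘ P⊆Q) s (≤-trans (s≤s (m≤n+m _ (length todo))) len)
      ... | y , Ty , y∉ , ok
        with go av todo (v ∷ Q) (update g v y) s′ (there ∘ P⊆Q) utodo new′
               (subst (_≤ length vs + length P) (sym (+-suc (length todo) (length Q))) len)
        where
        gQ : ∀ {u} → u ∈ Q → update g v y u ≡ g u
        gQ u∈ = update-other g v y (∉⇒≢ v∉Q u∈)
        cl : ∀ {u} → u ∈ v ∷ Q → u ∈ P ⊎ (u ∈ vs × T u (update g v y u))
        cl (here refl) = inj₂ (v∈vs , subst (T v) (sym (update-same g v y)) Ty)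
        cl (there u∈) with class s u∈
        ... | inj₁ u∈P = inj₁ u∈P
        ... | inj₂ (u∈vs , Tu) = inj₂ (u∈vs , subst (T _) (sym (gQ u∈)) Tu)
        s′ : State (v ∷ Q) (update g v y)
        s′ = record
          { pe = extend (pe s) v∉Q y∉ ok
          ; unique = All.tabulate (λ u∈ e → v∉Q (subst (_∈ Q) (sym e) u∈)) ∷ unique s
          ; agree = λ u∈ → trans (gQ (P⊆Q u∈)) (agree s u∈)
          ; class = cl }
        new′ : ∀ {u} → u ∈ todo → u ∈ vs × u ∉ v ∷ Q
        new′ u∈ = proj₁ (new (there u∈)) ,
          λ { (here refl) → All.lookup v∉todo u∈ refl ; (there u∈Q) → proj₂ (new (there u∈)) u∈Q }
      ... | R , h , sR , Q⊆R , todo⊆R = R , h , sR , (Q⊆R ∘ there) ,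
        λ { (here refl) → Q⊆R (here refl) ; (there u∈) → todo⊆R u∈ }

    placeAll : Embeds P f → Unique P → Unique vs → (∀ {v} → v ∈ vs → v ∉ P) → Available →
      ∃[ g ] Embeds (vs ++ P) g × (∀ {u} → u ∈ P → g u ≡ f u) × (∀ {u} → u ∈ vs → T u (g u))
    placeAll p uP uvs disj av with go av vs P f
      (record { pe = p ; unique = uP ; agree = λ _ → refl ; class = inj₁ }) id uvs (λ v∈ → v∈ , disj v∈) ≤-refl
    ... | R , h , s , P⊆R , vs⊆R = h , Embeds-⊆ (λ u∈ → [ vs⊆R , P⊆R ]′ (∈-++⁻ vs u∈)) (pe s) , agree s ,
      λ u∈ → [ (λ u∈P → contradiction u∈P (disj u∈)) , proj₂ ]′ (class s (vs⊆R u∈))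

  -- Used host vertices exclude `length Q` places, and each placed neighbour of `v` excludes at most
  -- `D` more through its blue edges.
  freeSpot : ∀ {Q g v} D → Unique Q → (∀ {u} → u ∈ Q → v ~ u → length (blueNbrs (g u)) ≤ D) →
    length Q + deg v * D < N → ∃ (Spot Q g v)
  freeSpot {Q} {g} {v} D uQ small room = spot (pick (Uniqueₚ.allFin⁺ N) few)
    where
    Qv = filter (v ~?_) Q
    bad = concatMap (blueNbrs ∘ g) Qv
    bad≤ : length bad ≤ deg v * D
    bad≤ = ≤-trans
      (length-concatMap-≤ (blueNbrs ∘ g) Qv D λ u∈ → let (u∈Q , e) = ∈-filter⁻ (v ~?_) {xs = Q} u∈ in small u∈Q e)
      (*-monoˡ-≤ D (length-⊆ (Uniqueₚ.filter⁺ (v ~?_) uQ) λ u∈ → ∈-nbrs (proj₂ (∈-filter⁻ (v ~?_) {xs = Q} u∈))))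
    few : length (map g Q ++ bad) < length (allFin N)
    few = subst₂ _<_ (sym (trans (length-++ (map g Q)) (cong (_+ length bad) (length-map g Q)))) (sym (length-allFin N))
      (≤-<-trans (+-monoʳ-≤ (length Q) bad≤) room)
    spot : (∃[ y ] y ∈ allFin N × y ∉ map g Q ++ bad) → ∃ (Spot Q g v)
    spot (y , _ , y∉) = y , (y∉ ∘ ∈-++⁺ˡ) ,
      λ u∈ e b → y∉ (∈-++⁺ʳ (map g Q) (∈-concatMap (blueNbrs ∘ g) (∈-filter⁺ (v ~?_) u∈ e) (∈-blueNbrs b)))

-- Almost cliques and greedy embeddings

argmax : ∀ {A : Set} (f : A → ℕ) x xs → ∃[ y ] f x ≤ f y × (∀ {z} → z ∈ xs → f z ≤ f y)
argmax f x [] = x , ≤-refl , λ ()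
argmax f x (z ∷ xs) with argmax f x xs
... | y , x≤y , h with ≤-total (f z) (f y)
... | inj₁ z≤y = y , x≤y , λ { (here refl) → z≤y ; (there p) → h p }
... | inj₂ y≤z = z , ≤-trans x≤y y≤z , λ { (here refl) → ≤-refl ; (there p) → ≤-trans (h p) y≤z }

module Weights {n : ℕ} (H : Graph n) where

  open Degree H

  degSum-filter : ∀ {P : Fin n → Set} (P? : Decidable P) xs → degSum (filter P? xs) ≤ degSum xs
  degSum-filter P? [] = z≤n
  degSum-filter P? (x ∷ xs) with P? x
  ... | yes _ = +-monoʳ-≤ (deg x) (degSum-filter P? xs)
  ... | no  _ = ≤-trans (degSum-filter P? xs) (m≤n+m _ (deg x))

  degSum-≥ : ∀ a t S → (∀ {v} → v ∈ S → t ≤ a * deg v) → length S * t ≤ a * degSum S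
  degSum-≥ a t [] h = z≤n
  degSum-≥ a t (v ∷ S) h = subst (t + length S * t ≤_) (sym (*-distribˡ-+ a (deg v) (degSum S)))
    (h (here refl) ⊕ degSum-≥ a t S (h ∘ there))

module Sparse {n N : ℕ} (j ℓ : ℕ) (H : Graph n) (c : Colouring N) (L : List (Fin n)) where

  open Blue c
  open Degree H
  open Weights H
  open Embedding H c

  private
    k m : ℕ
    k = suc j
    m = length L

  placeInClique : ∀ A → Unique A → Red A → ∀ S → Unique S → length S ≤ length A →
    (f₀ : Fin n → Fin N) → ∃[ f ] Embeds S f × (∀ {v} → v ∈ S → f v ∈ A)
  placeInClique A uA redA S uS len f₀ = finish (placeAll Embeds-[] [] uS (λ _ ()) av)
    where
    open Place (λ _ y → y ∈ A) S [] f₀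
    av : Available
    av Q g v v∈ v∉Q _ s lt = spot (pick {ys = map g Q} uA (<-≤-trans
        (subst₂ _<_ (sym (length-map g Q)) (+-identityʳ (length S)) lt) len))
      where
      spot : (∃[ y ] y ∈ A × y ∉ map g Q) → ∃[ y ] y ∈ A × Spot Q g v y
      spot (y , y∈ , y∉) = y , y∈ , y∉ , λ u∈ _ → [ (λ ()) , (λ p → redA (proj₂ p) y∈) ]′ (class s u∈)
    finish : (∃[ g ] Embeds (S ++ []) g × (∀ {u} → u ∈ [] → g u ≡ f₀ u) × (∀ {u} → u ∈ S → g u ∈ A)) →
      ∃[ f ] Embeds S f × (∀ {v} → v ∈ S → f v ∈ A)
    finish (g , p , _ , t) = g , Embeds-⊆ ∈-++⁺ˡ p , t

  IndependentIn : List (Fin n) → ℕ → Set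
  IndependentIn low r = ∃[ X ] length X ≡ r × Unique X × (∀ {v} → v ∈ X → v ∈ low) ×
    (∀ {u v} → u ∈ X → v ∈ X → ¬ (u ~ v))

  -- Each chosen vertex blocks at most five candidates: itself and at most four neighbours.
  independent : ∀ r low → Unique low → (∀ {v} → v ∈ low → deg v ≤ 4) → 5 * r ≤ length low → IndependentIn low r
  independent zero low _ _ _ = [] , refl , [] , (λ ()) , λ ()
  independent (suc r) low ulow d4 len
    with independent r low ulow d4 (≤-trans (5 ⊛ n≤1+n r) len)
  ... | X , lenX , uX , X⊆ , ind = add (pick {ys = X ++ concatMap nbrs X} ulow (<-≤-trans bound len))
    where
    bound : length (X ++ concatMap nbrs X) < 5 * suc r
    bound = subst (_< 5 * suc r) (sym (length-++ X)) (≤-<-trans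
      (≤-reflexive lenX ⊕ subst (λ z → length (concatMap nbrs X) ≤ z * 4) lenX
        (length-concatMap-≤ nbrs X 4 (d4 ∘ X⊆)))
      (lt r))
      where
      lt : ∀ r → r + r * 4 < 5 * suc r
      lt r = ≤-trans (m≤m+n _ 4) (≤-reflexive (eq r))
        where
        eq : ∀ r → suc (r + r * 4) + 4 ≡ 5 * suc r
        eq = solve-∀
    add : (∃[ x ] x ∈ low × x ∉ X ++ concatMap nbrs X) → IndependentIn low (suc r)
    add (x , x∈ , x∉) = x ∷ X , cong suc lenX ,
      All.tabulate (λ u∈ e → x∉ (∈-++⁺ˡ (subst (_∈ X) (sym e) u∈))) ∷ uX ,
      (λ { (here refl) → x∈ ; (there u∈) → X⊆ u∈ }) , ind′
      where
      far : ∀ {u} → u ∈ X → ¬ (u ~ x)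
      far u∈ e = x∉ (∈-++⁺ʳ X (∈-concatMap nbrs u∈ (∈-nbrs e)))
      ind′ : ∀ {u v} → u ∈ x ∷ X → v ∈ x ∷ X → ¬ (u ~ v)
      ind′ (here refl) (here refl) e = ~-irrefl e refl
      ind′ (here refl) (there v∈) e = far v∈ (~-sym e)
      ind′ (there u∈) (here refl) e = far u∈ e
      ind′ (there u∈) (there v∈) e = ind u∈ v∈ e

  -- The clique is too small by `r` vertices, and `Ws` supplies them. The independent set `X` goes
  -- onto `Ws`, so that no colour inside `Ws` matters; its neighbours `Nb` go into `A`, off every
  -- vertex that is blue to `Ws`; the other vertices have no neighbour in `X` and go anywhere in
  -- `A`. `Nb` precedes the rest because only its places are restricted.
  module AlmostClique (f₀ : Fin n → Fin N) (uL : Unique L) (r : ℕ)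
    (A Ws : List (Fin N)) (uA : Unique A) (uWs : Unique Ws) (redA : Red A) (disj : ∀ {w} → w ∈ Ws → w ∉ A)
    (lenWs : length Ws ≡ r) (r+A : r + length A ≡ m)
    (few : ∀ {w} → w ∈ Ws → length (blueIn w A) ≤ 3 * k) (room : r * 5 + r * (3 * k) ≤ length A)
    (X : List (Fin n)) (lenX : length X ≡ r) (uX : Unique X) (X⊆L : ∀ {v} → v ∈ X → v ∈ L)
    (degX : ∀ {v} → v ∈ X → deg v ≤ 4) (indX : ∀ {u v} → u ∈ X → v ∈ X → ¬ (u ~ v)) where

    Γ = concatMap nbrs X
    Nb = filter (_∈? Γ) L
    uNb : Unique Nb
    uNb = Uniqueₚ.filter⁺ (_∈? Γ) uL
    Nb-Γ : ∀ {v} → v ∈ Nb → v ∈ Γ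
    Nb-Γ v∈ = proj₂ (∈-filter⁻ (_∈? Γ) {xs = L} v∈)
    lenNb : length Nb ≤ r * 4
    lenNb = ≤-trans (length-⊆ uNb Nb-Γ) (subst (λ z → length Γ ≤ z * 4) lenX
      (length-concatMap-≤ nbrs X 4 degX))
    Nb∉X : ∀ {v} → v ∈ Nb → v ∉ X
    Nb∉X v∈ v∈X with find (∈-concatMap⁻ nbrs {xs = X} (Nb-Γ v∈))
    ... | x , x∈ , v∈x = indX x∈ v∈X (∈-nbrs⁻ v∈x)

    stage₁ : ∃[ f ] Embeds X f × (∀ {v} → v ∈ X → f v ∈ Ws)
    stage₁ = fin (placeAll Embeds-[] [] uX (λ _ ()) av)
      where
      open Place (λ _ y → y ∈ Ws) X [] f₀
      av : Available
      av Q g v v∈ v∉Q _ s lt = spot (pick {ys = map g Q} uWs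
          (subst₂ _<_ (sym (length-map g Q)) (trans (+-identityʳ (length X)) (trans lenX (sym lenWs))) lt))
        where
        spot : (∃[ y ] y ∈ Ws × y ∉ map g Q) → ∃[ y ] y ∈ Ws × Spot Q g v y
        spot (y , y∈ , y∉) = y , y∈ , y∉ , λ u∈ e → [ (λ ()) , (λ p → contradiction e (indX v∈ (proj₁ p))) ]′ (class s u∈)
      fin : (∃[ g ] Embeds (X ++ []) g × (∀ {u} → u ∈ [] → g u ≡ f₀ u) × (∀ {u} → u ∈ X → g u ∈ Ws)) →
        ∃[ f ] Embeds X f × (∀ {v} → v ∈ X → f v ∈ Ws)
      fin (g , p , _ , t) = g , Embeds-⊆ ∈-++⁺ˡ p , t
    bad = concatMap (λ w → blueIn w A) Ws
    lenBad : length bad ≤ r * (3 * k)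
    lenBad = subst (λ z → length bad ≤ z * (3 * k)) lenWs
      (length-concatMap-≤ (λ w → blueIn w A) Ws (3 * k) few)

    stage₂ : ∀ f₁ → Embeds X f₁ → (∀ {v} → v ∈ X → f₁ v ∈ Ws) → ∃[ f ] Embeds (Nb ++ X) f × (∀ {v} → v ∈ X → f v ≡ f₁ v) × (∀ {v} → v ∈ Nb → f v ∈ A × f v ∉ bad)
    stage₂ f₁ p₁ f₁X = placeAll p₁ uX uNb Nb∉X av
      where
      open Place (λ _ y → y ∈ A × y ∉ bad) Nb X f₁
      av : Available
      av Q g v v∈ v∉Q _ s lt = spot (pick {ys = map g Q ++ bad} uA (≤-trans
          (subst (_< r * 5 + r * (3 * k)) (sym (trans (length-++ (map g Q)) (cong (_+ length bad) (length-map g Q))))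
            (<-≤-trans (+-monoˡ-< (length bad) lt) ((≤-trans (lenNb ⊕ ≤-reflexive lenX) (≤-reflexive (eq r))) ⊕ lenBad)))
          room))
        where
        eq : ∀ r → r * 4 + r ≡ r * 5
        eq = solve-∀
        spot : (∃[ y ] y ∈ A × y ∉ map g Q ++ bad) → ∃[ y ] (y ∈ A × y ∉ bad) × Spot Q g v y
        spot (y , y∈ , y∉) = y , (y∈ , y∉ ∘ ∈-++⁺ʳ (map g Q)) , (y∉ ∘ ∈-++⁺ˡ) , ok
          where
          ok : ∀ {u} → u ∈ Q → v ~ u → ¬ Bl (g u) y
          ok u∈ e b with class s u∈
          ... | inj₁ u∈X = y∉ (∈-++⁺ʳ (map g Q) (∈-concatMap (λ w → blueIn w A) (f₁X u∈X)
                  (∈-filter⁺ (Bl? _) y∈ (subst (λ z → Bl z y) (agree s u∈X) b))))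
          ... | inj₂ (_ , gu∈A , _) = redA gu∈A y∈ b
    rest? : Decidable (λ v → ¬ v ∈ Nb ++ X)
    rest? v = ¬? (v ∈? Nb ++ X)
    rest = filter rest? L

    stage₃ : ∀ f₂ → Embeds (Nb ++ X) f₂ → (∀ {v} → v ∈ X → f₂ v ∉ A) → (∀ {v} → v ∈ Nb → f₂ v ∈ A) →
      ∃[ f ] Embeds (rest ++ (Nb ++ X)) f
    stage₃ f₂ p₂ f₂X f₂Nb = forget (placeAll p₂ (Uniqueₚ.++⁺ uNb uX (λ (p , q) → Nb∉X p q)) (Uniqueₚ.filter⁺ rest? uL)
        (λ v∈ → proj₂ (∈-filter⁻ rest? {xs = L} v∈)) av)
      where
      open Place (λ _ y → y ∈ A) rest (Nb ++ X) f₂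
      X? : Decidable (λ v → v ∉ X)
      X? v = ¬? (v ∈? X)
      onX : ∀ {Q g} → State Q g → ∀ {u} → u ∈ X → g u ∉ A
      onX s u∈X gu∈A = f₂X u∈X (subst (_∈ A) (agree s (∈-++⁺ʳ Nb u∈X)) gu∈A)
      offX : ∀ {Q g} → State Q g → ∀ {u} → u ∈ Q → u ∉ X → g u ∈ A
      offX s u∈ u∉X with class s u∈
      ... | inj₂ (_ , t) = t
      ... | inj₁ u∈P with ∈-++⁻ Nb u∈P
      ... | inj₁ u∈Nb = subst (_∈ A) (sym (agree s u∈P)) (f₂Nb u∈Nb)
      ... | inj₂ u∈X = contradiction u∈X u∉X
      -- The fit is tight: `X` takes `r` vertices, and the other `m - r` are exactly as many as `A`
      -- has.
      L-X≤A : length (filter X? L) ≤ length A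
      L-X≤A = +-cancelˡ-≤ r _ _ (≤-trans (+-monoˡ-≤ (length (filter X? L)) (subst (_≤ length (filter (_∈? X) L)) lenX
        (length-⊆ uX (λ u∈ → ∈-filter⁺ (_∈? X) (X⊆L u∈) u∈))))
        (≤-reflexive (trans (sym (length-filter-¬ (_∈? X) L)) (sym r+A))))
      av : Available
      av Q g v v∈ v∉Q v∉P s lt = spot (pick {ys = map g (filter X? Q)} uA
          (subst (_< length A) (sym (length-map g (filter X? Q))) (≤-trans (length-⊆ uvQ vQ⊆) L-X≤A)))
        where
        Q⊆L : ∀ {u} → u ∈ Q → u ∈ L
        Q⊆L u∈ with class s u∈
        ... | inj₂ (u∈rest , _) = proj₁ (∈-filter⁻ rest? {xs = L} u∈rest)
        ... | inj₁ u∈P with ∈-++⁻ Nb u∈P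
        ... | inj₁ u∈Nb = proj₁ (∈-filter⁻ (_∈? Γ) {xs = L} u∈Nb)
        ... | inj₂ u∈X = X⊆L u∈X
        uvQ : Unique (v ∷ filter X? Q)
        uvQ = All.tabulate (λ u∈ e → v∉Q (subst (_∈ Q) (sym e) (proj₁ (∈-filter⁻ X? {xs = Q} u∈)))) ∷ Uniqueₚ.filter⁺ X? (unique s)
        vQ⊆ : ∀ {u} → u ∈ v ∷ filter X? Q → u ∈ filter X? L
        vQ⊆ (here refl) = ∈-filter⁺ X? (proj₁ (∈-filter⁻ rest? {xs = L} v∈)) (v∉P ∘ ∈-++⁺ʳ Nb)
        vQ⊆ (there u∈) = let (u∈Q , u∉X) = ∈-filter⁻ X? {xs = Q} u∈ in ∈-filter⁺ X? (Q⊆L u∈Q) u∉X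
        v∈L = proj₁ (∈-filter⁻ rest? {xs = L} v∈)
        spot : (∃[ y ] y ∈ A × y ∉ map g (filter X? Q)) → ∃[ y ] y ∈ A × Spot Q g v y
        spot (y , y∈ , y∉) = y , y∈ , fresh , ok
          where
          fresh : y ∉ map g Q
          fresh y∈Q with ∈-map⁻ g y∈Q
          ... | u , u∈ , refl with u ∈? X
          ... | yes u∈X = onX s u∈X y∈
          ... | no u∉X = y∉ (∈-map⁺ g (∈-filter⁺ X? u∈ u∉X))
          -- A neighbour of `v` in `X` would have put `v` into `Nb`; so all placed neighbours lie in
          -- the red clique.
          ok : ∀ {u} → u ∈ Q → v ~ u → ¬ Bl (g u) y
          ok {u} u∈ e = redA (offX s u∈ (λ u∈X → v∉P (∈-++⁺ˡ
            (∈-filter⁺ (_∈? Γ) v∈L (∈-concatMap nbrs u∈X (∈-nbrs (~-sym e))))))) y∈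
      forget : (∃[ f ] Embeds (rest ++ (Nb ++ X)) f × (∀ {v} → v ∈ Nb ++ X → f v ≡ f₂ v) × (∀ {v} → v ∈ rest → f v ∈ A)) →
        ∃[ f ] Embeds (rest ++ (Nb ++ X)) f
      forget (f , p , _) = f , p

    almostEmb : Emb L
    almostEmb =
      let (f₁ , p₁ , t₁) = stage₁
          (f₂ , p₂ , e₂ , t₂) = stage₂ f₁ p₁ t₁
          (f₃ , p₃) = stage₃ f₂ p₂ (λ v∈ v∈A → disj (t₁ v∈) (subst (_∈ A) (e₂ v∈) v∈A)) (λ v∈ → proj₁ (t₂ v∈))
      in f₃ , Embeds-⊆ cover p₃
      where
      cover : ∀ {u} → u ∈ L → u ∈ rest ++ (Nb ++ X)
      cover {u} u∈ with u ∈? Nb ++ X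
      ... | yes q = ∈-++⁺ʳ rest q
      ... | no ¬q = ∈-++⁺ˡ (∈-filter⁺ rest? u∈ ¬q)

  almostClique : Unique L → degSum L ≤ 2 * (m + ℓ) → m ≤ n → 330 * ℓ ≤ n → 36 * (k * k) ≤ n →
    (Fin n → Fin N) → ∀ A W → Unique A → Unique W → (∀ {w} → w ∈ W → w ∉ A) → Red A →
    n ≤ length A + length W → n ≤ length A + 2 * j → (∀ {w} → w ∈ W → length (blueIn w A) ≤ 3 * k) → Emb L
  almostClique uL sparse m≤n hℓ hk f₀ A W uA uW disj redA lenW lenA few with m ≤? length A
  ... | yes m≤A = let (f , p , _) = placeInClique A uA redA L uL m≤A f₀ in f , p
  ... | no  m≰A = from (independent r low (Uniqueₚ.filter⁺ low? uL) (λ v∈ → proj₂ (∈-filter⁻ low? {xs = L} v∈))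
      (low-degree-count (length low) (length high) m ℓ r j n (length A) (≤-reflexive (length-filter-¬ low? L))
        highBound (≤-reflexive r+A) lenA r≤2j hℓ 36k≤n))
    where
    r = m ∸ length A
    r+A : r + length A ≡ m
    r+A = m∸n+n≡m (<⇒≤ (≰⇒> m≰A))
    r≤W : r ≤ length W
    r≤W = m≤n+o⇒m∸n≤o m (length A) (≤-trans m≤n lenW)
    r≤2j : r ≤ 2 * j
    r≤2j = m≤n+o⇒m∸n≤o m (length A) (≤-trans m≤n lenA)
    low? : Decidable (λ v → deg v ≤ 4)
    low? v = deg v ≤? 4
    low = filter low? L
    high = filter (¬? ∘ low?) L
    highBound : 5 * length high ≤ 2 * (m + ℓ)
    highBound = ≤-trans (≤-reflexive (*-comm 5 (length high))) (≤-trans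
      (degSum-≥ 1 5 high (λ v∈ → subst (5 ≤_) (sym (*-identityˡ _)) (≰⇒> (proj₂ (∈-filter⁻ (¬? ∘ low?) {xs = L} v∈)))))
      (subst (_≤ 2 * (m + ℓ)) (sym (*-identityˡ _)) (≤-trans (degSum-filter (¬? ∘ low?) L) sparse)))
    36k≤n : 36 * k ≤ n
    36k≤n = ≤-trans (36 ⊛ m≤m*n k k) hk
    from : IndependentIn low r → Emb L
    from (X , lenX , uX , X⊆ , indX) = AlmostClique.almostEmb f₀ uL r A (take r W) uA (Uniqueₚ.take⁺ r uW) redA
      (disj ∘ ∈-take⁻ r) (length-take-≤ r≤W) r+A (few ∘ ∈-take⁻ r) (room-in-clique r j n (length A) r≤2j lenA hk)
      X lenX uX (λ v∈ → proj₁ (∈-filter⁻ low? {xs = L} (X⊆ v∈))) (λ v∈ → proj₂ (∈-filter⁻ low? {xs = L} (X⊆ v∈))) indX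

  greedyRest : ∀ D S f → Unique L → Unique S → Embeds S f → (∀ {v} → v ∈ S → v ∈ L) → (∀ x → length (blueNbrs x) ≤ D) →
    (∀ {v} → v ∈ L → v ∉ S → ∀ {q} → q < m → q + deg v * D < N) → Emb L
  greedyRest D S f uL uS p S⊆L small room = finish
      (placeAll p uS (Uniqueₚ.filter⁺ rest? uL) (λ v∈ → proj₂ (∈-filter⁻ rest? {xs = L} v∈)) av)
    where
    rest? : Decidable (λ v → ¬ v ∈ S)
    rest? v = ¬? (v ∈? S)
    rest = filter rest? L
    open Place (λ _ _ → ⊤) rest S f
    rest+S : length rest + length S ≤ m
    rest+S = subst (_≤ m) (length-++ rest) (length-⊆
      (Uniqueₚ.++⁺ (Uniqueₚ.filter⁺ rest? uL) uS (λ (a , b) → proj₂ (∈-filter⁻ rest? {xs = L} a) b))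
      (λ u∈ → [ (λ a → proj₁ (∈-filter⁻ rest? {xs = L} a)) , S⊆L ]′ (∈-++⁻ rest u∈)))
    av : Available
    av Q g v v∈ v∉Q v∉S s lt =
      let (y , sp) = freeSpot {Q} {g} {v} D (unique s) (λ _ _ → small _)
                       (room (proj₁ (∈-filter⁻ rest? {xs = L} v∈)) v∉S (<-≤-trans lt rest+S))
      in y , tt , sp
    finish : (∃[ g ] Embeds (rest ++ S) g × (∀ {u} → u ∈ S → g u ≡ f u) × (∀ {u} → u ∈ rest → ⊤)) → Emb L
    finish (g , q , _) = g , Embeds-⊆ cover q
      where
      cover : ∀ {u} → u ∈ L → u ∈ rest ++ S
      cover {u} u∈ with u ∈? S
      ... | yes a = ∈-++⁺ʳ rest a
      ... | no ¬a = ∈-++⁺ˡ (∈-filter⁺ rest? u∈ ¬a)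

  module _ (nofan : ¬ BlueFan (suc j)) where
    open NoFan j nofan

    -- If all blue degrees are below `6k`, the maximum degree `Δ` of the embedded graph suffices for
    -- the greedy choice. Otherwise a vertex of maximum blue degree `D ≥ 6k` yields a red clique of
    -- order `a ≥ 2D/3`, as the loss of `2j` is at most a third; it receives the vertices whose
    -- degree is too large for the greedy choice.
    greedyEmb : ∀ Δ → (Fin n → Fin N) → Unique L → degSum L ≤ 2 * (m + ℓ) → (∀ {v} → v ∈ L → deg v ≤ Δ) →
      Δ * (6 * k) + m ≤ N → 4 * m + 3 * ℓ ≤ N → Emb L
    greedyEmb Δ f₀ uL sparse maxdeg roomΔ room with Finₚ.any? (λ x → 6 * k ≤? length (blueNbrs x))
    ... | no none = greedyRest (6 * k) [] f₀ uL [] Embeds-[] (λ ()) (λ x → ≰⇒≥ (λ h → none (x , h)))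
      (λ {v} v∈ _ {q} q<m → <-≤-trans (+-mono-<-≤ q<m (*-monoˡ-≤ (6 * k) (maxdeg v∈)))
        (subst (_≤ N) (+-comm (Δ * (6 * k)) m) roomΔ))
    ... | yes (x₀ , big) = large (argmax (length ∘ blueNbrs) x₀ (allFin N))
      where
      large : (∃[ x ] length (blueNbrs x₀) ≤ length (blueNbrs x) × (∀ {z} → z ∈ allFin N → length (blueNbrs z) ≤ length (blueNbrs x))) → Emb L
      large (x , x₀≤x , mx) with redClique x (blueNbrs x) (blueNbrs-unique x) ∈-blueNbrs⁻
      ... | A , uA , _ , redA , lenA = greedyRest D S (proj₁ emb₁) uL uS (proj₁ (proj₂ emb₁))
              (λ v∈ → proj₁ (∈-filter⁻ S? {xs = L} v∈)) (λ z → mx (∈-allFin z))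
              (λ {v} v∈ v∉ {q} q<m → greedy-room q (deg v) D a E m ℓ N 2D≤3a
                (≮⇒≥ (λ h → v∉ (∈-filter⁺ S? v∈ h))) sparse q<m room)
        where
        D = length (blueNbrs x)
        a = length A
        E = degSum L
        -- The threshold `E / a` balances both sides: degrees sum to `E`, so at most `a` vertices
        -- exceed it, and a vertex below it forbids at most `dD ≤ 3E/2` places.
        S? : Decidable (λ v → E < a * deg v)
        S? v = E <? a * deg v
        S = filter S? L
        uS = Uniqueₚ.filter⁺ S? uL
        2D≤3a : 2 * D ≤ 3 * a
        2D≤3a = blue-degree-vs-clique D a j lenA (≤-trans big x₀≤x)
        S≤a : length S ≤ a
        S≤a = high-degree-few (length S) a E (≤-trans
          (degSum-≥ a (suc E) S (λ v∈ → proj₂ (∈-filter⁻ S? {xs = L} v∈))) (a ⊛ degSum-filter S? L))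
        emb₁ = placeInClique A uA redA S uS S≤a f₀

-- Connected sparse graphs

module FromRelation {n : ℕ} (R : Fin n → Fin n → Set) (R? : ∀ u v → Dec (R u v))
         (R-sym : ∀ {u v} → R u v → R v u) (R-irr : ∀ {v} → ¬ R v v) where

  mkGraph : Graph n
  mkGraph = record
    { adj     = λ u v → does (R? u v)
    ; adj-sym = λ u v → symm u v
    ; irrefl  = λ v → dec-false (R? v v) R-irr }
    where
    symm : ∀ u v → does (R? u v) ≡ does (R? v u)
    symm u v with R? u v | R? v u
    ... | yes _ | yes _ = refl
    ... | no  _ | no  _ = refl
    ... | yes r | no ¬r = contradiction (R-sym r) ¬r
    ... | no ¬r | yes r = contradiction (R-sym r) ¬r

  mkGraph⁺ : ∀ {u v} → R u v → adj mkGraph u v ≡ true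
  mkGraph⁺ {u} {v} r = dec-true (R? u v) r

  mkGraph⁻ : ∀ {u v} → adj mkGraph u v ≡ true → R u v
  mkGraph⁻ {u} {v} e with R? u v
  ... | yes r = r

module Darts {n : ℕ} (H : Graph n) where

  open Degree H

  -- Oriented edges. A degree sum is the length of this duplicate-free list, so edge counts of two
  -- graphs can be compared by inclusion.
  darts : List (Fin n) → List (Fin n × Fin n)
  darts = concatMap (λ a → map (a ,_) (nbrs a))

  length-darts : ∀ L → length (darts L) ≡ degSum L
  length-darts []      = refl
  length-darts (a ∷ L) = trans (length-++ (map (a ,_) (nbrs a))) (cong₂ _+_ (length-map _ (nbrs a)) (length-darts L))

  ∈-darts : ∀ {L a b} → a ∈ L → a ~ b → (a , b) ∈ darts L
  ∈-darts a∈ e = ∈-concatMap (λ a → map (a ,_) (nbrs a)) a∈ (∈-map⁺ _ (∈-nbrs e))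

  ∈-darts⁻ : ∀ {L d} → d ∈ darts L → proj₁ d ∈ L × proj₁ d ~ proj₂ d
  ∈-darts⁻ {L} d∈ with find (∈-concatMap⁻ (λ a → map (a ,_) (nbrs a)) {xs = L} d∈)
  ... | a , a∈ , d∈a with ∈-map⁻ (a ,_) d∈a
  ... | b , b∈ , refl = a∈ , ∈-nbrs⁻ b∈

  darts-unique : ∀ {L} → Unique L → Unique (darts L)
  darts-unique [] = []
  darts-unique {a ∷ L} (a∉ ∷ u) = Uniqueₚ.++⁺ (Uniqueₚ.map⁺ (λ { refl → refl }) (nbrs-unique a)) (darts-unique u)
    λ (p , q) → disj p q
    where
    disj : ∀ {d} → d ∈ map (a ,_) (nbrs a) → d ∉ darts L
    disj p q with ∈-map⁻ (a ,_) p
    ... | _ , _ , refl = All.lookup a∉ (proj₁ (∈-darts⁻ {L} q)) refl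

-- The graphs of the induction: H is a graph on the vertices in L, all other elements of Fin n being isolated.
record IsSparse {n : ℕ} (ℓ : ℕ) (H : Graph n) (L : List (Fin n)) : Set where
  open Degree H
  field
    uniq  : Unique L
    supp  : ∀ {u v} → u ~ v → u ∈ L
    conn  : ∀ {u v} → u ∈ L → v ∈ L → Reachable H u v
    edges : degSum L ≤ 2 * (length L + ℓ)
open IsSparse public

Reachable-closed : ∀ {n} {H : Graph n} (P : Fin n → Set) → (∀ {a b} → P a → adj H a b ≡ true → P b) →
  ∀ {u w} → Reachable H u w → P u → P w
Reachable-closed P cl here       p = p
Reachable-closed P cl (step e r) p = Reachable-closed P cl r (cl p e)

-- A walk through `v` enters from some `a` and leaves to some `b`. If `v` was a leaf then `a ≡ b`;
-- if `v` was suppressed, the alternative is the new edge `ab`.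
Reachable-bypass : ∀ {n} {H H′ : Graph n} v → (∀ {a b} → a ≢ v → b ≢ v → adj H a b ≡ true → adj H′ a b ≡ true) →
  (∀ {a b} → adj H a v ≡ true → adj H v b ≡ true → a ≡ b ⊎ adj H′ a b ≡ true) →
  ∀ {u w} → Reachable H u w → u ≢ v → w ≢ v → Reachable H′ u w
Reachable-bypass v keep cut here _ _ = here
Reachable-bypass {H = H} v keep cut (step {v = x} e r) u≢v w≢v with x ≟ᶠ v
... | no x≢v = step (keep u≢v x≢v e) (Reachable-bypass v keep cut r x≢v w≢v)
... | yes refl with r
... | here = contradiction refl w≢v
... | step {v = y} e′ r′ with y ≟ᶠ v | cut e e′
... | yes refl | _ = contradiction refl (Degree.~-irrefl H e′)
... | no y≢v | inj₁ refl = Reachable-bypass v keep cut r′ y≢v w≢v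
... | no y≢v | inj₂ e″ = step e″ (Reachable-bypass v keep cut r′ y≢v w≢v)

module Remove {n : ℕ} (v : Fin n) where

  other? : Decidable (_≢ v)
  other? u = ¬? (u ≟ᶠ v)

  without : List (Fin n) → List (Fin n)
  without = filter other?

  ∈-without : ∀ {L u} → u ∈ L → u ≢ v → u ∈ without L
  ∈-without = ∈-filter⁺ other?

  ∈-without⁻ : ∀ {L u} → u ∈ without L → u ∈ L × u ≢ v
  ∈-without⁻ {L} = ∈-filter⁻ other? {xs = L}

  without-unique : ∀ {L} → Unique L → Unique (without L)
  without-unique = Uniqueₚ.filter⁺ other?

  v∷without : ∀ {L} → Unique L → Unique (v ∷ without L)
  v∷without {L} u = All.tabulate (λ x∈ e → proj₂ (∈-without⁻ {L} x∈) (sym e)) ∷ without-unique u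

  length-without : ∀ {L} → Unique L → v ∈ L → suc (length (without L)) ≤ length L
  length-without {L} u v∈ = length-⊆ (v∷without u)
    λ { (here refl) → v∈ ; (there x∈) → proj₁ (∈-without⁻ {L} x∈) }

  length-without′ : ∀ {L} → Unique L → length L ≤ suc (length (without L))
  length-without′ {L} u = length-⊆ u λ {x} x∈ → [ here , there ∘ ∈-without x∈ ]′ (split x)
    where
    split : ∀ x → x ≡ v ⊎ x ≢ v
    split x with x ≟ᶠ v
    ... | yes e = inj₁ e
    ... | no ¬e = inj₂ ¬e

module DeleteLeaf {n : ℕ} (H : Graph n) (v p : Fin n) where

  open Degree H
  open Remove v

  Kept : Fin n → Fin n → Set
  Kept a b = a ~ b × a ≢ v × b ≢ v

  kept? : ∀ a b → Dec (Kept a b)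
  kept? a b = (a ~? b) ×-dec (other? a ×-dec other? b)

  kept-sym : ∀ {a b} → Kept a b → Kept b a
  kept-sym (e , a≢v , b≢v) = ~-sym e , b≢v , a≢v

  kept-irr : ∀ {a} → ¬ Kept a a
  kept-irr (e , _) = ~-irrefl e refl

  open FromRelation Kept kept? kept-sym kept-irr public
    renaming (mkGraph to delete; mkGraph⁻ to delete⁻) hiding (mkGraph⁺)
  open FromRelation Kept kept? kept-sym kept-irr using (mkGraph⁺)

  delete⁺ : ∀ {a b} → a ≢ v → b ≢ v → a ~ b → adj delete a b ≡ true
  delete⁺ a≢v b≢v e = mkGraph⁺ (e , a≢v , b≢v)

  delete-sparse : ∀ {ℓ L} → IsSparse ℓ H L → v ~ p → (∀ {w} → v ~ w → w ≡ p) → IsSparse ℓ delete (without L)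
  delete-sparse {ℓ} {L} s vp only = record
    { uniq  = without-unique (uniq s)
    ; supp  = λ e → let (e′ , a , _) = delete⁻ e in ∈-without (supp s e′) a
    ; conn  = λ u∈ w∈ → let (u∈L , u≢) = ∈-without⁻ {L} u∈ ; (w∈L , w≢) = ∈-without⁻ {L} w∈ in
        Reachable-bypass v delete⁺ (λ av vb → inj₁ (trans (only (~-sym av)) (sym (only vb)))) (conn s u∈L w∈L) u≢ w≢
    ; edges = drop-two-darts (degSum L) (Degree.degSum delete (without L)) (length L) (length (without L)) ℓ
        (subst₂ (λ a b → 2 + a ≤ b) (D′.length-darts (without L)) (D.length-darts L) (length-⊆ u⁺ sub))
        (length-without′ (uniq s)) (edges s) }
    where
    module D = Darts H
    module D′ = Darts delete
    old : ∀ {d} → d ∈ D′.darts (without L) → d ∈ D.darts L × proj₁ d ≢ v × proj₂ d ≢ v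
    old d∈ = let (_ , e) = D′.∈-darts⁻ {without L} d∈ ; (e′ , a , b) = delete⁻ e in D.∈-darts (supp s e′) e′ , a , b
    u⁺ : Unique ((v , p) ∷ (p , v) ∷ D′.darts (without L))
    u⁺ = ((λ { refl → ~-irrefl vp refl }) ∷ All.tabulate (λ d∈ → λ { refl → proj₁ (proj₂ (old d∈)) refl })) ∷
         All.tabulate (λ d∈ → λ { refl → proj₂ (proj₂ (old d∈)) refl }) ∷ D′.darts-unique (without-unique (uniq s))
    sub : ∀ {d} → d ∈ (v , p) ∷ (p , v) ∷ D′.darts (without L) → d ∈ D.darts L
    sub (here refl) = D.∈-darts (supp s vp) vp
    sub (there (here refl)) = D.∈-darts (supp s (~-sym vp)) (~-sym vp)
    sub (there (there d∈)) = proj₁ (old d∈)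

-- Leaves

module Leaves {n N : ℕ} (j ℓ : ℕ) (hN : suc N ≡ 2 * n) (hk : 36 * (suc j * suc j) ≤ n) (hℓ : 330 * ℓ ≤ n)
  (c : Colouring N) (nofan : ¬ Blue.BlueFan c (suc j))
  (H : Graph n) (L : List (Fin n)) (sp : IsSparse ℓ H L) (m≤n : length L ≤ n) where

  open Blue c
  open NoFan j nofan
  open Degree H
  open Embedding H c
  open Sparse j ℓ H c L

  private
    k m : ℕ
    k = suc j
    m = length L

  leaf? : Decidable (λ v → deg v ≡ 1)
  leaf? v = deg v ℕ.≟ 1

  parent : ∀ {v} → deg v ≡ 1 → ∃[ p ] v ~ p × (∀ {w} → v ~ w → w ≡ p)
  parent {v} d = go (nbrs v) refl d
    where
    go : ∀ xs → nbrs v ≡ xs → length xs ≡ 1 → ∃[ p ] v ~ p × (∀ {w} → v ~ w → w ≡ p)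
    go (p ∷ []) eq _ = p , ∈-nbrs⁻ (subst (p ∈_) (sym eq) (here refl)) ,
      λ {w} e → single (subst (w ∈_) eq (∈-nbrs e))
      where
      single : ∀ {w} → w ∈ p ∷ [] → w ≡ p
      single (here e) = e

  -- The smaller copy uses at most `n - 1` vertices and the image of the parent has at most `n - 1`
  -- blue neighbours; one of the `2n - 1` host vertices is left for the leaf.
  removeOneLeaf : (∀ x → length (blueNbrs x) < n) → ∀ {v} → v ∈ L → deg v ≡ 1 →
    (∀ {H′ L′} → IsSparse ℓ H′ L′ → length L′ < m → Embedding.Emb H′ c L′) → Emb L
  removeOneLeaf small {v} v∈ d ih with parent d
  ... | p , vp , only = finish (ih (delete-sparse sp vp only) (length-without (uniq sp) v∈))
    where
    open DeleteLeaf H v p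
    open Remove v
    finish : Embedding.Emb delete c (without L) → Emb L
    finish (f , q) = add (freeSpot {without L} {f} {v} (n ∸ 1) (without-unique (uniq sp))
        (λ _ _ → ∸-monoˡ-≤ 1 (small _))
        (subst (λ z → length (without L) + z * (n ∸ 1) < N) (sym d)
          (one-leaf-room _ n N hN (≤-trans (length-without (uniq sp) v∈) m≤n))))
      where
      q′ : Embeds (without L) f
      q′ = record { inj = Embedding.inj q
                  ; red = λ a b e → Embedding.red q a b (delete⁺ (proj₂ (∈-without⁻ {L} a)) (proj₂ (∈-without⁻ {L} b)) e) }
      add : ∃ (Spot (without L) f v) → Emb L
      add (y , y∉ , ok) = update f v y , Embeds-⊆ cover (extend q′ (λ v∈′ → proj₂ (∈-without⁻ {L} v∈′) refl) y∉ ok)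
        where
        cover : ∀ {u} → u ∈ L → u ∈ v ∷ without L
        cover {u} u∈ with u ≟ᶠ v
        ... | yes e = here e
        ... | no ¬e = there (∈-without u∈ ¬e)

  -- Two adjacent leaves form a whole component. As `m` is large, the parent of a leaf is therefore
  -- never a leaf.
  adjacentLeaves : ∀ {u v} → deg u ≡ 1 → deg v ≡ 1 → u ~ v → m ≤ 2
  adjacentLeaves {u} {v} du dv e = length-⊆ {ys = u ∷ v ∷ []} (uniq sp)
      λ {w} w∈ → Reachable-closed {H = H} (_∈ u ∷ v ∷ []) closed (conn sp (supp sp e) w∈) (here refl)
    where
    only : ∀ {a b} → deg a ≡ 1 → a ~ b → ∀ {w} → a ~ w → w ≡ b
    only da ab aw = let (_ , _ , o) = parent da in trans (o aw) (sym (o ab))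
    closed : ∀ {a b} → a ∈ u ∷ v ∷ [] → a ~ b → b ∈ u ∷ v ∷ []
    closed (here refl) ab = there (here (only du e ab))
    closed (there (here refl)) ab = here (only dv (~-sym e) ab)

  module _ (x : Fin N) (A : List (Fin N)) (uA : Unique A) (redA : Red A) (lenA : n ≤ length A + 2 * j)
           (A<m : length A < m) where

    -- Vertices of the clique to which a leaf can still be attached greedily, since fewer than `n`
    -- vertices are blocked by their blue edges.
    good? : Decidable (λ a → length (blueNbrs a) < n)
    good? a = length (blueNbrs a) <? n

    Good = filter good? A

    -- The clique may lack `2j` of `n` vertices, so setting aside `2j + 1` leaves makes the rest fit
    -- into it. There are at most as many parents as leaves, hence enough good places for them.
    parentsInGood : ∀ Lv → Unique Lv → length Lv ≡ suc (2 * j) → (∀ {v} → v ∈ Lv → v ∈ L × deg v ≡ 1) →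
      suc (2 * j) ≤ length Good → Emb L
    parentsInGood Lv uLv lenLv leaves lenGood =
      let (f₁ , p₁ , t₁) = stage₁
          (f₂ , p₂ , e₂ , _) = stage₂ f₁ p₁ t₁
          (f₃ , p₃ , _) = stage₃ f₂ p₂ (λ v∈ → subst (_∈ Good) (sym (e₂ v∈)) (t₁ v∈))
      in f₃ , Embeds-⊆ cover p₃
      where
      Γ = concatMap nbrs Lv
      Pa = filter (_∈? Γ) L
      uPa = Uniqueₚ.filter⁺ (_∈? Γ) (uniq sp)
      lenPa : length Pa ≤ length Good
      lenPa = ≤-trans (length-⊆ uPa (λ u∈ → proj₂ (∈-filter⁻ (_∈? Γ) {xs = L} u∈)))
        (≤-trans (length-concatMap-≤ nbrs Lv 1 (λ v∈ → ≤-reflexive (proj₂ (leaves v∈))))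
          (≤-trans (≤-reflexive (trans (*-identityʳ _) lenLv)) lenGood))
      Pa∉Lv : ∀ {v} → v ∈ Pa → v ∉ Lv
      Pa∉Lv v∈ v∈Lv with find (∈-concatMap⁻ nbrs {xs = Lv} (proj₂ (∈-filter⁻ (_∈? Γ) {xs = L} v∈)))
      ... | u , u∈ , v∈u = <⇒≱ (three-vertices m (length A) n j A<m lenA hk)
        (adjacentLeaves (proj₂ (leaves u∈)) (proj₂ (leaves v∈Lv)) (∈-nbrs⁻ v∈u))
      stage₁ : ∃[ f ] Embeds Pa f × (∀ {v} → v ∈ Pa → f v ∈ Good)
      stage₁ = placeInClique Good (Uniqueₚ.filter⁺ good? uA)
        (λ a b → redA (proj₁ (∈-filter⁻ good? {xs = A} a)) (proj₁ (∈-filter⁻ good? {xs = A} b))) Pa uPa lenPa (λ _ → x)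
      core? : Decidable (λ v → v ∉ Lv ++ Pa)
      core? v = ¬? (v ∈? Lv ++ Pa)
      core = filter core? L
      uCore = Uniqueₚ.filter⁺ core? (uniq sp)
      uCP : Unique (core ++ Pa)
      uCP = Uniqueₚ.++⁺ uCore uPa (λ (a , b) → proj₂ (∈-filter⁻ core? {xs = L} a) (∈-++⁺ʳ Lv b))
      CP∉Lv : ∀ {v} → v ∈ core ++ Pa → v ∉ Lv
      CP∉Lv v∈ v∈Lv with ∈-++⁻ core v∈
      ... | inj₁ a = proj₂ (∈-filter⁻ core? {xs = L} a) (∈-++⁺ˡ v∈Lv)
      ... | inj₂ b = Pa∉Lv b v∈Lv
      CP⊆L : ∀ {v} → v ∈ core ++ Pa → v ∈ L
      CP⊆L v∈ = [ (λ a → proj₁ (∈-filter⁻ core? {xs = L} a)) , (λ b → proj₁ (∈-filter⁻ (_∈? Γ) {xs = L} b)) ]′ (∈-++⁻ core v∈)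
      total : length ((core ++ Pa) ++ Lv) ≤ m
      total = length-⊆ (Uniqueₚ.++⁺ uCP uLv (λ (a , b) → CP∉Lv a b))
        λ u∈ → [ CP⊆L , proj₁ ∘ leaves ]′ (∈-++⁻ (core ++ Pa) u∈)
      CP≤A : length (core ++ Pa) ≤ length A
      CP≤A = core-fits _ (length Lv) m n (length A) j (subst (_≤ m) (length-++ (core ++ Pa)) total) m≤n lenLv lenA
      stage₂ : ∀ f₁ → Embeds Pa f₁ → (∀ {v} → v ∈ Pa → f₁ v ∈ Good) → ∃[ g ] Embeds (core ++ Pa) g × (∀ {u} → u ∈ Pa → g u ≡ f₁ u) × (∀ {u} → u ∈ core → g u ∈ A)
      stage₂ f₁ p₁ f₁Good = placeAll p₁ uPa uCore (λ v∈ v∈Pa → proj₂ (∈-filter⁻ core? {xs = L} v∈) (∈-++⁺ʳ Lv v∈Pa)) av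
        where
        open Place (λ _ y → y ∈ A) core Pa f₁
        av : Available
        av Q g v v∈ v∉Q _ s lt = spot (pick {ys = map g Q} uA
            (subst (_< length A) (sym (length-map g Q)) (<-≤-trans lt (subst (_≤ length A) (length-++ core) CP≤A))))
          where
          inA : ∀ {u} → u ∈ Q → g u ∈ A
          inA u∈ with class s u∈
          ... | inj₁ u∈Pa = subst (_∈ A) (sym (agree s u∈Pa)) (proj₁ (∈-filter⁻ good? {xs = A} (f₁Good u∈Pa)))
          ... | inj₂ (_ , t) = t
          spot : (∃[ y ] y ∈ A × y ∉ map g Q) → ∃[ y ] y ∈ A × Spot Q g v y
          spot (y , y∈ , y∉) = y , y∈ , y∉ , λ u∈ _ → redA (inA u∈) y∈
      stage₃ : ∀ f₂ → Embeds (core ++ Pa) f₂ → (∀ {v} → v ∈ Pa → f₂ v ∈ Good) → ∃[ g ] Embeds (Lv ++ (core ++ Pa)) g × (∀ {u} → u ∈ core ++ Pa → g u ≡ f₂ u) × (∀ {u} → u ∈ Lv → ⊤)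
      stage₃ f₂ p₂ f₂Good = placeAll p₂ uCP uLv (λ v∈ v∈CP → CP∉Lv v∈CP v∈) av
        where
        open Place (λ _ _ → ⊤) Lv (core ++ Pa) f₂
        av : Available
        av Q g v v∈ v∉Q _ s lt = let (y , t) = freeSpot {Q} {g} {v} (n ∸ 1) (unique s) small room in y , tt , t
          where
          small : ∀ {u} → u ∈ Q → v ~ u → length (blueNbrs (g u)) ≤ n ∸ 1
          small {u} u∈ e with class s u∈
          ... | inj₂ (u∈Lv , _) = contradiction u∈Lv (Pa∉Lv (∈-filter⁺ (_∈? Γ) (supp sp (~-sym e)) (∈-concatMap nbrs v∈ (∈-nbrs e))))
          ... | inj₁ u∈CP = ∸-monoˡ-≤ 1 (subst (λ z → length (blueNbrs z) < n) (sym (agree s u∈CP))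
                  (proj₂ (∈-filter⁻ good? {xs = A} (f₂Good u∈Pa))))
            where
            u∈Pa : u ∈ Pa
            u∈Pa = ∈-filter⁺ (_∈? Γ) (supp sp (~-sym e)) (∈-concatMap nbrs v∈ (∈-nbrs e))
          room : length Q + deg v * (n ∸ 1) < N
          room = subst (λ z → length Q + z * (n ∸ 1) < N) (sym (proj₂ (leaves v∈)))
            (one-leaf-room (length Q) n N hN (<-≤-trans lt (≤-trans (≤-reflexive (+-comm (length Lv) (length (core ++ Pa))))
              (≤-trans (subst (_≤ m) (length-++ (core ++ Pa)) total) m≤n))))
      cover : ∀ {u} → u ∈ L → u ∈ Lv ++ (core ++ Pa)
      cover {u} u∈ with u ∈? Lv ++ Pa
      ... | no ¬a = ∈-++⁺ʳ Lv (∈-++⁺ˡ (∈-filter⁺ core? u∈ ¬a))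
      ... | yes a = [ ∈-++⁺ˡ , ∈-++⁺ʳ Lv ∘ ∈-++⁺ʳ core ]′ (∈-++⁻ Lv a)

    -- Most of `A` is bad, that is, of blue degree at least `n`, and each bad vertex is blue to all
    -- but `2j` of the vertices of `A′`. A vertex outside both cliques cannot have many blue
    -- neighbours in both, so it can be added to one of them as part of an almost clique.
    module TwoCliques (lenGood : length Good ≤ 2 * j) (A′ : List (Fin N)) (uA′ : Unique A′) (redA′ : Red A′)
      (lenA′ : n ≤ length A′ + 2 * j) (A′∉A : ∀ {y} → y ∈ A′ → y ∉ A) where

      out? : Decidable (λ u → u ∉ A ++ A′)
      out? u = ¬? (u ∈? A ++ A′)
      U = filter out? (allFin N)
      uU = Uniqueₚ.filter⁺ out? (Uniqueₚ.allFin⁺ N)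
      -- More than `3k` leaves at least `k` after a loss of `2j`: to good vertices in `A`, or to red
      -- neighbours in `A′`.
      toA? : Decidable (λ u → length (blueIn u A) ≤ 3 * k)
      toA? u = length (blueIn u A) ≤? 3 * k
      U₁ = filter toA? U
      U₂ = filter (¬? ∘ toA?) U
      out : ∀ {u} → u ∈ U → u ∉ A ++ A′
      out u∈ = proj₂ (∈-filter⁻ out? {xs = allFin N} u∈)
      N≤ : N ≤ (length A + length U₁) + (length A′ + length U₂)
      N≤ = subst (_≤ (length A + length U₁) + (length A′ + length U₂)) (length-allFin N)
        (≤-trans (length-⊆ {ys = (A ++ A′) ++ U} (Uniqueₚ.allFin⁺ N) λ {u} _ → cover u)
          (≤-reflexive (trans (length-++ (A ++ A′)) (trans (cong₂ _+_ (length-++ A) (length-filter-¬ toA? U))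
            (shuffle (length A) (length A′) (length U₁) (length U₂))))))
        where
        cover : ∀ u → u ∈ (A ++ A′) ++ U
        cover u with u ∈? A ++ A′
        ... | yes p = ∈-++⁺ˡ p
        ... | no ¬p = ∈-++⁺ʳ (A ++ A′) (∈-filter⁺ out? (∈-allFin u) ¬p)
        shuffle : ∀ a b c d → a + b + (c + d) ≡ a + c + (b + d)
        shuffle = solve-∀
      fewInA′ : ∀ {u} → u ∈ U₂ → length (blueIn u A′) ≤ 3 * k
      -- Otherwise the bad blue neighbours of `u` in `A` can be matched in blue into its blue
      -- neighbours in `A′`, a fan with centre `u`.
      fewInA′ {u} u∈ = ≮⇒≥ λ many → nofan (fanFromBipartite k u S (blueIn u A′) (2 * j)
          (Uniqueₚ.filter⁺ (¬? ∘ good?) (Uniqueₚ.filter⁺ (Bl? u) uA)) (Uniqueₚ.filter⁺ (Bl? u) uA′)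
          (λ s∈ s∈′ → A′∉A (proj₁ (∈-filter⁻ (Bl? u) {xs = A′} s∈′)) (S⊆A s∈))
          (λ s∈ → proj₂ (∈-filter⁻ (Bl? u) {xs = A} (proj₁ (∈-filter⁻ (¬? ∘ good?) {xs = blueIn u A} s∈))))
          (λ p∈ → proj₂ (∈-filter⁻ (Bl? u) {xs = A′} p∈))
          (blue-bad-many _ (length S) (length Good) j manyS lenGood (≰⇒> (proj₂ (∈-filter⁻ (¬? ∘ toA?) {xs = U} u∈))))
          few (fan-room j _ many))
        where
        S = filter (¬? ∘ good?) (blueIn u A)
        S⊆A : ∀ {s} → s ∈ S → s ∈ A
        S⊆A s∈ = proj₁ (∈-filter⁻ (Bl? u) {xs = A} (proj₁ (∈-filter⁻ (¬? ∘ good?) {xs = blueIn u A} s∈)))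
        manyS : length (blueIn u A) ≤ length S + length Good
        manyS = ≤-trans (≤-reflexive (trans (length-filter-¬ good? (blueIn u A)) (+-comm _ (length S))))
          (+-monoʳ-≤ (length S) (length-⊆ (Uniqueₚ.filter⁺ good? (Uniqueₚ.filter⁺ (Bl? u) uA))
            λ a∈ → let (a∈′ , g) = ∈-filter⁻ good? {xs = blueIn u A} a∈ in
              ∈-filter⁺ good? (proj₁ (∈-filter⁻ (Bl? u) {xs = A} a∈′)) g))
        few : ∀ {s} → s ∈ S → length (redIn s (blueIn u A′)) ≤ 2 * j
        -- The red neighbours counted here, the at least `n` blue neighbours of `s`, and `A` are
        -- disjoint in a host of `2n - 1` vertices.
        few {s} s∈ = red-outside-few _ (length (blueNbrs s)) (length A) n j N hN
            (subst₂ _≤_ (trans (length-++ R) (cong (length R +_) (length-++ (blueNbrs s)))) (length-allFin N)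
              (length-⊆ uAll (λ {z} _ → ∈-allFin z)))
            (≮⇒≥ (proj₂ (∈-filter⁻ (¬? ∘ good?) {xs = blueIn u A} s∈))) lenA
          where
          R = redIn s (blueIn u A′)
          R⁻ : ∀ {z} → z ∈ R → z ∈ A′ × ¬ Bl s z
          R⁻ z∈ = let (p , q) = ∈-filter⁻ (¬? ∘ Bl? s) {xs = blueIn u A′} z∈ in proj₁ (∈-filter⁻ (Bl? u) {xs = A′} p) , q
          uAll : Unique (R ++ (blueNbrs s ++ A))
          uAll = Uniqueₚ.++⁺ (Uniqueₚ.filter⁺ (¬? ∘ Bl? s) (Uniqueₚ.filter⁺ (Bl? u) uA′))
            (Uniqueₚ.++⁺ (blueNbrs-unique s) uA (λ (a , b) → redA (S⊆A s∈) b (∈-blueNbrs⁻ a)))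
            (λ (a , b) → [ (λ p → proj₂ (R⁻ a) (∈-blueNbrs⁻ p)) , A′∉A (proj₁ (R⁻ a)) ]′ (∈-++⁻ (blueNbrs s) b))

      twoCliques : Emb L
      twoCliques with n ≤? length A + length U₁
      ... | yes h = almostClique (uniq sp) (edges sp) m≤n hℓ hk (λ _ → x) A U₁ uA (Uniqueₚ.filter⁺ toA? uU)
        (λ w∈ w∈A → out (proj₁ (∈-filter⁻ toA? {xs = U} w∈)) (∈-++⁺ˡ w∈A)) redA h lenA
        (λ w∈ → proj₂ (∈-filter⁻ toA? {xs = U} w∈))
      ... | no h = almostClique (uniq sp) (edges sp) m≤n hℓ hk (λ _ → x) A′ U₂ uA′ (Uniqueₚ.filter⁺ (¬? ∘ toA?) uU)
        (λ w∈ w∈A → out (proj₁ (∈-filter⁻ (¬? ∘ toA?) {xs = U} w∈)) (∈-++⁺ʳ A w∈A)) redA′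
        (one-side-large _ _ n N hN N≤ (≰⇒> h)) lenA′ fewInA′

    -- Any bad vertex `a₀` of `A` supplies the second clique; it is disjoint from `A` because it is
    -- blue to `a₀` and `A` is red.
    fewGood : length Good ≤ 2 * j → Emb L
    fewGood lenGood = fromBad (pick {ys = []} (Uniqueₚ.filter⁺ (¬? ∘ good?) uA)
        (bad-vertices-exist (length A) (length Good) (length (filter (¬? ∘ good?) A)) n j
          (≤-reflexive (length-filter-¬ good? A)) lenGood lenA hk))
      where
      fromClique : ∀ a₀ → a₀ ∈ A → n ≤ length (blueNbrs a₀) → (Σ[ A′ ∈ List (Fin N) ] Unique A′ ×
        (∀ {y} → y ∈ A′ → y ∈ blueNbrs a₀) × Red A′ × length (blueNbrs a₀) ≤ length A′ + 2 * j) → Emb L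
      fromClique a₀ a₀∈ big (A′ , uA′ , A′⊆ , redA′ , len) =
        TwoCliques.twoCliques lenGood A′ uA′ redA′ (≤-trans big len) (λ y∈′ y∈ → redA a₀∈ y∈ (∈-blueNbrs⁻ (A′⊆ y∈′)))
      fromBad : (∃[ a ] a ∈ filter (¬? ∘ good?) A × a ∉ []) → Emb L
      fromBad (a₀ , a₀∈bad , _) = let (a₀∈ , bad) = ∈-filter⁻ (¬? ∘ good?) {xs = A} a₀∈bad in
        fromClique a₀ a₀∈ (≮⇒≥ bad) (redClique a₀ (blueNbrs a₀) (blueNbrs-unique a₀) ∈-blueNbrs⁻)

  module _ (many : suc (2 * j) ≤ length (filter leaf? L)) where

    private
      Lv = take (suc (2 * j)) (filter leaf? L)

    largeBlueDegree : ∀ x → n ≤ length (blueNbrs x) → (Σ[ A ∈ List (Fin N) ] Unique A ×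
      (∀ {y} → y ∈ A → y ∈ blueNbrs x) × Red A × length (blueNbrs x) ≤ length A + 2 * j) → Emb L
    largeBlueDegree x big (A , uA , _ , redA , len) = bySize (m ≤? length A)
      where
      byGood : (A<m : length A < m) → Dec (suc (2 * j) ≤ length (Good x A uA redA (≤-trans big len) A<m)) → Emb L
      byGood A<m (no few) = fewGood x A uA redA (≤-trans big len) A<m (≤-pred (≰⇒> few))
      byGood A<m (yes enough) = parentsInGood x A uA redA (≤-trans big len) A<m Lv
        (Uniqueₚ.take⁺ (suc (2 * j)) (Uniqueₚ.filter⁺ leaf? (uniq sp))) (length-take-≤ {xs = filter leaf? L} many)
        (λ v∈ → ∈-filter⁻ leaf? {xs = L} (∈-take⁻ (suc (2 * j)) v∈)) enough
      bySize : Dec (m ≤ length A) → Emb L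
      bySize (yes m≤A) = let (f , p , _) = placeInClique A uA redA L (uniq sp) m≤A (λ _ → x) in f , p
      bySize (no m≰A)  = byGood (≰⇒> m≰A) (_ ≤? _)

    manyLeaves : (∀ {H′ L′} → IsSparse ℓ H′ L′ → length L′ < m → Embedding.Emb H′ c L′) → Emb L
    manyLeaves ih = byDegree (Finₚ.any? (λ x → n ≤? length (blueNbrs x)))
      where
      byDegree : Dec (∃[ x ] n ≤ length (blueNbrs x)) → Emb L
      byDegree (yes (x , big)) = largeBlueDegree x big (redClique x (blueNbrs x) (blueNbrs-unique x) ∈-blueNbrs⁻)
      byDegree (no none) = fromLeaf (pick {ys = []} (Uniqueₚ.filter⁺ leaf? (uniq sp)) (≤-trans (s≤s z≤n) many))
        where
        fromLeaf : (∃[ v ] v ∈ filter leaf? L × v ∉ []) → Emb L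
        fromLeaf (v , v∈ , _) = let (v∈L , d) = ∈-filter⁻ leaf? {xs = L} v∈ in
          removeOneLeaf (λ x → ≰⇒> (λ h → none (x , h))) v∈L d ih

-- Suspended paths

-- The list holds the inner vertices only, so that a path between fixed ends can be compared with a
-- rearrangement of its interior.
data Path {A : Set} (R : A → A → Set) : A → List A → A → Set where
  last : ∀ {p t} → R p t → Path R p [] t
  _∷_  : ∀ {p u us t} → R p u → Path R u us t → Path R p (u ∷ us) t

headOr : {A : Set} → List A → A → A
headOr []      t = t
headOr (u ∷ _) t = u

changeStart : ∀ {A : Set} {R : A → A → Set} {p u us t} → Path R p us t → R u (headOr us t) → Path R u us t
changeStart (last _) r = last r
changeStart (_ ∷ π)  r = r ∷ π

map-path : ∀ {A B : Set} {R : A → A → Set} {S : B → B → Set} (f : A → B) {p us t} →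
  (∀ {a b} → a ∈ p ∷ us → R a b → S (f a) (f b)) → Path R p us t → Path S (f p) (map f us) (f t)
map-path f h (last r) = last (h (here refl) r)
map-path f h (r ∷ π)  = h (here refl) r ∷ map-path f (h ∘ there) π

Unique-map : ∀ {A B : Set} (f : A → B) {xs} → (∀ {a b} → a ∈ xs → b ∈ xs → f a ≡ f b → a ≡ b) →
  Unique xs → Unique (map f xs)
Unique-map f inj [] = []
Unique-map f {x ∷ xs} inj (x∉ ∷ u) = All.tabulate fresh ∷ Unique-map f (λ a b → inj (there a) (there b)) u
  where
  fresh : ∀ {z} → z ∈ map f xs → f x ≢ z
  fresh z∈ e with ∈-map⁻ f z∈
  ... | w , w∈ , refl = All.lookup x∉ w∈ (inj (here refl) (there w∈) e)

module _ {A : Set} where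

  flat-++ : (M M′ : List (A × A)) → flat (M ++ M′) ≡ flat M ++ flat M′
  flat-++ []            M′ = refl
  flat-++ ((a , b) ∷ M) M′ = cong (λ z → a ∷ b ∷ z) (flat-++ M M′)

  flat-take-unique : ∀ k (M : List (A × A)) → Unique (flat M) → Unique (flat (take k M))
  flat-take-unique k M u = Unique-++ˡ (flat (take k M))
    (subst Unique (trans (cong flat (sym (take++drop≡id k M))) (flat-++ (take k M) (drop k M))) u)

  flat-take-⊆ : ∀ k (M : List (A × A)) {x} → x ∈ flat (take k M) → x ∈ flat M
  flat-take-⊆ (suc k) (_ ∷ M) (here e)           = here e
  flat-take-⊆ (suc k) (_ ∷ M) (there (here e))   = there (here e)
  flat-take-⊆ (suc k) (_ ∷ M) (there (there x∈)) = there (there (flat-take-⊆ k M x∈))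

  pairUp : List A → List (A × A)
  pairUp (a ∷ b ∷ xs) = (a , b) ∷ pairUp xs
  pairUp _            = []

  flat-pairUp-All : ∀ {P : A → Set} {xs} → All P xs → All P (flat (pairUp xs))
  flat-pairUp-All []              = []
  flat-pairUp-All (_ ∷ [])        = []
  flat-pairUp-All (pa ∷ pb ∷ pxs) = pa ∷ pb ∷ flat-pairUp-All pxs

  flat-pairUp-Unique : ∀ {xs : List A} → Unique xs → Unique (flat (pairUp xs))
  flat-pairUp-Unique []                    = []
  flat-pairUp-Unique (_ ∷ [])              = []
  flat-pairUp-Unique ((ab ∷ a∉) ∷ b∉ ∷ u) = (ab ∷ flat-pairUp-All a∉) ∷ flat-pairUp-All b∉ ∷ flat-pairUp-Unique u

  pairUp-AllPairs : ∀ {R : A → A → Set} {xs} → AllPairs R xs → All (λ e → R (proj₁ e) (proj₂ e)) (pairUp xs)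
  pairUp-AllPairs []                  = []
  pairUp-AllPairs (_ ∷ [])            = []
  pairUp-AllPairs ((ab ∷ _) ∷ _ ∷ ps) = ab ∷ pairUp-AllPairs ps

  length-pairUp : ∀ k (xs : List A) → k + k ≤ length xs → k ≤ length (pairUp xs)
  length-pairUp zero    _            _ = z≤n
  length-pairUp (suc k) (a ∷ [])     h = contradiction (≤-trans (≤-reflexive (cong suc (sym (+-suc k k)))) h) λ { (s≤s ()) }
  length-pairUp (suc k) (a ∷ b ∷ xs) h = s≤s (length-pairUp k xs
    (≤-pred (≤-pred (≤-trans (≤-reflexive (cong suc (sym (+-suc k k)))) h))))

module Reroute {N : ℕ} (c : Colouring N) (y : Fin N) where

  open Blue c

  red-sym : ∀ {a b} → RedEdge a b → RedEdge b a
  red-sym {a} {b} r = trans (csym c b a) r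

  blueOr : ∀ {a b} → a ≢ b → ¬ RedEdge a b → Bl a b
  blueOr a≢b ¬r = a≢b , ¬-not ¬r

  -- The set of the Chvátal-Erdős argument: successors, along the path, of the vertices that are red
  -- to `y`.
  succs : Fin N → List (Fin N) → Fin N → List (Fin N)
  succs p [] t with Bl? y p
  ... | yes _ = []
  ... | no  _ = t ∷ []
  succs p (u ∷ us) t with Bl? y p
  ... | yes _ = succs u us t
  ... | no  _ = u ∷ succs u us t

  length-succs : ∀ p us t → length (succs p us t) ≡ length (redIn y (p ∷ us))
  length-succs p [] t with Bl? y p
  ... | yes b = sym (cong length (filter-reject (¬? ∘ Bl? y) {xs = []} (λ ¬b → ¬b b)))
  ... | no ¬b = sym (cong length (filter-accept (¬? ∘ Bl? y) {xs = []} ¬b))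
  length-succs p (u ∷ us) t with Bl? y p
  ... | yes b = trans (length-succs u us t) (sym (cong length (filter-reject (¬? ∘ Bl? y) {xs = u ∷ us} (λ ¬b → ¬b b))))
  ... | no ¬b = trans (cong suc (length-succs u us t)) (sym (cong length (filter-accept (¬? ∘ Bl? y) {xs = u ∷ us} ¬b)))

  succs-⊆ : ∀ p us t {s} → s ∈ succs p us t → s ∈ us ++ t ∷ []
  succs-⊆ p [] t s∈ with Bl? y p
  succs-⊆ p [] t s∈ | no _ = s∈
  succs-⊆ p (u ∷ us) t s∈ with Bl? y p
  succs-⊆ p (u ∷ us) t s∈         | yes _ = there (succs-⊆ u us t s∈)
  succs-⊆ p (u ∷ us) t (here e)   | no _ = here e
  succs-⊆ p (u ∷ us) t (there s∈) | no _ = there (succs-⊆ u us t s∈)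

  -- If y is red to the predecessor of s on a path from u, and u to s, then one can go from y to that
  -- predecessor, walk back to u, jump to s and continue; p and rs are the vertices passed so far, reversed.
  reroute : ∀ {u us₀ t} p rs us → (∀ {xs} → Path RedEdge u xs t → Path RedEdge p (rs ++ xs) t) →
    p ∷ rs ++ us ↭ u ∷ us₀ → (∀ {z} → z ∈ p ∷ us → y ≢ z) → Path RedEdge p us t →
    ∀ {s} → s ∈ succs p us t → RedEdge u s → ∃[ us′ ] Path RedEdge y us′ t × us′ ↭ u ∷ us₀
  reroute p rs [] back perm y≢ π s∈ us with Bl? y p
  reroute p rs [] back perm y≢ π (here refl) us | no ¬b =
    p ∷ rs ++ [] , ¬Bl⇒red (y≢ (here refl)) ¬b ∷ back (changeStart π us) , perm
  reroute p rs (v ∷ vs) back perm y≢ (r ∷ π) s∈ us with Bl? y p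
  reroute p rs (v ∷ vs) back perm y≢ (r ∷ π) (here refl) us | no ¬b =
    p ∷ rs ++ v ∷ vs , ¬Bl⇒red (y≢ (here refl)) ¬b ∷ back (us ∷ π) , perm
  reroute p rs (v ∷ vs) back perm y≢ (r ∷ π) (there s∈) us | no _ =
    reroute v (p ∷ rs) vs (λ ρ → red-sym r ∷ back ρ) (↭-trans (↭-sym (shift v (p ∷ rs) vs)) perm) (y≢ ∘ there) π s∈ us
  reroute p rs (v ∷ vs) back perm y≢ (r ∷ π) s∈ us | yes _ =
    reroute v (p ∷ rs) vs (λ ρ → red-sym r ∷ back ρ) (↭-trans (↭-sym (shift v (p ∷ rs) vs)) perm) (y≢ ∘ there) π s∈ us

  -- Any order of the inner vertices is allowed, not just `y` put between two neighbours: rerouting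
  -- reverses a segment of the path.
  NoInsertion : Fin N → List (Fin N) → Fin N → Set
  NoInsertion p us t = ∀ us′ → Path RedEdge p us′ t → us′ ↭ y ∷ us → ⊥

  -- If `y` is red to the successor of one of its red neighbours, it fits between them; if two
  -- successors are joined in red, `reroute` absorbs `y`. Both contradict `NoInsertion`.
  succs-blue : ∀ p us t → Path RedEdge p us t → (∀ {z} → z ∈ p ∷ us ++ t ∷ [] → y ≢ z) → Unique (us ++ t ∷ []) →
    NoInsertion p us t → All (Bl y) (succs p us t) × AllPairs Bl (succs p us t)
  succs-blue p [] t (last r) y≢ u no-ins with Bl? y p
  ... | yes _ = [] , []
  ... | no ¬b = blueOr (y≢ (there (here refl)))
      (λ yt → no-ins (y ∷ []) (red-sym (¬Bl⇒red (y≢ (here refl)) ¬b) ∷ last yt) ↭-refl) ∷ [] , [] ∷ []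
  succs-blue p (v ∷ vs) t (r ∷ π) y≢ (v∉ ∷ u) no-ins
    -- An insertion into the tail becomes one into the whole path after `v` is put in front.
    with succs-blue v vs t π (y≢ ∘ there) u
           (λ us′ ρ perm → no-ins (v ∷ us′) (r ∷ ρ) (↭-trans (↭-prep v perm) (↭-swap v y ↭-refl)))
  ... | yS , SS with Bl? y p
  ... | yes _ = yS , SS
  ... | no ¬b = blueOr (y≢ (there (here refl))) (λ yv → no-ins (y ∷ v ∷ vs) (py ∷ yv ∷ π) ↭-refl) ∷ yS ,
      All.tabulate (λ s∈ → blueOr (All.lookup v∉ (succs-⊆ v vs t s∈)) (far s∈)) ∷ SS
    where
    py : RedEdge p y
    py = red-sym (¬Bl⇒red (y≢ (here refl)) ¬b)
    far : ∀ {s} → s ∈ succs v vs t → ¬ RedEdge v s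
    far s∈ vs-red with reroute v [] vs id ↭-refl (λ z∈ → y≢ (there (∈-++⁺ˡ z∈))) π s∈ vs-red
    ... | us′ , ρ , perm = no-ins (y ∷ us′) (py ∷ ρ) (↭-prep y perm)

  -- With `2k` red neighbours, the successors form a blue clique of order `2k` in the blue
  -- neighbourhood of `y`; pairing them up gives a fan.
  few-red : ∀ j → ¬ BlueFan (suc j) → ∀ p us t → Path RedEdge p us t → (∀ {z} → z ∈ p ∷ us ++ t ∷ [] → y ≢ z) →
    Unique (us ++ t ∷ []) → NoInsertion p us t → length (redIn y (p ∷ us)) ≤ suc (2 * j)
  few-red j nofan p us t π y≢ u no-ins = ≮⇒≥ λ many → nofan (fan! many (succs-blue p us t π y≢ u no-ins))
    where
    fan! : suc (2 * j) < length (redIn y (p ∷ us)) → All (Bl y) (succs p us t) × AllPairs Bl (succs p us t) → BlueFan (suc j)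
    fan! many (yS , SS) = y , pairUp (succs p us t) ,
      length-pairUp (suc j) (succs p us t) (subst₂ _≤_ (double j) (sym (length-succs p us t)) many) ,
      pairUp-AllPairs SS , (λ x∈ → All.lookup (flat-pairUp-All yS) x∈) , flat-pairUp-Unique (AllPairs.map proj₁ SS)
      where
      double : ∀ j → suc (suc (2 * j)) ≡ suc j + suc j
      double = solve-∀

module Suspended {n : ℕ} (H : Graph n) where

  open Degree H

  data Sus : Fin n → List (Fin n) → Fin n → Set where
    []  : ∀ {p t} → Sus p [] t
    _∷_ : ∀ {p u us t} → (∀ {w} → u ~ w → w ≡ p ⊎ w ≡ headOr us t) → Sus u us t → Sus p (u ∷ us) t

module Suppress {n : ℕ} (H : Graph n) (v x y : Fin n) (x≢y : x ≢ y) where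

  open Degree H
  open Remove v

  Kept : Fin n → Fin n → Set
  Kept a b = (a ~ b × a ≢ v × b ≢ v) ⊎ ((a ≡ x × b ≡ y) ⊎ (a ≡ y × b ≡ x))

  kept? : ∀ a b → Dec (Kept a b)
  kept? a b = ((a ~? b) ×-dec (other? a ×-dec other? b)) ⊎-dec
    (((a ≟ᶠ x) ×-dec (b ≟ᶠ y)) ⊎-dec ((a ≟ᶠ y) ×-dec (b ≟ᶠ x)))

  kept-sym : ∀ {a b} → Kept a b → Kept b a
  kept-sym (inj₁ (e , a≢v , b≢v))      = inj₁ (~-sym e , b≢v , a≢v)
  kept-sym (inj₂ (inj₁ (refl , refl))) = inj₂ (inj₂ (refl , refl))
  kept-sym (inj₂ (inj₂ (refl , refl))) = inj₂ (inj₁ (refl , refl))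

  kept-irr : ∀ {a} → ¬ Kept a a
  kept-irr (inj₁ (e , _))             = ~-irrefl e refl
  kept-irr (inj₂ (inj₁ (refl , x≡y))) = x≢y x≡y
  kept-irr (inj₂ (inj₂ (refl , y≡x))) = x≢y (sym y≡x)

  open FromRelation Kept kept? kept-sym kept-irr public
    renaming (mkGraph to suppress; mkGraph⁻ to suppress⁻; mkGraph⁺ to suppress⁺)

  -- Four darts at `v` disappear and at most two appear; if `x` and `y` were already adjacent, none
  -- appears, and the bound still holds.
  suppress-sparse : ∀ {ℓ L} → IsSparse ℓ H L → v ~ x → v ~ y → (∀ {w} → v ~ w → w ≡ x ⊎ w ≡ y) →
    IsSparse ℓ suppress (without L)
  suppress-sparse {ℓ} {L} s vx vy only = record
    { uniq  = without-unique (uniq s)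
    ; supp  = λ e → supp′ (suppress⁻ e)
    ; conn  = λ u∈ w∈ → let (u∈L , u≢) = ∈-without⁻ {L} u∈ ; (w∈L , w≢) = ∈-without⁻ {L} w∈ in
        Reachable-bypass v (λ a≢v b≢v e → suppress⁺ (inj₁ (e , a≢v , b≢v))) (λ av vb → cut (only (~-sym av)) (only vb))
          (conn s u∈L w∈L) u≢ w≢
    ; edges = drop-two-darts (degSum L) (Degree.degSum suppress (without L)) (length L) (length (without L)) ℓ
        (subst₂ (λ a b → 2 + a ≤ b) (D′.length-darts (without L)) (D.length-darts L)
          (suppressed-darts (length (D.darts L)) (length (D′.darts (without L))) (length old)
            (length-⊆ (D′.darts-unique (without-unique (uniq s))) new⊆) (length-⊆ u⁺ sub)))
        (length-without′ (uniq s)) (edges s) }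
    where
    module D = Darts H
    module D′ = Darts suppress
    x≢v : x ≢ v
    x≢v e = ~-irrefl vx (sym e)
    y≢v : y ≢ v
    y≢v e = ~-irrefl vy (sym e)
    supp′ : ∀ {a b} → Kept a b → a ∈ without L
    supp′ (inj₁ (e , a≢v , _))       = ∈-without (supp s e) a≢v
    supp′ (inj₂ (inj₁ (refl , _))) = ∈-without (supp s (~-sym vx)) x≢v
    supp′ (inj₂ (inj₂ (refl , _))) = ∈-without (supp s (~-sym vy)) y≢v
    cut : ∀ {a b} → a ≡ x ⊎ a ≡ y → b ≡ x ⊎ b ≡ y → a ≡ b ⊎ adj suppress a b ≡ true
    cut (inj₁ refl) (inj₁ refl) = inj₁ refl
    cut (inj₁ refl) (inj₂ refl) = inj₂ (suppress⁺ (inj₂ (inj₁ (refl , refl))))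
    cut (inj₂ refl) (inj₁ refl) = inj₂ (suppress⁺ (inj₂ (inj₂ (refl , refl))))
    cut (inj₂ refl) (inj₂ refl) = inj₁ refl
    Away : Fin n × Fin n → Set
    Away d = proj₁ d ≢ v × proj₂ d ≢ v
    away? : Decidable Away
    away? d = other? (proj₁ d) ×-dec other? (proj₂ d)
    old = filter away? (D.darts L)
    old⁻ : ∀ {d} → d ∈ old → d ∈ D.darts L × Away d
    old⁻ = ∈-filter⁻ away? {xs = D.darts L}
    new⊆ : ∀ {d} → d ∈ D′.darts (without L) → d ∈ (x , y) ∷ (y , x) ∷ old
    new⊆ d∈ with suppress⁻ (proj₂ (D′.∈-darts⁻ {without L} d∈))
    ... | inj₁ (e , a≢v , b≢v)       = there (there (∈-filter⁺ away? (D.∈-darts (supp s e) e) (a≢v , b≢v)))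
    ... | inj₂ (inj₁ (refl , refl)) = here refl
    ... | inj₂ (inj₂ (refl , refl)) = there (here refl)
    u⁺ : Unique ((v , x) ∷ (v , y) ∷ (x , v) ∷ (y , v) ∷ old)
    u⁺ = ((λ { refl → x≢y refl }) ∷ (λ { refl → x≢v refl }) ∷ (λ { refl → y≢v refl }) ∷
            All.tabulate (λ d∈ → λ { refl → proj₁ (proj₂ (old⁻ d∈)) refl })) ∷
         ((λ { refl → x≢v refl }) ∷ (λ { refl → y≢v refl }) ∷
            All.tabulate (λ d∈ → λ { refl → proj₁ (proj₂ (old⁻ d∈)) refl })) ∷
         ((λ { refl → x≢y refl }) ∷ All.tabulate (λ d∈ → λ { refl → proj₂ (proj₂ (old⁻ d∈)) refl })) ∷
         All.tabulate (λ d∈ → λ { refl → proj₂ (proj₂ (old⁻ d∈)) refl }) ∷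
         Uniqueₚ.filter⁺ away? (D.darts-unique (uniq s))
    sub : ∀ {d} → d ∈ (v , x) ∷ (v , y) ∷ (x , v) ∷ (y , v) ∷ old → d ∈ D.darts L
    sub (here refl) = D.∈-darts (supp s vx) vx
    sub (there (here refl)) = D.∈-darts (supp s vy) vy
    sub (there (there (here refl))) = D.∈-darts (supp s (~-sym vx)) (~-sym vx)
    sub (there (there (there (here refl)))) = D.∈-darts (supp s (~-sym vy)) (~-sym vy)
    sub (there (there (there (there d∈)))) = proj₁ (old⁻ d∈)

module PlacePath {n N : ℕ} (H : Graph n) (c : Colouring N) where

  open Blue c
  open Degree H
  open Embedding H c
  open Suspended H

  red⇒¬Bl : ∀ {a b} → RedEdge a b → ¬ Bl a b
  red⇒¬Bl r (_ , b) = contradiction (trans (sym r) b) λ ()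

  red⇒¬Bl′ : ∀ {a b} → RedEdge a b → ¬ Bl b a
  red⇒¬Bl′ r b = red⇒¬Bl r (Bl-sym b)

  -- Inner vertices have no neighbours off the path, so only the red path carrying them and its two
  -- ends have to be checked.
  placePath : ∀ {L p us t zs a b} Q f → Embeds Q f → p ∈ Q → t ∈ Q → f p ≡ a → f t ≡ b →
    (∀ {u} → u ∈ us → u ∉ Q) → Unique us → (∀ {z} → z ∈ zs → z ∉ map f Q) → Unique zs → length us ≡ length zs →
    Path RedEdge a zs b → Sus p us t → (∀ {u} → u ∈ L → u ∈ us ⊎ u ∈ Q) → Emb L
  placePath {us = []} Q f pe _ _ _ _ _ _ _ _ _ _ _ cover = f , Embeds-⊆ (λ u∈ → [ (λ ()) , id ]′ (cover u∈)) pe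
  placePath {L} {p} {u ∷ us} {t} {z ∷ zs} {a} {b} Q f pe p∈ t∈ fp ft us∉ (u∉ ∷ uus) zs∉ (z∉ ∷ uzs) len (r ∷ π) (nb ∷ sus) cover =
    placePath (u ∷ Q) g (extend pe (us∉ (here refl)) (zs∉ (here refl)) (ok nb π)) (here refl) (there t∈)
      (update-same f u z) (trans (gQ t∈) ft)
      (λ w∈ → λ { (here refl) → All.lookup u∉ w∈ refl ; (there w∈Q) → us∉ (there w∈) w∈Q }) uus
      zs∉′ uzs (suc-injective len) π sus cover′
    where
    g = update f u z
    gQ : ∀ {w} → w ∈ Q → g w ≡ f w
    gQ w∈ = update-other f u z (∉⇒≢ (us∉ (here refl)) w∈)
    zs∉′ : ∀ {z′} → z′ ∈ zs → z′ ∉ map g (u ∷ Q)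
    zs∉′ z′∈ (here e) = All.lookup z∉ z′∈ (sym (trans e (update-same f u z)))
    zs∉′ z′∈ (there m∈) with ∈-map⁻ g m∈
    ... | w , w∈ , e = zs∉ (there z′∈) (subst (_∈ map f Q) (sym (trans e (gQ w∈))) (∈-map⁺ f w∈))
    cover′ : ∀ {w} → w ∈ L → w ∈ us ⊎ w ∈ u ∷ Q
    cover′ w∈ with cover w∈
    ... | inj₁ (here e)   = inj₂ (here e)
    ... | inj₁ (there w∈) = inj₁ w∈
    ... | inj₂ w∈Q        = inj₂ (there w∈Q)
    next : ∀ {us zs} → Path RedEdge z zs b → length us ≡ length zs → (∀ {w} → w ∈ us → w ∉ Q) → ∀ {w} → w ∈ Q →
      w ≡ headOr us t → ¬ Bl (f w) z
    next {[]} (last r′) _ _ w∈ refl = subst (λ v → ¬ Bl v z) (sym ft) (red⇒¬Bl′ r′)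
    next {u′ ∷ us} π _ us∉ w∈ refl = contradiction w∈ (us∉ (here refl))
    ok : (∀ {w} → u ~ w → w ≡ p ⊎ w ≡ headOr us t) → Path RedEdge z zs b → ∀ {w} → w ∈ Q → u ~ w → ¬ Bl (f w) z
    ok nb π w∈ e with nb e
    ... | inj₁ refl = subst (λ v → ¬ Bl v z) (sym fp) (red⇒¬Bl r)
    ... | inj₂ w≡   = next π (suc-injective len) (us∉ ∘ there) w∈ w≡

module LongPath {n N : ℕ} (j ℓ : ℕ) (hN : suc N ≡ 2 * n) (hk : 36 * (suc j * suc j) ≤ n) (hℓ : 330 * ℓ ≤ n)
  (c : Colouring N) (nofan : ¬ Blue.BlueFan c (suc j))
  (H : Graph n) (L : List (Fin n)) (sp : IsSparse ℓ H L) (m≤n : length L ≤ n) where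

  open Blue c
  open Degree H
  open Embedding H c
  open Sparse j ℓ H c L
  open Suspended H
  open PlacePath H c using (placePath)

  private
    k m : ℕ
    k = suc j
    m = length L

  -- Vertices of `Y` are blue to nearly all of `Pth`. Hence `k` disjoint blue edges in `Y` have a
  -- common blue neighbour on `Pth`, the centre of a fan, and a maximal matching leaves a red clique
  -- of all but `2j` vertices of `Y`.
  blueToPath : ∀ Pth Y → Unique Pth → length Pth ≡ 4 * (k * k) → Unique Y → n ≤ length Y → (∀ {y} → y ∈ Y → y ∉ Pth) →
    (∀ {y} → y ∈ Y → length (redIn y Pth) ≤ suc (2 * j)) → (Fin n → Fin N) → Emb L
  blueToPath Pth Y uP lenP uY lenY disj few f₀ = split (maxMatching Y)
    where
    split : (Σ[ A ∈ List (Fin N) ] Σ[ M ∈ List (Fin N × Fin N) ]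
      (A ++ flat M ↭ Y) × All (λ e → Bl (proj₁ e) (proj₂ e)) M × Red A) → Emb L
    split (A , M , perm , blM , redA) =
      almostClique (uniq sp) (edges sp) m≤n hℓ hk f₀ A (flat M) uA uM
        (λ w∈ w∈A → disjoint uAM w∈A w∈) redA
        (≤-trans lenY (≤-reflexive (trans (sym (↭-length perm)) (length-++ A))))
        (≤-trans lenY (≤-trans (≤-reflexive (trans (sym (↭-length perm)) (length-++ A)))
          (+-monoʳ-≤ (length A) (subst (_≤ 2 * j) (sym (length-flat M)) (2 ⊛ M≤j)))))
        fewW
      where
      uAM : Unique (A ++ flat M)
      uAM = Unique-resp-↭ (↭-sym perm) uY
      uA = Unique-++ˡ A uAM
      uM = Unique-++ʳ A uAM
      disjoint : ∀ {B C : List (Fin N)} → Unique (B ++ C) → ∀ {w} → w ∈ B → w ∉ C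
      disjoint {b ∷ B} (b∉ ∷ _) (here refl) w∈C = All.lookup b∉ (∈-++⁺ʳ B w∈C) refl
      disjoint {b ∷ B} (_ ∷ u) (there w∈B) w∈C = disjoint u w∈B w∈C
      M⊆Y : ∀ {w} → w ∈ flat M → w ∈ Y
      M⊆Y w∈ = ∈-resp-↭ perm (∈-++⁺ʳ A w∈)
      A⊆Y : ∀ {w} → w ∈ A → w ∈ Y
      A⊆Y w∈ = ∈-resp-↭ perm (∈-++⁺ˡ w∈)
      M≤j : length M ≤ j
      M≤j = ≮⇒≥ λ j<M → nofan (fan! j<M (pick {ys = concatMap (λ y → redIn y Pth) F} uP (small j<M)))
        where
        F = flat (take k M)
        small : k ≤ length M → length (concatMap (λ y → redIn y Pth) F) < length Pth
        small k≤M = ≤-<-trans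
          (length-concatMap-≤ (λ y → redIn y Pth) F (suc (2 * j)) (λ y∈ → few (M⊆Y (flat-take-⊆ k M y∈))))
          (subst₂ _<_ (cong (_* suc (2 * j)) (sym (trans (length-flat (take k M)) (cong (2 *_) (length-take-≤ {xs = M} k≤M)))))
            (sym lenP) (pairs-in-path j))
        fan! : k ≤ length M → (∃[ x ] x ∈ Pth × x ∉ concatMap (λ y → redIn y Pth) F) → BlueFan k
        fan! k≤M (x , x∈ , x∉) = x , take k M , ≤-reflexive (sym (length-take-≤ {xs = M} k≤M)) , Allₚ.take⁺ k blM ,
          (λ {y} y∈ → Bl-sym (decidable-stable (Bl? y x)
            (λ ¬b → x∉ (∈-concatMap (λ y → redIn y Pth) y∈ (∈-filter⁺ (¬? ∘ Bl? y) x∈ ¬b))))) ,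
          flat-take-unique k M uM
      fewW : ∀ {w} → w ∈ flat M → length (blueIn w A) ≤ 3 * k
      -- If `w` had `k` blue neighbours in `A`, they could be matched in blue into its blue
      -- neighbours on the path: a fan with centre `w`.
      fewW {w} w∈ = ≤-trans (≤-pred (≰⇒> λ k≤ → nofan (fanFromBipartite k w (blueIn w A) (blueIn w Pth) (suc (2 * j))
          (Uniqueₚ.filter⁺ (Bl? w) uA) (Uniqueₚ.filter⁺ (Bl? w) uP)
          (λ s∈ s∈P → disj (A⊆Y (proj₁ (∈-filter⁻ (Bl? w) {xs = A} s∈))) (proj₁ (∈-filter⁻ (Bl? w) {xs = Pth} s∈P)))
          (λ s∈ → proj₂ (∈-filter⁻ (Bl? w) {xs = A} s∈)) (λ p∈ → proj₂ (∈-filter⁻ (Bl? w) {xs = Pth} p∈))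
          k≤ fewS
          (path-blue-room j (length (redIn w Pth)) (length (blueIn w Pth))
            (≤-reflexive (trans (sym lenP) (length-filter-¬ (Bl? w) Pth))) (few (M⊆Y w∈))))))
          (≤-trans (n≤1+n j) (m≤m+n k (k + (k + 0))))
        where
        fewS : ∀ {s} → s ∈ blueIn w A → length (redIn s (blueIn w Pth)) ≤ suc (2 * j)
        fewS {s} s∈ = ≤-trans (length-⊆ (Uniqueₚ.filter⁺ (¬? ∘ Bl? s) (Uniqueₚ.filter⁺ (Bl? w) uP))
            λ z∈ → let (z∈′ , r) = ∈-filter⁻ (¬? ∘ Bl? s) {xs = blueIn w Pth} z∈ in
              ∈-filter⁺ (¬? ∘ Bl? s) (proj₁ (∈-filter⁻ (Bl? w) {xs = Pth} z∈′)) r)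
          (few (A⊆Y (proj₁ (∈-filter⁻ (Bl? w) {xs = A} s∈))))

  -- The vertex `u₁` is suppressed. The image of `p`, `u₂` and the later inner vertices still has
  -- `4k²` vertices, with `p` in place of `u₁`. If there is no copy of the full graph, no outside
  -- vertex can be inserted, and `few-red` feeds `blueToPath`.
  longPath : ∀ p u₁ u₂ us t → Path _~_ p (u₁ ∷ u₂ ∷ us) t → Unique (p ∷ u₁ ∷ u₂ ∷ us ++ t ∷ []) →
    Sus p (u₁ ∷ u₂ ∷ us) t → length (u₁ ∷ u₂ ∷ us) ≡ 4 * (k * k) →
    (∀ {H′ L′} → IsSparse ℓ H′ L′ → length L′ < m → Embedding.Emb H′ c L′) → Emb L
  longPath p u₁ u₂ us t (pu₁ ∷ u₁u₂ ∷ π) ((p≢u₁ ∷ p≢u₂ ∷ p∉) ∷ u₁∉ ∷ uPath) sus@(nb ∷ _) len ih =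
      decidable-stable (emb? L) λ ¬emb → ¬emb (extendPath ¬emb (ih (suppress-sparse sp (~-sym pu₁) u₁u₂ nb)
        (length-without (uniq sp) (supp sp u₁u₂))))
    where
    open Suppress H u₁ p u₂ p≢u₂
    open Remove u₁
    L′ = without L
    interior = u₁ ∷ u₂ ∷ us
    path⊆ : ∀ {q vs t} → Path _~_ q vs t → ∀ {v} → v ∈ q ∷ vs ++ t ∷ [] → v ∈ L
    path⊆ (last r) (here refl) = supp sp r
    path⊆ (last r) (there (here refl)) = supp sp (~-sym r)
    path⊆ (r ∷ ρ) (here refl) = supp sp r
    path⊆ (r ∷ ρ) (there v∈) = path⊆ ρ v∈
    short⊆L′ : ∀ {v} → v ∈ p ∷ u₂ ∷ us ++ t ∷ [] → v ∈ L′
    short⊆L′ (here refl) = ∈-without (supp sp pu₁) p≢u₁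
    short⊆L′ (there v∈) = ∈-without (path⊆ π v∈) (λ e → All.lookup u₁∉ v∈ (sym e))
    uShort : Unique (p ∷ u₂ ∷ us ++ t ∷ [])
    uShort = (p≢u₂ ∷ p∉) ∷ uPath
    shortPath : Path (λ a b → adj suppress a b ≡ true) p (u₂ ∷ us) t
    shortPath = suppress⁺ (inj₂ (inj₁ (refl , refl))) ∷ keep π (λ v∈ e → All.lookup u₁∉ v∈ (sym e))
      where
      keep : ∀ {q vs t} → Path _~_ q vs t → (∀ {v} → v ∈ q ∷ vs ++ t ∷ [] → v ≢ u₁) →
        Path (λ a b → adj suppress a b ≡ true) q vs t
      keep (last r) ne = last (suppress⁺ (inj₁ (r , ne (here refl) , ne (there (here refl)))))
      keep (r ∷ ρ) ne = suppress⁺ (inj₁ (r , ne (here refl) , ne (there (here refl)))) ∷ keep ρ (ne ∘ there)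
    extendPath : ¬ Emb L → Embedding.Emb suppress c L′ → Emb L
    extendPath ¬emb (f , pe) = blueToPath Pth Y (Unique-++ˡ Pth (subst Unique (map-++ f (p ∷ u₂ ∷ us) (t ∷ [])) uImage))
        (trans (length-map f (p ∷ u₂ ∷ us)) len) (Uniqueₚ.filter⁺ out? (Uniqueₚ.allFin⁺ N)) lenY
        (λ y∈ y∈P → out y∈ (image⊆ (there-Pth y∈P))) fewRed f
      where
      open Embedding suppress c using () renaming (inj to inj′; red to red′)
      Pth = map f (p ∷ u₂ ∷ us)
      image = map f (p ∷ u₂ ∷ us ++ t ∷ [])
      uImage : Unique image
      uImage = Unique-map f (λ a b → inj′ pe (short⊆L′ a) (short⊆L′ b)) uShort
      image⊆ : ∀ {z} → z ∈ image → z ∈ map f L′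
      image⊆ z∈ with ∈-map⁻ f z∈
      ... | w , w∈ , refl = ∈-map⁺ f (short⊆L′ w∈)
      image≡ : map f us ++ f t ∷ [] ≡ map f (us ++ t ∷ [])
      image≡ = sym (map-++ f us (t ∷ []))
      there-Pth : ∀ {z} → z ∈ Pth → z ∈ image
      there-Pth {z} z∈ = subst (z ∈_) (sym (map-++ f (p ∷ u₂ ∷ us) (t ∷ []))) (∈-++⁺ˡ z∈)
      out? : Decidable (λ y → y ∉ map f L′)
      out? y = ¬? (y ∈? map f L′)
      Y = filter out? (allFin N)
      out : ∀ {y} → y ∈ Y → y ∉ map f L′
      out y∈ = proj₂ (∈-filter⁻ out? {xs = allFin N} y∈)
      lenY : n ≤ length Y
      lenY = outside-large (length L′) (length Y) m n N hN
        (subst₂ _≤_ (length-allFin N) (trans (length-++ (map f L′)) (cong (_+ length Y) (length-map f L′)))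
          (length-⊆ (Uniqueₚ.allFin⁺ N) (λ {y} _ → cover y)))
        (length-without (uniq sp) (supp sp u₁u₂)) m≤n
        where
        cover : ∀ y → y ∈ map f L′ ++ Y
        cover y with y ∈? map f L′
        ... | yes q = ∈-++⁺ˡ q
        ... | no ¬q = ∈-++⁺ʳ (map f L′) (∈-filter⁺ out? (∈-allFin y) ¬q)
      redPath : Path RedEdge (f p) (map f (u₂ ∷ us)) (f t)
      redPath = map-path f (λ {a} {b} _ e → red′ pe (supp (suppress-sparse sp (~-sym pu₁) u₁u₂ nb) e)
        (supp (suppress-sparse sp (~-sym pu₁) u₁u₂ nb) (Degree.~-sym suppress e)) e) shortPath
      Q? : Decidable (λ v → v ∉ interior)
      Q? v = ¬? (v ∈? interior)
      Q = filter Q? L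
      Q⊆L′ : ∀ {v} → v ∈ Q → v ∈ L′
      Q⊆L′ v∈ = let (v∈L , v∉) = ∈-filter⁻ Q? {xs = L} v∈ in ∈-without v∈L (λ e → v∉ (here e))
      peQ : Embeds Q f
      peQ = record
        { inj = λ a b → inj′ pe (Q⊆L′ a) (Q⊆L′ b)
        ; red = λ a b e → red′ pe (Q⊆L′ a) (Q⊆L′ b)
            (suppress⁺ (inj₁ (e , proj₂ (∈-without⁻ {L} (Q⊆L′ a)) , proj₂ (∈-without⁻ {L} (Q⊆L′ b))))) }
      p∈Q : p ∈ Q
      p∈Q = ∈-filter⁺ Q? (supp sp pu₁) λ { (here e) → p≢u₁ e ; (there (here e)) → p≢u₂ e
                                         ; (there (there p∈)) → All.lookup p∉ (∈-++⁺ˡ p∈) refl }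
      t∈Q : t ∈ Q
      t∈Q = ∈-filter⁺ Q? (path⊆ π (there (∈-++⁺ʳ us (here refl))))
        λ { (here e) → All.lookup u₁∉ (there (∈-++⁺ʳ us (here refl))) (sym e) ; (there t∈) → tail∉ uPath t∈ }
        where
        tail∉ : ∀ {vs} → Unique (vs ++ t ∷ []) → t ∉ vs
        tail∉ {v ∷ vs} (v∉ ∷ _) (here refl) = All.lookup v∉ (∈-++⁺ʳ vs (here refl)) refl
        tail∉ {v ∷ vs} (_ ∷ u) (there t∈) = tail∉ u t∈
      fewRed : ∀ {y} → y ∈ Y → length (redIn y Pth) ≤ suc (2 * j)
      fewRed {y} y∈ = Reroute.few-red c y j nofan (f p) (map f (u₂ ∷ us)) (f t) redPath
          (λ {z} z∈ e → out y∈ (subst (_∈ map f L′) (sym e) (image⊆ (subst (z ∈_) (cong (λ w → f p ∷ f u₂ ∷ w) image≡) z∈))))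
          (subst (λ w → Unique (f u₂ ∷ w)) (sym image≡) (tailU uImage)) no-ins
        where
        tailU : ∀ {z} {zs : List (Fin N)} → Unique (z ∷ zs) → Unique zs
        tailU (_ ∷ u) = u
        -- A red path through `y` and the old inner images, in whatever order, carries the full
        -- interior `u₁ ∷ u₂ ∷ us`; the rest keeps its images.
        no-ins : Reroute.NoInsertion c y (f p) (map f (u₂ ∷ us)) (f t)
        no-ins zs ρ perm = ¬emb (placePath {zs = zs} Q f peQ p∈Q t∈Q refl refl
            (λ v∈ v∈Q → proj₂ (∈-filter⁻ Q? {xs = L} v∈Q) v∈) uInt
            (λ z∈ → fresh (∈-resp-↭ perm z∈)) (Unique-resp-↭ (↭-sym perm) uNew)
            (sym (trans (↭-length perm) (cong suc (length-map f (u₂ ∷ us))))) ρ sus cover)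
          where
          uInt : Unique interior
          uInt = Unique-++ˡ interior (u₁∉ ∷ uPath)
          uNew : Unique (y ∷ map f (u₂ ∷ us))
          uNew = All.tabulate (λ z∈ e → out y∈ (subst (_∈ map f L′) (sym e) (image⊆ (there-Pth (there z∈))))) ∷
            tailU (Unique-++ˡ Pth (subst Unique (map-++ f (p ∷ u₂ ∷ us) (t ∷ [])) uImage))
          fresh : ∀ {z} → z ∈ y ∷ map f (u₂ ∷ us) → z ∉ map f Q
          fresh (here refl) z∈Q with ∈-map⁻ f z∈Q
          ... | w , w∈ , e = out y∈ (subst (_∈ map f L′) (sym e) (∈-map⁺ f (Q⊆L′ w∈)))
          fresh (there z∈) z∈Q with ∈-map⁻ f z∈Q | ∈-map⁻ f z∈
          ... | w , w∈ , e | v , v∈ , e′ = proj₂ (∈-filter⁻ Q? {xs = L} w∈) (there (subst (_∈ u₂ ∷ us)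
                  (inj′ pe (short⊆L′ (there (∈-++⁺ˡ v∈))) (Q⊆L′ w∈) (trans (sym e′) e)) v∈))
          cover : ∀ {v} → v ∈ L → v ∈ interior ⊎ v ∈ Q
          cover {v} v∈ with v ∈? interior
          ... | yes q = inj₁ q
          ... | no ¬q = inj₂ (∈-filter⁺ Q? v∈ ¬q)

-- Graphs with few leaves and short suspended paths

-- `Ess` is a parameter because of cycles: they have no vertex of degree ≠ 2, and an arbitrary
-- vertex serves instead.
module Routes {n : ℕ} (H : Graph n) (Ess : Fin n → Set) (Ess? : Decidable Ess) where

  open Degree H
  open Suspended H

  record Route (u : Fin n) : Set where
    constructor route
    field
      {between} : List (Fin n)
      {end}     : Fin n
      essential : Ess end
      inner     : All (¬_ ∘ Ess) (u ∷ between)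
      path      : Path _~_ u between end
      distinct  : Unique (u ∷ between ++ end ∷ [])

  suffix : ∀ {u v vs a} → Ess a → All (¬_ ∘ Ess) (v ∷ vs) → Path _~_ v vs a → Unique (v ∷ vs ++ a ∷ []) →
    u ∈ v ∷ vs → Route u
  suffix ea ne π un (here refl) = route ea ne π un
  suffix ea (_ ∷ ne) (_ ∷ π) (_ ∷ un) (there u∈) = suffix ea ne π un u∈

  -- A walk is turned into a path from its end: if the new vertex already lies on the route built so
  -- far, the suffix from that vertex is taken.
  toEssential : ∀ {u w} → Reachable H u w → Ess w → Ess u ⊎ Route u
  toEssential here ew = inj₁ ew
  toEssential {u} (step {v = v} e r) ew with Ess? u
  ... | yes eu = inj₁ eu
  ... | no ¬eu with toEssential r ew
  ... | inj₁ ev = inj₂ (route ev (¬eu ∷ []) (last e) ((~-irrefl e ∷ []) ∷ [] ∷ []))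
  ... | inj₂ (route {vs} {a} ea ne π un) with u ∈? v ∷ vs
  ... | yes u∈ = inj₂ (suffix ea ne π un u∈)
  ... | no u∉ = inj₂ (route ea (¬eu ∷ ne) (e ∷ π) (All.tabulate fresh ∷ un))
    where
    fresh : ∀ {z} → z ∈ v ∷ vs ++ a ∷ [] → u ≢ z
    fresh z∈ refl with ∈-++⁻ (v ∷ vs) z∈
    ... | inj₁ u∈ = u∉ u∈
    ... | inj₂ (here refl) = ¬eu ea

  only-two : ∀ {v x y} → deg v ≡ 2 → v ~ x → v ~ y → x ≢ y → ∀ {w} → v ~ w → w ≡ x ⊎ w ≡ y
  only-two {v} {x} {y} d vx vy x≢y {w} vw with w ≟ᶠ x | w ≟ᶠ y
  ... | yes e | _     = inj₁ e
  ... | no _  | yes e = inj₂ e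
  ... | no w≢x | no w≢y = contradiction
    (length-⊆ {xs = w ∷ x ∷ y ∷ []} ((w≢x ∷ w≢y ∷ []) ∷ (x≢y ∷ []) ∷ [] ∷ [])
      λ { (here refl) → ∈-nbrs vw ; (there (here refl)) → ∈-nbrs vx ; (there (there (here refl))) → ∈-nbrs vy })
    (<⇒≱ (≤-reflexive (cong suc d)))

  headOr-path : ∀ {p us t} → Path _~_ p us t → p ~ headOr us t
  headOr-path (last r) = r
  headOr-path (r ∷ _)  = r

  headOr-∈ : ∀ (us : List (Fin n)) t → headOr us t ∈ us ++ t ∷ []
  headOr-∈ []      t = here refl
  headOr-∈ (u ∷ _) t = here refl

  record Prefix (q : ℕ) (p : Fin n) (vs : List (Fin n)) (a : Fin n) : Set where
    constructor prefixed
    field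
      {us}   : List (Fin n)
      {t}    : Fin n
      len    : length us ≡ q
      path   : Path _~_ p us t
      sus    : Sus p us t
      unique : Unique (p ∷ us ++ t ∷ [])
      sub    : ∀ {x} → x ∈ us ++ t ∷ [] → x ∈ vs ++ a ∷ []

  prefix : ∀ q {p vs a} → Path _~_ p vs a → Unique (p ∷ vs ++ a ∷ []) → (∀ {v} → v ∈ vs → deg v ≡ 2) → q ≤ length vs →
    Prefix q p vs a
  prefix zero {p} {vs} {a} π un d2 _ = prefixed refl (last (headOr-path π)) [] ((~-irrefl (headOr-path π) ∷ []) ∷ [] ∷ [])
    λ { (here refl) → headOr-∈ vs a }
  prefix (suc q) {p} {v ∷ vs} {a} (r ∷ π) (p∉ ∷ un) d2 (s≤s q≤)
    with prefix q π un (d2 ∘ there) q≤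
  ... | prefixed {us} {t} len ρ sus u sub = prefixed (cong suc len) (r ∷ ρ)
      (only-two (d2 (here refl)) (~-sym r) (headOr-path ρ) (All.lookup p∉ (there (sub (headOr-∈ us t)))) ∷ sus)
      (All.tabulate (λ z∈ → All.lookup p∉ (sub′ z∈)) ∷ u) sub′
    where
    sub′ : ∀ {x} → x ∈ v ∷ us ++ t ∷ [] → x ∈ v ∷ vs ++ a ∷ []
    sub′ (here e)   = here e
    sub′ (there x∈) = there (sub x∈)

  -- The continuation of a walk that comes to `y` from `x`; the default `x` is never reached when
  -- `y` has degree 2.
  other : Fin n → Fin n → Fin n
  other x y = headOr (filter (λ w → ¬? (w ≟ᶠ x)) (nbrs y)) x

  other-≡ : ∀ {p x y} → deg y ≡ 2 → y ~ x → y ~ p → x ≢ p → other x y ≡ p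
  other-≡ {p} {x} {y} d yx yp x≢p = go (filter not-x? (nbrs y)) (λ w∈ → ∈-filter⁻ not-x? {xs = nbrs y} w∈)
      (∈-filter⁺ not-x? (∈-nbrs yp) (x≢p ∘ sym))
    where
    not-x? : Decidable (_≢ x)
    not-x? w = ¬? (w ≟ᶠ x)
    go : ∀ xs → (∀ {w} → w ∈ xs → w ∈ nbrs y × w ≢ x) → p ∈ xs → headOr xs x ≡ p
    go (w ∷ xs) ch _ with ch (here refl)
    ... | w∈ , w≢x with only-two d yx yp x≢p (∈-nbrs⁻ w∈)
    ... | inj₁ e = contradiction e w≢x
    ... | inj₂ e = e

  next : Fin n × Fin n → Fin n × Fin n
  next (x , y) = y , other x y

  walk : ℕ → Fin n × Fin n → Fin n × Fin n
  walk zero    d = d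
  walk (suc i) d = next (walk i d)

  -- The walk starts with the last edge of the path and follows it backwards.
  walk-back : ∀ {p vs a} → Path _~_ p vs a → Unique (p ∷ vs ++ a ∷ []) → (∀ {v} → v ∈ vs → deg v ≡ 2) →
    ∃[ b ] a ~ b × walk (length vs) (a , b) ≡ (headOr vs a , p)
  walk-back {p} (last r) _ _ = p , ~-sym r , refl
  walk-back {p} {v ∷ vs} {a} (r ∷ π) (p∉ ∷ un) d2 with walk-back π un (d2 ∘ there)
  ... | b , ab , eq = b , ab , trans (cong next eq) (cong (v ,_) (other-≡ (d2 (here refl)) (headOr-path π) (~-sym r)
      (λ e → All.lookup p∉ (there (headOr-∈ vs a)) (sym e))))

  open Darts H

  -- Read backwards, the route of a nonessential vertex is the forced walk from a dart leaving an
  -- essential vertex. So these darts, each followed for `q` vertices, cover everything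
  -- nonessential.
  essential-count : ∀ q L → Unique L → (∀ {u v} → u ~ v → u ∈ L) → (∀ {v} → v ∈ L → ¬ Ess v → deg v ≡ 2) →
    (∀ {u} → u ∈ L → ¬ Ess u → Σ[ r ∈ Route u ] length (Route.between r) < q) →
    length L ≤ length (filter Ess? L) + degSum (filter Ess? L) * q
  essential-count q L uL sup d2 short = subst (_≤ length E + degSum E * q) (sym (length-filter-¬ Ess? L))
      (+-monoʳ-≤ (length E) (≤-trans (length-⊆ (Uniqueₚ.filter⁺ (¬? ∘ Ess?) uL) covered)
        (subst (λ z → length (concatMap visited (darts E)) ≤ z * q) (length-darts E)
          (length-concatMap-≤ visited (darts E) q (λ {d} _ → ≤-reflexive (trans (length-map _ (upTo q)) (length-upTo q)))))))
    where
    E = filter Ess? L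
    visited : Fin n × Fin n → List (Fin n)
    visited d = map (λ i → proj₂ (walk i d)) (upTo q)
    end∈ : ∀ {p vs a} → Path _~_ p vs a → a ∈ L
    end∈ (last r) = sup (~-sym r)
    end∈ (_ ∷ π)  = end∈ π
    inner∈ : ∀ {p vs a} → Path _~_ p vs a → ∀ {v} → v ∈ vs → v ∈ L
    inner∈ (r ∷ π) (here refl) = sup (~-sym r)
    inner∈ (r ∷ π) (there v∈)  = inner∈ π v∈
    visit : ∀ {u} → (Σ[ r ∈ Route u ] length (Route.between r) < q) → u ∈ concatMap visited (darts E)
    visit {u} (route {vs} {a} ea (_ ∷ ne) π un , lt)
      with walk-back π un (λ v∈ → d2 (inner∈ π v∈) (All.lookup ne v∈))
    ... | b , ab , eq = ∈-concatMap visited (∈-darts (∈-filter⁺ Ess? (end∈ π) ea) ab)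
      (subst (_∈ visited (a , b)) (cong proj₂ eq) (∈-map⁺ (λ i → proj₂ (walk i (a , b))) (∈-upTo⁺ lt)))
    covered : ∀ {u} → u ∈ filter (¬? ∘ Ess?) L → u ∈ concatMap visited (darts E)
    covered u∈ = let (u∈L , ¬e) = ∈-filter⁻ (¬? ∘ Ess?) {xs = L} u∈ in visit (short u∈L ¬e)

module EssentialDegrees {n : ℕ} (H : Graph n) where

  open Degree H

  ess? : Decidable (λ v → deg v ≢ 2)
  ess? v = ¬? (deg v ℕ.≟ 2)

  one? : Decidable (λ v → deg v ≡ 1)
  one? v = deg v ℕ.≟ 1

  private
    shift₁ : ∀ a b c d → a + b ≡ c + d → 2 + a + b ≡ c + (2 + d)
    shift₁ a b c d h = trans (cong (2 +_) h) (eq c d)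
      where
      eq : ∀ c d → 2 + (c + d) ≡ c + (2 + d)
      eq = solve-∀
    shift₂ : ∀ x a b c d → a + b ≡ c + d → x + a + (2 + b) ≡ x + c + (2 + d)
    shift₂ x a b c d h = trans (eq x a b) (trans (cong (λ z → 2 + (x + z)) h) (sym (eq x c d)))
      where
      eq : ∀ x a b → x + a + (2 + b) ≡ 2 + (x + (a + b))
      eq = solve-∀
    double : ∀ m → 2 * suc m ≡ 2 + 2 * m
    double = solve-∀
    triple : ∀ m → 3 * suc m ≡ 3 + 3 * m
    triple = solve-∀

  -- Vertices of degree 2 contribute nothing to the sum of `deg v - 2`; the terms are moved across
  -- to avoid subtraction.
  degSum-essential : ∀ L → degSum L + 2 * length (filter ess? L) ≡ degSum (filter ess? L) + 2 * length L
  degSum-essential [] = refl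
  degSum-essential (v ∷ L) = byDegree (deg v ℕ.≟ 2)
    where
    E = filter ess? L
    Goal : List (Fin n) → Set
    Goal E′ = degSum (v ∷ L) + 2 * length E′ ≡ degSum E′ + 2 * length (v ∷ L)
    byDegree : Dec (deg v ≡ 2) → Goal (filter ess? (v ∷ L))
    byDegree (yes d) = subst Goal (sym (filter-reject ess? {xs = L} (λ ne → ne d)))
      (trans (cong (λ z → z + degSum L + 2 * length E) d)
        (trans (shift₁ (degSum L) (2 * length E) (degSum E) (2 * length L) (degSum-essential L))
          (cong (degSum E +_) (sym (double (length L))))))
    byDegree (no ne) = subst Goal (sym (filter-accept ess? {xs = L} ne))
      (trans (cong (deg v + degSum L +_) (double (length E)))
        (trans (shift₂ (deg v) (degSum L) (2 * length E) (degSum E) (2 * length L) (degSum-essential L))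
          (cong (deg v + degSum E +_) (sym (double (length L))))))

  -- Each vertex counted on the left has degree at least 3 or is a leaf, whose degree 1 is
  -- compensated by 2.
  essential-heavy : ∀ L → (∀ {v} → v ∈ L → deg v ≢ 0) →
    3 * length (filter ess? L) ≤ degSum (filter ess? L) + 2 * length (filter one? L)
  essential-heavy [] _ = z≤n
  essential-heavy (v ∷ L) pos = byDegree (deg v) refl
    where
    E = filter ess? L
    O = filter one? L
    ih : 3 * length E ≤ degSum E + 2 * length O
    ih = essential-heavy L (pos ∘ there)
    Goal : List (Fin n) → List (Fin n) → Set
    Goal E O = 3 * length E ≤ degSum E + 2 * length O
    byDegree : ∀ d → deg v ≡ d → Goal (filter ess? (v ∷ L)) (filter one? (v ∷ L))
    byDegree 0 d = contradiction d (pos (here refl))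
    byDegree 1 d = subst₂ Goal (sym (filter-accept ess? {xs = L} (λ e → contradiction (trans (sym d) e) λ ())))
      (sym (filter-accept one? {xs = L} d))
      (subst₂ _≤_ (sym (triple (length E))) (trans (rearrange (degSum E) (length O))
        (cong (λ z → z + degSum E + 2 * suc (length O)) (sym d))) (+-monoʳ-≤ 3 ih))
      where
      rearrange : ∀ a b → 3 + (a + 2 * b) ≡ 1 + a + 2 * suc b
      rearrange = solve-∀
    byDegree 2 d = subst₂ Goal (sym (filter-reject ess? {xs = L} (λ ne → ne d)))
      (sym (filter-reject one? {xs = L} (λ e → contradiction (trans (sym d) e) λ ()))) ih
    byDegree (suc (suc (suc d′))) d = subst₂ Goal
      (sym (filter-accept ess? {xs = L} (λ e → contradiction (trans (sym d) e) λ ())))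
      (sym (filter-reject one? {xs = L} (λ e → contradiction (trans (sym d) e) λ ())))
      (subst₂ _≤_ (sym (triple (length E))) (sym (+-assoc (deg v) (degSum E) (2 * length O)))
        (subst (3 ≤_) (sym d) (s≤s (s≤s (s≤s z≤n))) ⊕ ih))

  deg≤degSum : ∀ {v} xs → v ∈ xs → deg v ≤ degSum xs
  deg≤degSum (x ∷ xs) (here refl) = m≤m+n (deg x) _
  deg≤degSum (x ∷ xs) (there v∈)  = ≤-trans (deg≤degSum xs v∈) (m≤n+m _ (deg x))

module Main {n N : ℕ} (j ℓ : ℕ) (hN : suc N ≡ 2 * n)
  (hn : 36 * (suc j * suc j * (suc j * suc j)) ≤ n) (hℓ : 330 * (suc j * suc j * ℓ) ≤ n)
  (c : Colouring N) (nofan : ¬ Blue.BlueFan c (suc j)) (f₀ : Fin n → Fin N) where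

  private
    k q : ℕ
    k = suc j
    q = 4 * (k * k)

  IH : ℕ → Set
  IH m = ∀ {H′ : Graph n} {L′} → IsSparse ℓ H′ L′ → length L′ < m → Embedding.Emb H′ c L′

  module Step (H : Graph n) (L : List (Fin n)) (sp : IsSparse ℓ H L) (m≤n : length L ≤ n) (ih : IH (length L)) where

    open Degree H
    open Embedding H c
    open EssentialDegrees H

    module _ (Ess : Fin n → Set) (Ess? : Decidable Ess) (d2 : ∀ {v} → v ∈ L → ¬ Ess v → deg v ≡ 2)
             {x₀ : Fin n} (x₀∈ : x₀ ∈ L) (ex₀ : Ess x₀) where

      open Routes H Ess Ess?

      fromPrefix : ∀ {p vs a} → Prefix q p vs a → Emb L
      fromPrefix {p} (prefixed {us} {t} len π sus u _) = go us len π sus u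
        where
        go : ∀ us → length us ≡ q → Path _~_ p us t → Suspended.Sus H p us t → Unique (p ∷ us ++ t ∷ []) → Emb L
        go [] len _ _ _ = contradiction (path-length-≥2 j) (subst (λ z → ¬ 2 ≤ z) len λ ())
        go (_ ∷ []) len _ _ _ = contradiction (path-length-≥2 j) (subst (λ z → ¬ 2 ≤ z) len λ { (s≤s ()) })
        go (u₁ ∷ u₂ ∷ us) len π sus u = LongPath.longPath j ℓ hN (fourth-power⇒square j n hn) (excess-bound j ℓ n hℓ)
          c nofan H L sp m≤n p u₁ u₂ us t π u sus len ih

      shortRoutes : ¬ Emb L → ∀ {u} → u ∈ L → ¬ Ess u → Σ[ r ∈ Route u ] length (Route.between r) < q
      shortRoutes ¬emb {u} u∈ ¬eu = check (toEssential (conn sp u∈ x₀∈) ex₀)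
        where
        inL : ∀ {p vs a} → Path _~_ p vs a → ∀ {v} → v ∈ vs → v ∈ L
        inL (r ∷ π) (here refl) = supp sp (~-sym r)
        inL (r ∷ π) (there v∈)  = inL π v∈
        check : Ess u ⊎ Route u → Σ[ r ∈ Route u ] length (Route.between r) < q
        check (inj₁ eu) = contradiction eu ¬eu
        check (inj₂ r@(route {vs} {a} ea (_ ∷ ne) π un)) = r , ≰⇒> λ q≤ →
          ¬emb (fromPrefix (prefix q π un (λ v∈ → d2 (inL π v∈) (All.lookup ne v∈)) q≤))

      countL : ¬ Emb L → length L ≤ length (filter Ess? L) + degSum (filter Ess? L) * q
      countL ¬emb = essential-count q L (uniq sp) (supp sp) d2 (shortRoutes ¬emb)

    greedy : ∀ Δ → (∀ {v} → v ∈ L → deg v ≤ Δ) → Δ * (6 * k) + length L ≤ N → 4 * length L + 3 * ℓ ≤ N → Emb L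
    greedy Δ = Sparse.greedyEmb j ℓ H c L nofan Δ f₀ (uniq sp) (edges sp)

    isolated : ∀ {v} → v ∈ L → deg v ≡ 0 → Emb L
    isolated {v} v∈ d = f₀ , record
        { inj = λ a b _ → trans (only a) (sym (only b))
        ; red = λ a _ e → contradiction e (lonely (only a)) }
      where
      none : ∀ {w} → ¬ (v ~ w)
      none e = contradiction (∈-length (∈-nbrs e)) (subst (λ z → ¬ 0 < z) (sym d) λ ())
      lonely : ∀ {a b} → a ≡ v → ¬ (a ~ b)
      lonely refl = none
      only : ∀ {w} → w ∈ L → w ≡ v
      only w∈ = Reachable-closed {H = H} (_≡ v) (λ { refl e → contradiction e none }) (conn sp v∈ w∈) refl

    -- Here the graph is a cycle. Cut at `x₀`, it has two darts to follow, so without a long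
    -- suspended path it has at most `1 + 2q` vertices.
    allTwo : ∀ {x₀} → x₀ ∈ L → (∀ {v} → v ∈ L → deg v ≡ 2) → Emb L
    allTwo {x₀} x₀∈ d2 = decidable-stable (emb? L) λ ¬emb → ¬emb (fits (countL (_≡ x₀) (_≟ᶠ x₀) (λ v∈ _ → d2 v∈) x₀∈ refl ¬emb))
      where
      E = filter (_≟ᶠ x₀) L
      E≤1 : length E ≤ 1
      E≤1 = length-⊆ {ys = x₀ ∷ []} (Uniqueₚ.filter⁺ (_≟ᶠ x₀) (uniq sp)) λ v∈ → here (proj₂ (∈-filter⁻ (_≟ᶠ x₀) {xs = L} v∈))
      sum≤2 : degSum E ≤ 2
      sum≤2 = small E E≤1 λ v∈ → d2 (proj₁ (∈-filter⁻ (_≟ᶠ x₀) {xs = L} v∈))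
        where
        small : ∀ xs → length xs ≤ 1 → (∀ {v} → v ∈ xs → deg v ≡ 2) → degSum xs ≤ 2
        small []       _ _ = z≤n
        small (x ∷ []) _ h = ≤-reflexive (trans (+-identityʳ (deg x)) (h (here refl)))
        small (_ ∷ _ ∷ _) (s≤s ()) _
      fits : length L ≤ length E + degSum E * q → Emb L
      fits h = greedy 2 (λ v∈ → ≤-reflexive (d2 v∈)) (cycle-degree-greedy (length L) n N j hN hn m≤)
          (cycle-greedy (length L) n N j ℓ hN hn hℓ m≤)
        where
        m≤ : length L ≤ 1 + 2 * q
        m≤ = ≤-trans h (E≤1 ⊕ *-monoˡ-≤ q sum≤2)

    fewLeaves : length (filter one? L) ≤ 2 * j → (∀ {v} → v ∈ L → deg v ≢ 0) → ∀ {x₀} → x₀ ∈ L → deg x₀ ≢ 2 → Emb L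
    fewLeaves few pos x₀∈ ex₀ = decidable-stable (emb? L) λ ¬emb → ¬emb (fits (countL (λ v → deg v ≢ 2) ess?
        (λ {v} _ ¬e → decidable-stable (deg v ℕ.≟ 2) ¬e) x₀∈ ex₀ ¬emb)
        (essential-bounds (length E) (degSum E) (length (filter one? L)) ℓ j
          (excess-at-essential (degSum L) (degSum E) (length E) (length L) ℓ (degSum-essential L) (edges sp))
          (essential-heavy L pos) few))
      where
      E = filter ess? L
      fits : length L ≤ length E + degSum E * q → length E ≤ 4 * j + 2 * ℓ × degSum E ≤ 8 * j + 6 * ℓ → Emb L
      fits h (E≤ , D≤) = greedy (8 * j + 6 * ℓ + 2) maxdeg (core-degree-greedy (length L) n N j ℓ hN hn hℓ m≤)
          (core-greedy (length L) n N j ℓ hN hn hℓ m≤)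
        where
        m≤ : length L ≤ 4 * j + 2 * ℓ + (8 * j + 6 * ℓ) * q
        m≤ = essential-size (length L) (length E) (degSum E) q j ℓ h E≤ D≤
        maxdeg : ∀ {v} → v ∈ L → deg v ≤ 8 * j + 6 * ℓ + 2
        maxdeg {v} v∈ with deg v ℕ.≟ 2
        ... | yes e = ≤-trans (≤-reflexive e) (m≤n+m 2 (8 * j + 6 * ℓ))
        ... | no ne = ≤-trans (deg≤degSum E (∈-filter⁺ ess? v∈ ne)) (≤-trans D≤ (m≤m+n _ 2))

    embeds : Emb L
    embeds = byLeaves (suc (2 * j) ≤? length (filter one? L))
      where
      byEssential : length (filter one? L) ≤ 2 * j → (∀ {v} → v ∈ L → deg v ≢ 0) → Dec (Any (λ v → deg v ≢ 2) L) → Emb L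
      byEssential few pos (yes p) = let (x , x∈ , ex) = find p in fewLeaves few pos x∈ ex
      byEssential few pos (no ¬p) = nonempty L refl
        where
        nonempty : ∀ xs → L ≡ xs → Emb L
        nonempty [] eq = f₀ , subst (λ z → Embeds z f₀) (sym eq) Embeds-[]
        nonempty (x ∷ xs) eq = allTwo (subst (x ∈_) (sym eq) (here refl))
          λ {v} v∈ → decidable-stable (deg v ℕ.≟ 2) (λ ne → ¬p (lose v∈ ne))
      byIsolated : length (filter one? L) ≤ 2 * j → Dec (Any (λ v → deg v ≡ 0) L) → Emb L
      byIsolated few (yes p) = let (x , x∈ , d) = find p in isolated x∈ d
      byIsolated few (no ¬p) = byEssential few (λ v∈ d → ¬p (lose v∈ d)) (any? ess? L)
      byLeaves : Dec (suc (2 * j) ≤ length (filter one? L)) → Emb L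
      byLeaves (yes many) = Leaves.manyLeaves j ℓ hN (fourth-power⇒square j n hn) (excess-bound j ℓ n hℓ)
        c nofan H L sp m≤n many ih
      byLeaves (no ¬many) = byIsolated (≤-pred (≰⇒> ¬many)) (any? (λ v → deg v ℕ.≟ 0) L)

  -- Strong induction on the number of vertices, with `fuel` as a strict bound for it.
  embedSparse : ∀ fuel {H : Graph n} {L} → IsSparse ℓ H L → length L ≤ n → length L < fuel → Embedding.Emb H c L
  embedSparse (suc fuel) {H} {L} sp m≤n (s≤s m≤fuel) = Step.embeds H L sp m≤n
    λ sp′ lt → embedSparse fuel sp′ (≤-trans (<⇒≤ lt) m≤n) (<-≤-trans lt m≤fuel)

-- The two bounds

true⇒T : ∀ {b} → b ≡ true → T b
true⇒T refl = tt

T⇒true : ∀ {b} → T b → b ≡ true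
T⇒true {true} _ = refl

module _ {n : ℕ} (G : Graph n) where

  open Degree G
  open Darts G

  private
    up : Fin n → Fin n → Bool
    up i i′ = (toℕ i <ᵇ toℕ i′) ∧ adj G i i′

    upDarts : List (Fin n) → List (Fin n × Fin n)
    upDarts = concatMap (λ i → map (i ,_) (filter (T? ∘ up i) (allFin n)))

    length-row : ∀ (b : Fin n → Bool) L → length (filter (λ p → T? (proj₁ p)) (map (λ i → b i , i) L)) ≡ length (filter (T? ∘ b) L)
    length-row b [] = refl
    length-row b (i ∷ L) with b i
    ... | true  = cong suc (length-row b L)
    ... | false = length-row b L

    length-upDarts : ∀ I → length (filter (λ p → T? (proj₁ p)) (concatMap (λ i → map (λ i′ → up i i′ , i′) (allFin n)) I))
      ≡ length (upDarts I)
    length-upDarts [] = refl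
    length-upDarts (i ∷ I) = trans
      (cong length (filter-++ (λ p → T? (proj₁ p)) (map (λ i′ → up i i′ , i′) (allFin n)) _))
      (trans (length-++ (filter (λ p → T? (proj₁ p)) (map (λ i′ → up i i′ , i′) (allFin n))))
        (trans (cong₂ _+_ (trans (length-row (up i) (allFin n)) (sym (length-map (i ,_) (filter (T? ∘ up i) (allFin n)))))
          (length-upDarts I)) (sym (length-++ (map (i ,_) (filter (T? ∘ up i) (allFin n)))))))

    ∈-upDarts : ∀ {a b} → toℕ a < toℕ b → a ~ b → (a , b) ∈ upDarts (allFin n)
    ∈-upDarts {a} {b} lt e = ∈-concatMap (λ i → map (i ,_) (filter (T? ∘ up i) (allFin n))) (∈-allFin a)
      (∈-map⁺ (a ,_) (∈-filter⁺ (T? ∘ up a) (∈-allFin b) (Equivalence.from T-∧ (<⇒<ᵇ lt , true⇒T e))))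

  -- `edgeCount` counts ascending pairs, and every dart is an ascending pair or the reverse of one.
  degSum≤2edges : degSum (allFin n) ≤ 2 * edgeCount G
  degSum≤2edges = subst₂ _≤_ (length-darts (allFin n))
    (trans (length-++ (upDarts (allFin n))) (trans (cong (length (upDarts (allFin n)) +_) (length-map swap (upDarts (allFin n))))
      (trans (cong (λ z → z + z) (sym (length-upDarts (allFin n)))) (cong (edgeCount G +_) (sym (+-identityʳ (edgeCount G)))))))
    (length-⊆ (darts-unique (Uniqueₚ.allFin⁺ n)) λ d∈ → split (proj₂ (∈-darts⁻ {allFin n} d∈)))
    where
    split : ∀ {a b} → a ~ b → (a , b) ∈ upDarts (allFin n) ++ map swap (upDarts (allFin n))
    split {a} {b} e with <-cmp (toℕ a) (toℕ b)
    ... | tri< lt _ _ = ∈-++⁺ˡ (∈-upDarts lt e)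
    ... | tri≈ _ eq _ = contradiction (Finₚ.toℕ-injective eq) (~-irrefl e)
    ... | tri> _ _ gt = ∈-++⁺ʳ (upDarts (allFin n)) (∈-map⁺ swap (∈-upDarts gt (~-sym e)))

  connected⇒sparse : Connected G → IsSparse (edgeCount G ∸ n) G (allFin n)
  connected⇒sparse con = record
    { uniq  = Uniqueₚ.allFin⁺ n
    ; supp  = λ {u} _ → ∈-allFin u
    ; conn  = λ {u} {v} _ _ → con u v
    ; edges = ≤-trans degSum≤2edges (2 ⊛ subst (λ z → edgeCount G ≤ z + (edgeCount G ∸ n)) (sym (length-allFin n)) (m≤n+m∸n _ n)) }

-- The extremal colouring: two red cliques of order at most `h = n - 1` with all edges between them
-- blue. Blue is bipartite and has no triangle, and a connected red graph stays on one side.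
module TwoSides (h M : ℕ) (M≤ : M ≤ h + h) where

  side : Fin M → Bool
  side x = toℕ x <ᵇ h

  split : Colouring M
  split = record { colour = λ x y → does (side x ≟ᵇ side y) ; csym = λ x y → comm (side x) (side y) }
    where
    comm : ∀ a b → does (a ≟ᵇ b) ≡ does (b ≟ᵇ a)
    comm true  true  = refl
    comm true  false = refl
    comm false true  = refl
    comm false false = refl

  red⇒same : ∀ {x y} → colour split x y ≡ true → side x ≡ side y
  red⇒same {x} {y} e with side x ≟ᵇ side y
  ... | yes p = p

  blue⇒differ : ∀ {x y} → colour split x y ≡ false → side x ≢ side y
  blue⇒differ {x} {y} e with side x ≟ᵇ side y
  ... | no ¬p = ¬p

  no-blue-fan : ∀ j → ¬ ContainsMono split false (fan (suc j))
  no-blue-fan j (f , _ , blue) = three (side (f zero)) (side (f u)) (side (f v))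
      (blue⇒differ {f zero} {f u} (blue zero u refl)) (blue⇒differ {f zero} {f v} (blue zero v refl))
      (blue⇒differ {f u} {f v} (blue u v uv))
    where
    k = suc j
    u v : Fin (suc (k + k))
    u = suc zero
    v = suc (k ↑ʳ zero)
    uv : adj (fan k) u v ≡ true
    uv = cong (_∨ fanRel k (toℕ v) 1) (T⇒true (≡⇒≡ᵇ (toℕ v) (1 + k) (cong suc (trans (Finₚ.toℕ-↑ʳ k zero) (+-identityʳ k)))))
    three : ∀ a b c → a ≢ b → a ≢ c → b ≢ c → ⊥
    three true  true  _     p _ _ = p refl
    three true  false true  _ q _ = q refl
    three true  false false _ _ r = r refl
    three false false _     p _ _ = p refl
    three false true  false _ q _ = q refl
    three false true  true  _ _ r = r refl

  -- The rank of a vertex within its side, which is below `h` because `M ≤ 2h`.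
  place : Bool → Fin M → ℕ
  place true  x = toℕ x
  place false x = toℕ x ∸ h

  place-inj : ∀ b {x y} → side x ≡ b → side y ≡ b → place b x ≡ place b y → x ≡ y
  place-inj true  _ _ e = Finₚ.toℕ-injective e
  place-inj false {x} {y} sx sy e = Finₚ.toℕ-injective (∸-cancelʳ-≡ (high x sx) (high y sy) e)
    where
    high : ∀ x → side x ≡ false → h ≤ toℕ x
    high x s = ≮⇒≥ λ lt → contradiction (trans (sym (T⇒true (<⇒<ᵇ lt))) s) λ ()

  place-< : ∀ b {x} → 0 < h → side x ≡ b → place b x < h
  place-< true  {x} _ s = <ᵇ⇒< (toℕ x) h (true⇒T s)
  place-< false {x} pos _ = m<n+o⇒m∸n<o (toℕ x) h {{>-nonZero pos}} (<-≤-trans (Finₚ.toℕ<n x) M≤)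

  no-red-copy : 0 < h → (G : Graph (suc h)) → Connected G → ¬ ContainsMono split true G
  no-red-copy pos G con (f , inj , red) = <⇒≱ (n<1+n h) (subst₂ _≤_
      (trans (length-map pl (allFin (suc h))) (length-allFin (suc h))) (length-upTo h)
      (length-⊆ (Uniqueₚ.map⁺ (λ {u} {v} e → inj (place-inj b (same u) (same v) e)) (Uniqueₚ.allFin⁺ (suc h))) sub))
    where
    b = side (f zero)
    same : ∀ u → side (f u) ≡ b
    same u = Reachable-closed {H = G} (λ w → side (f w) ≡ b)
      (λ {a} {a′} p e → trans (sym (red⇒same {f a} {f a′} (red a a′ e))) p) (con zero u) refl
    pl : Fin (suc h) → ℕ
    pl u = place b (f u)
    sub : ∀ {x} → x ∈ map pl (allFin (suc h)) → x ∈ upTo h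
    sub x∈ with ∈-map⁻ pl x∈
    ... | u , _ , refl = ∈-upTo⁺ (place-< b pos (same u))

upperBound : ∀ j n → 36 * suc j ^ 4 ≤ n → (G : Graph n) → Connected G →
  edgeCount G * (204 * suc j ^ 3 + 126 * suc j ^ 2) ≤ n * (204 * suc j ^ 3 + 126 * suc j ^ 2 + 1) →
  Arrows (2 * n ∸ 1) G (fan (suc j))
upperBound j n hn G con he c = byFan (contains? c false (fan (suc j)))
  where
  ℓ = edgeCount G ∸ n
  hn′ : 36 * (suc j * suc j * (suc j * suc j)) ≤ n
  hn′ = fourth-power n j hn
  1≤n : 1 ≤ n
  1≤n = ≤-trans (s≤s z≤n) (≤-trans (36 ⊛ s≤s {0} {j + j * suc j} z≤n) (fourth-power⇒square j n hn′))
  hN : suc (2 * n ∸ 1) ≡ 2 * n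
  hN = m+[n∸m]≡n (≤-trans 1≤n (m≤m+n n (n + 0)))
  -- A default map to start from; the host has a vertex 0 because `n ≥ 1`.
  f₀ : Fin n → Fin (2 * n ∸ 1)
  f₀ _ = Fin.fromℕ< {0} (∸-monoˡ-≤ 1 (1≤n ⊕ ≤-trans 1≤n (m≤m+n n 0)))
  byFan : Dec (ContainsMono c false (fan (suc j))) → ContainsMono c true G ⊎ ContainsMono c false (fan (suc j))
  byFan (yes fan!) = inj₂ fan!
  byFan (no ¬fan) = inj₁ (copy (Main.embedSparse j ℓ hN hn′
      (coefficient-bound ℓ n j (excess-scaled (edgeCount G) n (204 * suc j ^ 3 + 126 * suc j ^ 2) he))
      c (¬fan ∘ Blue.blueFan⇒contains c j) f₀ (suc (length (allFin n))) (connected⇒sparse G con)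
      (≤-reflexive (length-allFin n)) ≤-refl))
    where
    open Embedding G c
    copy : Emb (allFin n) → ContainsMono c true G
    copy (f , p) = f , (λ {u} {v} → inj p (∈-allFin u) (∈-allFin v)) , λ u v → red p (∈-allFin u) (∈-allFin v)

lowerBound : ∀ j n → 2 ≤ n → (G : Graph n) → Connected G → ∀ M → M < 2 * n ∸ 1 → ¬ Arrows M G (fan (suc j))
lowerBound j (suc (suc h)) (s≤s (s≤s z≤n)) G con M M< arrows =
  [ no-red-copy (s≤s z≤n) G con , no-blue-fan j ]′ (arrows split)
  where open TwoSides (suc h) M (below-two-cliques h M M<)

theorem1p5 : ∀ (k n : ℕ) → 1 ≤ k → 36 * k ^ 4 ≤ n →
    (G : Graph n) → Connected G →
    edgeCount G * (204 * k ^ 3 + 126 * k ^ 2) ≤ n * (204 * k ^ 3 + 126 * k ^ 2 + 1) →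
    RamseyNumberIs G (fan k) (2 * n ∸ 1)
theorem1p5 (suc j) n _ hn G con he = upperBound j n hn G con he , λ M _ M< → lowerBound j n 2≤n G con M M<
  where
  2≤n : 2 ≤ n
  2≤n = ≤-trans (s≤s (s≤s z≤n)) (≤-trans (36 ⊛ s≤s {0} {j + j * suc j} z≤n)
    (fourth-power⇒square j n (fourth-power n j hn)))
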